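{- Let $s,t$ be positive integers, let $\varepsilon\in\{1,-1\}$, and let \[ m=\frac{(s^4t+\varepsilon)^4-1}{s^4} \] be a square free integer with $m>1$ and $m\equiv 2,3 \pmod 4$. Let $\alpha=\sqrt[4]{m}$ and $K=\mathbb{Q}(\alpha)$. Then, up to equivalence, the only generators of power integral bases in $K$ are the elements $\vartheta=x\alpha+y\alpha^2+z\alpha^3$ with \[ (x,y,z)=(1,0,0)\quad\text{or}\quad (x,y,z)=\big((s^4t+\varepsilon)^2,\ \pm(s^4t+\varepsilon)s,\ s^2\big). \]
   Context: For a number field $K$ of degree $n$ with ring of integers $\mathbb{Z}_K$, an element $\gamma\in\mathbb{Z}_K$ generates a power integral basis if $\{1,\gamma,\ldots,\gamma^{n-1}\}$ is an integral basis of $K$. Two elements $\beta,\gamma\in\mathbb{Z}_K$ are called equivalent if $\beta+\gamma\in\mathbb{Z}$ or $\beta-\gamma\in\mathbb{Z}$; generators are considered only up to this equivalence. For $m$ square free with $m\equiv 2,3\pmod 4$, $\{1,\alpha,\alpha^2,\alpha^3\}$ is an integral basis of $K$. -}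

module Defs where

open import Data.Nat using (ℕ)
open import Data.Integer using (ℤ; +_; _+_; _*_; -_; ∣_∣; 0ℤ; 1ℤ)
open import Data.Integer.Divisibility using (_∣_)
open import Data.Fin using (Fin; zero; suc; toℕ)
open import Data.Product using (Σ; _×_)
open import Data.Sum using (_⊎_)
open import Relation.Binary.PropositionalEquality using (_≡_)

SquareFree : ℤ → Set
SquareFree m = ∀ (d : ℕ) → (+ d * + d) ∣ m → d ≡ 1

-- Elements of Z_K = Z[α], α⁴ = m, written in the integral basis
-- {1, α, α², α³} (valid since m square free, m ≡ 2,3 mod 4):
-- ⟨ a , b , c , d ⟩ stands for a + bα + cα² + dα³.
record ZK : Set where
  constructor ⟨_,_,_,_⟩
  field
    c0 c1 c2 c3 : ℤ
open ZK public

0K : ZK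
0K = ⟨ 0ℤ , 0ℤ , 0ℤ , 0ℤ ⟩

1K : ZK
1K = ⟨ 1ℤ , 0ℤ , 0ℤ , 0ℤ ⟩

_+K_ : ZK → ZK → ZK
⟨ a0 , a1 , a2 , a3 ⟩ +K ⟨ b0 , b1 , b2 , b3 ⟩ =
  ⟨ a0 + b0 , a1 + b1 , a2 + b2 , a3 + b3 ⟩

_·K_ : ℤ → ZK → ZK
k ·K ⟨ a0 , a1 , a2 , a3 ⟩ = ⟨ k * a0 , k * a1 , k * a2 , k * a3 ⟩

-- multiplication in Z[α] with α⁴ = m
mulK : ℤ → ZK → ZK → ZK
mulK m ⟨ a0 , a1 , a2 , a3 ⟩ ⟨ b0 , b1 , b2 , b3 ⟩ =
  ⟨ a0 * b0 + m * (a1 * b3 + a2 * b2 + a3 * b1)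
  , a0 * b1 + a1 * b0 + m * (a2 * b3 + a3 * b2)
  , a0 * b2 + a1 * b1 + a2 * b0 + m * (a3 * b3)
  , a0 * b3 + a1 * b2 + a2 * b1 + a3 * b0 ⟩

powK : ℤ → ZK → ℕ → ZK
powK m γ ℕ.zero = 1K
powK m γ (ℕ.suc n) = mulK m γ (powK m γ n)

lincomb : (Fin 4 → ZK) → (Fin 4 → ℤ) → ZK
lincomb b a = (a zero ·K b zero) +K ((a (suc zero) ·K b (suc zero))
  +K ((a (suc (suc zero)) ·K b (suc (suc zero)))
  +K (a (suc (suc (suc zero))) ·K b (suc (suc (suc zero))))))

IsIntegralBasis : (Fin 4 → ZK) → Set
IsIntegralBasis b =
  (∀ (v : ZK) → Σ (Fin 4 → ℤ) (λ a → lincomb b a ≡ v))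
  × (∀ (a : Fin 4 → ℤ) → lincomb b a ≡ 0K → ∀ i → a i ≡ 0ℤ)

powers : ℤ → ZK → Fin 4 → ZK
powers m γ i = powK m γ (toℕ i)

GeneratesPowerIntegralBasis : ℤ → ZK → Set
GeneratesPowerIntegralBasis m γ = IsIntegralBasis (powers m γ)

-- β, γ equivalent: β - γ ∈ Z or β + γ ∈ Z
Equivalent : ZK → ZK → Set
Equivalent β γ =
  (c1 β ≡ c1 γ × c2 β ≡ c2 γ × c3 β ≡ c3 γ)
  ⊎ (c1 β ≡ - c1 γ × c2 β ≡ - c2 γ × c3 β ≡ - c3 γ)

ϑ : ℤ → ℤ → ℤ → ZK
ϑ x y z = ⟨ 0ℤ , x , y , z ⟩

{-# OPTIONS --safe #-}
-- Put a = s⁴t + ε and D = a⁴ − 1 = s⁴m.  The index of γ = xα + yα² + zα³ (up to ℤ) is n (n² + 4m (y² − xz)²)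
-- with n = x² − mz², so γ is a generator iff n = ±1 and y² = xz; since m ≡ 3 (mod 4), n = −1 is impossible.
-- As s⁴ ≤ a + 1, size alone shows that a² + s²√m is the least solution of u² − mv² = 1.  Hence, if z ≠ 0, up to sign
-- x = T and z = s²U with T + U√D = η^l, η = a² + √D, and xz = y² forces T = X², U = Y².
--
-- Work in ℤ[β], β⁴ = D, with θ = a + β, for which (a + β)(a − β) η = 1.  The element X + Yβ has norm η^(−l) over
-- ℤ[√D]; after multiplication by a power of η and possibly by a − β it has relative norm 1.  A descent
-- on the coefficient of √D shows that the elements of relative norm 1 are, up to sign, the powers of κ = θ²η and
-- their conjugates, so that X + Yβ is η^i θ^n.  The form W (e) = e₀e₃ − e₁e₂ vanishes at X + Yβ and is
-- invariant under η, whereas a 2-adic computation gives W (θ^n) ≠ 0 for n ≥ 2.  This leaves X = a, Y = 1.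
module Submission where

open import Defs
open import Data.Empty using (⊥; ⊥-elim)
open import Data.Fin using (Fin; zero; suc; #_)
open import Data.Integer using (ℤ; +_; -[1+_]; _+_; _-_; _*_; _^_; -_; _<_; _≤_; +≤+; ∣_∣; 0ℤ; 1ℤ; -1ℤ; _%_; _%ℕ_; _/ℕ_)
import Data.Integer as ℤ
import Data.Integer.DivMod as ℤ
import Data.Integer.Properties as ℤ
open import Data.Integer.Solver using (module +-*-Solver)
open +-*-Solver using (Polynomial; con; var; prove; ⟦_⟧; ⟦_⟧↓; _:=_; _:+_; _:*_; _:-_; :-_) renaming (solve to ring)
open import Data.Nat using (ℕ; NonZero; zero; suc)
import Data.Nat as ℕ
open import Data.Nat.Coprimality using (Coprime; coprime⇒gcd≡1; coprime-/gcd; coprime-divisor) renaming (sym to coprime-sym)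
open import Data.Nat.Divisibility using (divides; ∣-antisym; ∣-refl; m∣m*n; n∣m*n; *-pres-∣) renaming (_∣_ to _∣ℕ_)
import Data.Nat.DivMod as ℕ
open import Data.Nat.GCD using (gcd; gcd[m,n]∣m; gcd[m,n]∣n; gcd-greatest; c*gcd[m,n]≡gcd[cm,cn]; gcd[m,n]≡0⇒m≡0)
import Data.Nat.Properties as ℕ
open import Data.Product using (_×_; ∃; _,_; proj₁; proj₂)
open import Data.Sum using (_⊎_; inj₁; inj₂)
open import Data.Vec using (Vec; []; _∷_)
open import Function.Bundles using (_⇔_; mk⇔)
open import Relation.Binary.PropositionalEquality using (_≡_; _≢_; refl; sym; trans; cong; cong₂; subst; module ≡-Reasoning)

-- No real embedding is used: the sizes of β and √D enter only through D = a⁴ - 1 and through signs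
-- of integer coefficients. Division by κ is done in two halves because, for e of relative norm 1,
-- the intermediate e/θ has relative norm η; its two norm equations, together with the positivity of
-- e, force all four of its coefficients to be positive. Multiplication by η changes a relative norm
-- by η², so only the parity of l survives for X + Yβ; when l is odd, the factor a - β absorbs the
-- remaining η. Exponents of θ are treated modulo 4. The binomial coefficients 4, 6, 4 make θ⁴ an
-- odd integer plus even terms, and each squaring doubles these terms once more, so that up to
-- powers of a the 2-adic size of every coordinate of θ^(4q) is known. The exponents in between are
-- reached by one or two factors a + β or by one factor a - β.

0≤+ : ∀ {i j} → 0ℤ ≤ i → 0ℤ ≤ j → 0ℤ ≤ i + j
0≤+ = ℤ.+-mono-≤

0≤* : ∀ {i j} → 0ℤ ≤ i → 0ℤ ≤ j → 0ℤ ≤ i * j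
0≤* {+ i} {+ j} _ _ = subst (0ℤ ≤_) (ℤ.pos-* i j) (+≤+ ℕ.z≤n)

0≤n : ∀ {n} → 0ℤ ≤ + n
0≤n = +≤+ ℕ.z≤n

0≤i*i : ∀ i → 0ℤ ≤ i * i
0≤i*i (+ zero) = 0≤n
0≤i*i (+ suc _) = 0≤n
0≤i*i -[1+ _ ] = 0≤n

¬0≤-1 : ∀ {i} → 0ℤ ≤ i → i ≡ -1ℤ → ⊥
¬0≤-1 () refl

-- Strict inequalities i < j are written 0 ≤ j - i - 1, so that they can be added and multiplied.
sign? : ∀ i → 0ℤ ≤ i ⊎ 0ℤ ≤ - i - 1ℤ
sign? (+ _) = inj₁ 0≤n
sign? -[1+ _ ] = inj₂ 0≤n

-- Feeds `ring` an identity that only holds under a hypothesis l ≡ r: k is the cofactor of that hypothesis.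
modulo : ∀ {x y l r} k → x ≡ y + k * (l - r) → l ≡ r → x ≡ y
modulo {y = y} {l} k p refl = trans p (ring 3 (λ y k l → y :+ k :* (l :- l) := y) refl y k l)

-- Arithmetic of ℤ[β], β⁴ = m, in coordinates

zk≡ : ∀ {a a′ b b′ c c′ d d′} → a ≡ a′ → b ≡ b′ → c ≡ c′ → d ≡ d′ → ⟨ a , b , c , d ⟩ ≡ ⟨ a′ , b′ , c′ , d′ ⟩
zk≡ refl refl refl refl = refl

-- The suffix P marks the solver's syntactic copy of an operation on ℤ or ZK.
record Quartic (n : ℕ) : Set where
  constructor ⟪_,_,_,_⟫
  field p0 p1 p2 p3 : Polynomial n
open Quartic

infixl 9 _:^2
_:^2 : ∀ {n} → Polynomial n → Polynomial n
p :^2 = p :* p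

mulP : ∀ {n} → Polynomial n → Quartic n → Quartic n → Quartic n
mulP m ⟪ a0 , a1 , a2 , a3 ⟫ ⟪ b0 , b1 , b2 , b3 ⟫ =
  ⟪ a0 :* b0 :+ m :* (a1 :* b3 :+ a2 :* b2 :+ a3 :* b1)
  , a0 :* b1 :+ a1 :* b0 :+ m :* (a2 :* b3 :+ a3 :* b2)
  , a0 :* b2 :+ a1 :* b1 :+ a2 :* b0 :+ m :* (a3 :* b3)
  , a0 :* b3 :+ a1 :* b2 :+ a2 :* b1 :+ a3 :* b0 ⟫

-- For β⁴ = m, the norm of e from ℤ[β] down to ℤ[√m] is N₀ m e + N₂ m e √m.
N₀ N₂ : ℤ → ZK → ℤ
N₀ m ⟨ e0 , e1 , e2 , e3 ⟩ = e0 * e0 + m * (e2 * e2) - + 2 * (m * (e1 * e3))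
N₂ m ⟨ e0 , e1 , e2 , e3 ⟩ = + 2 * (e0 * e2) - e1 * e1 - m * (e3 * e3)

N₀P N₂P : ∀ {n} → Polynomial n → Quartic n → Polynomial n
N₀P m ⟪ e0 , e1 , e2 , e3 ⟫ = e0 :* e0 :+ m :* (e2 :* e2) :- con (+ 2) :* (m :* (e1 :* e3))
N₂P m ⟪ e0 , e1 , e2 , e3 ⟫ = con (+ 2) :* (e0 :* e2) :- e1 :* e1 :- m :* (e3 :* e3)

⟦_⟧K : ∀ {n} → Quartic n → Vec ℤ n → ZK
⟦ ⟪ a , b , c , d ⟫ ⟧K ρ = ⟨ ⟦ a ⟧ ρ , ⟦ b ⟧ ρ , ⟦ c ⟧ ρ , ⟦ d ⟧ ρ ⟩

ringK : ∀ {n} (ρ : Vec ℤ n) (x y : Quartic n) →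
  ⟦ p0 x ⟧↓ ρ ≡ ⟦ p0 y ⟧↓ ρ → ⟦ p1 x ⟧↓ ρ ≡ ⟦ p1 y ⟧↓ ρ →
  ⟦ p2 x ⟧↓ ρ ≡ ⟦ p2 y ⟧↓ ρ → ⟦ p3 x ⟧↓ ρ ≡ ⟦ p3 y ⟧↓ ρ → ⟦ x ⟧K ρ ≡ ⟦ y ⟧K ρ
ringK ρ x y e0 e1 e2 e3 = zk≡ (prove ρ (p0 x) (p0 y) e0) (prove ρ (p1 x) (p1 y) e1)
  (prove ρ (p2 x) (p2 y) e2) (prove ρ (p3 x) (p3 y) e3)

mulK-comm : ∀ m x y → mulK m x y ≡ mulK m y x
mulK-comm m ⟨ a0 , a1 , a2 , a3 ⟩ ⟨ b0 , b1 , b2 , b3 ⟩ =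
  ringK (m ∷ a0 ∷ a1 ∷ a2 ∷ a3 ∷ b0 ∷ b1 ∷ b2 ∷ b3 ∷ []) (mulP μ x y) (mulP μ y x) refl refl refl refl
  where
  μ = var (# 0)
  x = ⟪ var (# 1) , var (# 2) , var (# 3) , var (# 4) ⟫
  y = ⟪ var (# 5) , var (# 6) , var (# 7) , var (# 8) ⟫

mulK-assoc : ∀ m x y z → mulK m (mulK m x y) z ≡ mulK m x (mulK m y z)
mulK-assoc m ⟨ a0 , a1 , a2 , a3 ⟩ ⟨ b0 , b1 , b2 , b3 ⟩ ⟨ d0 , d1 , d2 , d3 ⟩ =
  ringK (m ∷ a0 ∷ a1 ∷ a2 ∷ a3 ∷ b0 ∷ b1 ∷ b2 ∷ b3 ∷ d0 ∷ d1 ∷ d2 ∷ d3 ∷ [])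
    (mulP μ (mulP μ x y) z) (mulP μ x (mulP μ y z)) refl refl refl refl
  where
  μ = var (# 0)
  x = ⟪ var (# 1) , var (# 2) , var (# 3) , var (# 4) ⟫
  y = ⟪ var (# 5) , var (# 6) , var (# 7) , var (# 8) ⟫
  z = ⟪ var (# 9) , var (# 10) , var (# 11) , var (# 12) ⟫

mulK-identityˡ : ∀ m x → mulK m 1K x ≡ x
mulK-identityˡ m ⟨ a0 , a1 , a2 , a3 ⟩ =
  ringK (m ∷ a0 ∷ a1 ∷ a2 ∷ a3 ∷ []) (mulP (var (# 0)) ⟪ con 1ℤ , con 0ℤ , con 0ℤ , con 0ℤ ⟫ x) x refl refl refl refl
  where
  x = ⟪ var (# 1) , var (# 2) , var (# 3) , var (# 4) ⟫

N₀-mul : ∀ m x y → N₀ m (mulK m x y) ≡ N₀ m x * N₀ m y + m * (N₂ m x * N₂ m y)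
N₀-mul m ⟨ a0 , a1 , a2 , a3 ⟩ ⟨ b0 , b1 , b2 , b3 ⟩ =
  prove (m ∷ a0 ∷ a1 ∷ a2 ∷ a3 ∷ b0 ∷ b1 ∷ b2 ∷ b3 ∷ [])
    (N₀P μ (mulP μ x y)) (N₀P μ x :* N₀P μ y :+ μ :* (N₂P μ x :* N₂P μ y)) refl
  where
  μ = var (# 0)
  x = ⟪ var (# 1) , var (# 2) , var (# 3) , var (# 4) ⟫
  y = ⟪ var (# 5) , var (# 6) , var (# 7) , var (# 8) ⟫

N₂-mul : ∀ m x y → N₂ m (mulK m x y) ≡ N₀ m x * N₂ m y + N₂ m x * N₀ m y
N₂-mul m ⟨ a0 , a1 , a2 , a3 ⟩ ⟨ b0 , b1 , b2 , b3 ⟩ =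
  prove (m ∷ a0 ∷ a1 ∷ a2 ∷ a3 ∷ b0 ∷ b1 ∷ b2 ∷ b3 ∷ [])
    (N₂P μ (mulP μ x y)) (N₀P μ x :* N₂P μ y :+ N₂P μ x :* N₀P μ y) refl
  where
  μ = var (# 0)
  x = ⟪ var (# 1) , var (# 2) , var (# 3) , var (# 4) ⟫
  y = ⟪ var (# 5) , var (# 6) , var (# 7) , var (# 8) ⟫

-- For e = P + Qβ with P, Q ∈ ℤ[√m], this is (P′Q − PQ′)/(2√m), where ′ is the conjugation of ℤ[√m].
-- It vanishes on the binomials x + yβ and does not change when e is multiplied by a unit of norm 1 of ℤ[√m].
W : ZK → ℤ
W ⟨ e0 , e1 , e2 , e3 ⟩ = e0 * e3 - e1 * e2

conj : ZK → ZK
conj ⟨ e0 , e1 , e2 , e3 ⟩ = ⟨ e0 , - e1 , e2 , - e3 ⟩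

-- Units of relative norm 1

positive-product : ∀ i j → 0ℤ ≤ i * j - 1ℤ →
  (0ℤ ≤ i - 1ℤ × 0ℤ ≤ j - 1ℤ) ⊎ (0ℤ ≤ - i - 1ℤ × 0ℤ ≤ - j - 1ℤ)
positive-product (+ zero) j ()
positive-product (+ suc i) (+ zero) h rewrite ℤ.*-zeroʳ (+ suc i) with () ← h
positive-product (+ suc i) (+ suc j) h = inj₁ (0≤n , 0≤n)
positive-product -[1+ i ] (+ zero) h rewrite ℤ.*-zeroʳ (-[1+ i ]) with () ← h
positive-product -[1+ i ] -[1+ j ] h = inj₂ (0≤n , 0≤n)

disc : ℤ → ℤ
disc a = a * a * (a * a) - 1ℤ

δ : ∀ {n} → Polynomial n → Polynomial n
δ a = a :* a :* (a :* a) :- con 1ℤ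

:1 :2 : ∀ {n} → Polynomial n
:1 = con 1ℤ
:2 = con (+ 2)

weaken : ∀ {i} → 0ℤ ≤ i - 1ℤ → 0ℤ ≤ i
weaken {i} h = subst (0ℤ ≤_) (ring 1 (λ i → i :- :1 :+ :1 := i) refl i) (0≤+ h (0≤n {1}))

module Bounds (a : ℤ) (2≤a : 0ℤ ≤ a - + 2) where
  private D = disc a

  0≤a : 0ℤ ≤ a
  0≤a = subst (0ℤ ≤_) (ring 1 (λ a → a :- :2 :+ :2 := a) refl a) (0≤+ 2≤a 0≤n)

  1≤a² : 0ℤ ≤ a * a - 1ℤ
  1≤a² = subst (0ℤ ≤_) (ring 1 (λ a → (a :- :2) :* (a :+ :2) :+ con (+ 3) := a :* a :- :1) refl a)
    (0≤+ (0≤* 2≤a (0≤+ 0≤a 0≤n)) 0≤n)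

  a²<D : 0ℤ ≤ D - a * a - 1ℤ
  a²<D = subst (0ℤ ≤_) (ring 1 (λ a → ((a :- :2) :* (a :+ :2) :+ :2) :* (a :* a :+ :1) := δ a :- a :* a :- :1) refl a)
    (0≤* (0≤+ (0≤* 2≤a (0≤+ 0≤a 0≤n)) 0≤n) (0≤+ (0≤i*i a) 0≤n))

  0≤D : 0ℤ ≤ D
  0≤D = subst (0ℤ ≤_) (ring 2 (λ a d → d :- a :* a :- :1 :+ (a :* a :+ :1) := d) refl a D)
    (0≤+ a²<D (0≤+ (0≤i*i a) 0≤n))

  -- Everything reduces to a⁴ k0² − 2 a² D k0 k2 + a⁴ D k2² ≥ 0, which holds because D < a⁴.
  ¬steep : ∀ k0 k2 g1 g3 → 0ℤ ≤ k0 → 0ℤ ≤ k2 → 0ℤ ≤ g1 - a * k2 → 0ℤ ≤ D * g3 - a * k0 →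
    + 2 * (k0 * k2) - g1 * g1 - D * (g3 * g3) ≡ 1ℤ → ⊥
  ¬steep k0 k2 g1 g3 h0 h2 h1 h3 eq = ¬0≤-1
    (0≤+ (0≤+ (0≤+ (0≤+ (0≤+ (0≤+ (0≤* (0≤i*i a) a²<D) (0≤i*i (a * a))) 1≤a²)
      (0≤* (0≤* (0≤i*i a) 0≤D) (0≤+ (0≤i*i (g1 - a * k2)) (0≤* (0≤* (0≤n {2}) (0≤* 0≤a h2)) h1))))
      (0≤* (0≤i*i a) (0≤+ (0≤i*i (D * g3 - a * k0)) (0≤* (0≤* (0≤n {2}) (0≤* 0≤a h0)) h3))))
      (0≤i*i (a * a * k0 - D * k2)))
      (0≤* 0≤D (0≤i*i k2)))
    (modulo (- (a * a * D))
      (ring 5 (λ a k0 k2 g1 g3 → let D = δ a in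
         a :^2 :* (D :- a :* a :- :1) :+ (a :* a) :^2 :+ (a :* a :- :1)
         :+ a :^2 :* D :* ((g1 :- a :* k2) :^2 :+ :2 :* (a :* k2) :* (g1 :- a :* k2))
         :+ a :^2 :* ((D :* g3 :- a :* k0) :^2 :+ :2 :* (a :* k0) :* (D :* g3 :- a :* k0))
         :+ (a :* a :* k0 :- D :* k2) :^2 :+ D :* k2 :^2
         := con -1ℤ :+ (:- (a :* a :* D)) :* (:2 :* (k0 :* k2) :- g1 :* g1 :- D :* (g3 :* g3) :- :1))
        refl a k0 k2 g1 g3)
      eq)

  -- After multiplication by a², the terms in h1 and h3 alone leave (a² h1 - D h3)² + D h3², because
  -- a⁴ = D + 1. The unit by which g2 exceeds a h3 contributes D, and this is larger than a².
  ¬shallow : ∀ g0 g2 h1 h3 → 0ℤ ≤ h1 → 0ℤ ≤ h3 → 0ℤ ≤ g0 - a * h1 → 0ℤ ≤ g2 - a * h3 - 1ℤ →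
    g0 * g0 + D * (g2 * g2) - + 2 * (D * (h1 * h3)) ≡ a * a → ⊥
  ¬shallow g0 g2 h1 h3 p1 p3 q0 q2 eq = ¬0≤-1
    (0≤+ (0≤+ (0≤+ (0≤+ (0≤+ (0≤+
      (0≤* (0≤i*i a) (0≤+ (0≤i*i (g0 - a * h1)) (0≤* (0≤* (0≤n {2}) (0≤* 0≤a p1)) q0)))
      (0≤* (0≤* (0≤i*i a) 0≤D) (0≤+ (0≤i*i (g2 - a * h3 - 1ℤ)) (0≤* (0≤* (0≤n {2}) (0≤+ (0≤* 0≤a p3) (0≤n {1}))) q2))))
      (0≤i*i (a * a * h1 - D * h3)))
      (0≤* 0≤D (0≤i*i h3)))
      (0≤* (0≤* (0≤i*i a) 0≤D) (0≤* (0≤n {2}) (0≤* 0≤a p3))))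
      (0≤* (0≤i*i a) a²<D)) 1≤a²)
    (modulo (a * a)
      (ring 5 (λ a g0 g2 h1 h3 → let D = δ a in
         a :^2 :* ((g0 :- a :* h1) :^2 :+ :2 :* (a :* h1) :* (g0 :- a :* h1))
         :+ a :^2 :* D :* ((g2 :- a :* h3 :- :1) :^2 :+ :2 :* (a :* h3 :+ :1) :* (g2 :- a :* h3 :- :1))
         :+ (a :* a :* h1 :- D :* h3) :^2 :+ D :* h3 :^2
         :+ a :^2 :* D :* (:2 :* (a :* h3)) :+ a :^2 :* (D :- a :* a :- :1) :+ (a :* a :- :1)
         := con -1ℤ :+ (a :* a) :* (g0 :* g0 :+ D :* (g2 :* g2) :- :2 :* (D :* (h1 :* h3)) :- a :* a))
        refl a g0 g2 h1 h3)
      eq)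

  -- The two conclusions concern the coefficients of 1 and √D in θ̄g. Since N₂ (θ̄g) = a² N₂ g - N₀
  -- g = 0, twice their product is a sum of squares and they cannot have strictly opposite signs;
  -- `¬steep` prevents both from being nonpositive.
  descend-nonneg : ∀ g0 g1 g2 g3 → 0ℤ ≤ g0 → 0ℤ ≤ g2 →
    N₀ D ⟨ g0 , g1 , g2 , g3 ⟩ ≡ a * a → N₂ D ⟨ g0 , g1 , g2 , g3 ⟩ ≡ 1ℤ →
    0ℤ ≤ a * g0 - D * g3 × 0ℤ ≤ a * g2 - g1
  descend-nonneg g0 g1 g2 g3 p0 p2 eqA eqB = go (sign? e0) (sign? e2)
    where
    e0 = a * g0 - D * g3
    e2 = a * g2 - g1
    s = (a * g1 - g0) * (a * g1 - g0) + D * ((a * g3 - g2) * (a * g3 - g2))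

    0≤s : 0ℤ ≤ s
    0≤s = 0≤+ (0≤i*i (a * g1 - g0)) (0≤* 0≤D (0≤i*i (a * g3 - g2)))

    product : + 2 * (e0 * e2) ≡ s
    product = modulo (a * a) (modulo -1ℤ
      (ring 5 (λ a g0 g1 g2 g3 → let D = δ a; G = ⟪ g0 , g1 , g2 , g3 ⟫ in
         :2 :* ((a :* g0 :- D :* g3) :* (a :* g2 :- g1)) :=
         (a :* g1 :- g0) :^2 :+ D :* (a :* g3 :- g2) :^2 :+ (a :* a) :* (N₂P D G :- :1)
         :+ con -1ℤ :* (N₀P D G :- a :* a)) refl a g0 g1 g2 g3)
      eqA) eqB

    both-nonpos : 0ℤ ≤ - e0 → 0ℤ ≤ - e2 → ⊥
    both-nonpos n0 n2 = ¬steep g0 g2 g1 g3 p0 p2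
      (subst (0ℤ ≤_) (ring 3 (λ a g2 g1 → :- (a :* g2 :- g1) := g1 :- a :* g2) refl a g2 g1) n2)
      (subst (0ℤ ≤_) (ring 4 (λ a g0 g3 D → :- (a :* g0 :- D :* g3) := D :* g3 :- a :* g0) refl a g0 g3 D) n0)
      eqB

    opposite : ∀ x y → 0ℤ ≤ - x - 1ℤ → 0ℤ ≤ y - 1ℤ → + 2 * (x * y) ≡ s → ⊥
    opposite x y n p eq = ¬0≤-1 (0≤+ (0≤+ (0≤+ 0≤s (0≤* (0≤n {2}) (0≤* n p))) (0≤* (0≤n {2}) (0≤+ n p))) (0≤n {1}))
      (modulo -1ℤ (ring 3 (λ s x y →
          s :+ :2 :* ((:- x :- :1) :* (y :- :1)) :+ :2 :* ((:- x :- :1) :+ (y :- :1)) :+ :1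
          := con -1ℤ :+ con -1ℤ :* (:2 :* (x :* y) :- s)) refl s x y) eq)

    double-neg : ∀ i → - (- i) - 1ℤ ≡ i - 1ℤ
    double-neg i = cong (_- 1ℤ) (ℤ.neg-involutive i)

    go : 0ℤ ≤ e0 ⊎ 0ℤ ≤ - e0 - 1ℤ → 0ℤ ≤ e2 ⊎ 0ℤ ≤ - e2 - 1ℤ → 0ℤ ≤ e0 × 0ℤ ≤ e2
    go (inj₁ h0) (inj₁ h2) = h0 , h2
    go (inj₂ n0) _ with sign? (- e2)
    ... | inj₁ n2 = ⊥-elim (both-nonpos (weaken n0) n2)
    ... | inj₂ h2 = ⊥-elim (opposite e0 e2 n0 (subst (0ℤ ≤_) (double-neg e2) h2) product)
    go (inj₁ _) (inj₂ n2) with sign? (- e0)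
    ... | inj₁ n0 = ⊥-elim (both-nonpos n0 (weaken n2))
    ... | inj₂ h0 = ⊥-elim (opposite e2 e0 n2 (subst (0ℤ ≤_) (double-neg e0) h0)
                      (trans (cong (+ 2 *_) (ℤ.*-comm e2 e0)) product))

  -- The four hypotheses say that θg has positive coefficients. The norm equations give g0 g2 ≥ 1
  -- and g1 g3 ≥ 1, which leaves four sign patterns; `¬steep` and `¬shallow`, applied to the negated
  -- pair, exclude the two mixed ones.
  quotient-positive : ∀ g0 g1 g2 g3 →
    N₀ D ⟨ g0 , g1 , g2 , g3 ⟩ ≡ a * a → N₂ D ⟨ g0 , g1 , g2 , g3 ⟩ ≡ 1ℤ →
    0ℤ ≤ a * g0 + D * g3 - 1ℤ → 0ℤ ≤ a * g1 + g0 - 1ℤ → 0ℤ ≤ a * g2 + g1 - 1ℤ → 0ℤ ≤ a * g3 + g2 - 1ℤ →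
    0ℤ ≤ g0 - 1ℤ × 0ℤ ≤ g1 - 1ℤ × 0ℤ ≤ g2 - 1ℤ × 0ℤ ≤ g3 - 1ℤ
  quotient-positive g0 g1 g2 g3 eqA eqB h0 h1 h2 h3 = go (positive-product g0 g2 1≤g0g2) (positive-product g1 g3 1≤g1g3)
    where
    1≤g0g2 : 0ℤ ≤ g0 * g2 - 1ℤ
    1≤g0g2 with sign? (g0 * g2 - 1ℤ)
    ... | inj₁ h = h
    ... | inj₂ n = ⊥-elim (¬0≤-1
      (0≤+ (0≤+ (0≤i*i g1) (0≤* 0≤D (0≤i*i g3))) (0≤* (0≤n {2}) n))
      (modulo -1ℤ (ring 5 (λ D g0 g1 g2 g3 →
         g1 :^2 :+ D :* g3 :^2 :+ :2 :* (:- (g0 :* g2 :- :1) :- :1) :=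
         con -1ℤ :+ con -1ℤ :* (N₂P D ⟪ g0 , g1 , g2 , g3 ⟫ :- :1)) refl D g0 g1 g2 g3) eqB))

    1≤g2² : 0ℤ ≤ g2 * g2 - 1ℤ
    1≤g2² with positive-product g0 g2 1≤g0g2
    ... | inj₁ (_ , p) = subst (0ℤ ≤_) (ring 1 (λ g → (g :- :1) :* (g :- :1 :+ :2) := g :* g :- :1) refl g2) (0≤* p (0≤+ p 0≤n))
    ... | inj₂ (_ , p) = subst (0ℤ ≤_) (ring 1 (λ g → (:- g :- :1) :* (:- g :- :1 :+ :2) := g :* g :- :1) refl g2) (0≤* p (0≤+ p 0≤n))

    -- 2 D g1 g3 = g0² + D g2² - a², and D g2² > a² because g2 is nonzero.
    1≤g1g3 : 0ℤ ≤ g1 * g3 - 1ℤ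
    1≤g1g3 with sign? (g1 * g3 - 1ℤ)
    ... | inj₁ h = h
    ... | inj₂ n = ⊥-elim (¬0≤-1
      (0≤+ (0≤+ (0≤+ (0≤i*i g0) (0≤* 0≤D 1≤g2²)) (0≤* (0≤n {2}) (0≤* 0≤D n))) a²<D)
      (modulo 1ℤ (ring 6 (λ a D g0 g1 g2 g3 →
         g0 :^2 :+ D :* (g2 :* g2 :- :1) :+ :2 :* (D :* (:- (g1 :* g3 :- :1) :- :1)) :+ (D :- a :* a :- :1) :=
         con -1ℤ :+ :1 :* (N₀P D ⟪ g0 , g1 , g2 , g3 ⟫ :- a :* a)) refl a D g0 g1 g2 g3) eqA))

    go : (0ℤ ≤ g0 - 1ℤ × 0ℤ ≤ g2 - 1ℤ) ⊎ (0ℤ ≤ - g0 - 1ℤ × 0ℤ ≤ - g2 - 1ℤ) →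
         (0ℤ ≤ g1 - 1ℤ × 0ℤ ≤ g3 - 1ℤ) ⊎ (0ℤ ≤ - g1 - 1ℤ × 0ℤ ≤ - g3 - 1ℤ) → _
    go (inj₁ (p0 , p2)) (inj₁ (p1 , p3)) = p0 , p1 , p2 , p3
    go (inj₁ _) (inj₂ (n1 , n3)) = ⊥-elim (¬shallow g0 g2 (- g1) (- g3) (weaken n1) (weaken n3)
      (subst (0ℤ ≤_) (ring 3 (λ a g0 g1 → a :* g1 :+ g0 :- :1 :+ :1 := g0 :- a :* (:- g1)) refl a g0 g1) (0≤+ h1 (0≤n {1})))
      (subst (0ℤ ≤_) (ring 3 (λ a g2 g3 → a :* g3 :+ g2 :- :1 := g2 :- a :* (:- g3) :- :1) refl a g2 g3) h3)
      (trans (ring 5 (λ D g0 g1 g2 g3 → g0 :* g0 :+ D :* (g2 :* g2) :- :2 :* (D :* ((:- g1) :* (:- g3))) :=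
         N₀P D ⟪ g0 , g1 , g2 , g3 ⟫) refl D g0 g1 g2 g3) eqA))
    go (inj₂ (n0 , n2)) (inj₁ _) = ⊥-elim (¬steep (- g0) (- g2) g1 g3 (weaken n0) (weaken n2)
      (subst (0ℤ ≤_) (ring 3 (λ a g1 g2 → a :* g2 :+ g1 :- :1 :+ :1 := g1 :- a :* (:- g2)) refl a g1 g2) (0≤+ h2 (0≤n {1})))
      (subst (0ℤ ≤_) (ring 4 (λ a D g0 g3 → a :* g0 :+ D :* g3 :- :1 :+ :1 := D :* g3 :- a :* (:- g0)) refl a D g0 g3) (0≤+ h0 (0≤n {1})))
      (trans (ring 5 (λ D g0 g1 g2 g3 → :2 :* ((:- g0) :* (:- g2)) :- g1 :* g1 :- D :* (g3 :* g3) :=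
         N₂P D ⟪ g0 , g1 , g2 , g3 ⟫) refl D g0 g1 g2 g3) eqB))
    go (inj₂ (n0 , n2)) (inj₂ (n1 , n3)) = ⊥-elim (¬0≤-1
      (0≤+ (0≤+ (0≤+ (0≤+ h1 (0≤* 0≤a n1)) n0) 0≤a) (0≤n {1}))
      (ring 3 (λ a g0 g1 → a :* g1 :+ g0 :- :1 :+ a :* (:- g1 :- :1) :+ (:- g0 :- :1) :+ a :+ :1 := con -1ℤ) refl a g0 g1))

-- Since θ θ̄ η = 1, `κ` is the quotient of θ by its conjugate, so that `conj` inverts it. The
-- factor η replaces the division.
θ θ̄ η κ : ℤ → ZK
θ a = ⟨ a , 1ℤ , 0ℤ , 0ℤ ⟩
θ̄ a = ⟨ a , -1ℤ , 0ℤ , 0ℤ ⟩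
η a = ⟨ a * a , 0ℤ , 1ℤ , 0ℤ ⟩
κ a = mulK (disc a) (θ a) (mulK (disc a) (θ a) (η a))

:0 : ∀ {n} → Polynomial n
:0 = con 0ℤ

θP θ̄P ηP : ∀ {n} → Polynomial n → Quartic n
θP a = ⟪ a , :1 , :0 , :0 ⟫
θ̄P a = ⟪ a , con -1ℤ , :0 , :0 ⟫
ηP a = ⟪ a :* a , :0 , :1 , :0 ⟫

conjP : ∀ {n} → Quartic n → Quartic n
conjP ⟪ a , b , c , d ⟫ = ⟪ a , :- b , c , :- d ⟫

ePoly : ∀ {n} → Quartic (5 ℕ.+ n)
ePoly = ⟪ var (# 1) , var (# 2) , var (# 3) , var (# 4) ⟫

conj-mul : ∀ m x y → conj (mulK m x y) ≡ mulK m (conj x) (conj y)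
conj-mul m ⟨ a0 , a1 , a2 , a3 ⟩ ⟨ b0 , b1 , b2 , b3 ⟩ =
  ringK (m ∷ a0 ∷ a1 ∷ a2 ∷ a3 ∷ b0 ∷ b1 ∷ b2 ∷ b3 ∷ [])
    (conjP (mulP μ x y)) (mulP μ (conjP x) (conjP y)) refl refl refl refl
  where
  μ = var (# 0)
  x = ⟪ var (# 1) , var (# 2) , var (# 3) , var (# 4) ⟫
  y = ⟪ var (# 5) , var (# 6) , var (# 7) , var (# 8) ⟫

conj-involutive : ∀ x → conj (conj x) ≡ x
conj-involutive ⟨ _ , b , _ , d ⟩ = zk≡ refl (ℤ.neg-involutive b) refl (ℤ.neg-involutive d)

0≤-antisym : ∀ {i} → 0ℤ ≤ i → 0ℤ ≤ - i → i ≡ 0ℤ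
0≤-antisym {+ zero} _ _ = refl

zero-or-square : ∀ i → i ≡ 0ℤ ⊎ 0ℤ ≤ i * i - 1ℤ
zero-or-square (+ zero) = inj₁ refl
zero-or-square (+ suc n) = inj₂ 0≤n
zero-or-square -[1+ n ] = inj₂ 0≤n

square-one : ∀ {i} → 0ℤ ≤ i → i * i ≡ 1ℤ → i ≡ 1ℤ
square-one {+ 1} _ _ = refl

θ·-coords : ∀ a D g0 g1 g2 g3 → mulK D (θ a) ⟨ g0 , g1 , g2 , g3 ⟩ ≡ ⟨ a * g0 + D * g3 , a * g1 + g0 , a * g2 + g1 , a * g3 + g2 ⟩
θ·-coords a D g0 g1 g2 g3 = ringK (a ∷ D ∷ g0 ∷ g1 ∷ g2 ∷ g3 ∷ []) (mulP D′ (θP α) ⟪ x0 , x1 , x2 , x3 ⟫)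
  ⟪ α :* x0 :+ D′ :* x3 , α :* x1 :+ x0 , α :* x2 :+ x1 , α :* x3 :+ x2 ⟫ refl refl refl refl
  where
  α = var (# 0)
  D′ = var (# 1)
  x0 = var (# 2)
  x1 = var (# 3)
  x2 = var (# 4)
  x3 = var (# 5)

θ̄·-coords : ∀ a D g0 g1 g2 g3 → mulK D (θ̄ a) ⟨ g0 , g1 , g2 , g3 ⟩ ≡ ⟨ a * g0 - D * g3 , a * g1 - g0 , a * g2 - g1 , a * g3 - g2 ⟩
θ̄·-coords a D g0 g1 g2 g3 = ringK (a ∷ D ∷ g0 ∷ g1 ∷ g2 ∷ g3 ∷ []) (mulP D′ (θ̄P α) ⟪ x0 , x1 , x2 , x3 ⟫)
  ⟪ α :* x0 :- D′ :* x3 , α :* x1 :- x0 , α :* x2 :- x1 , α :* x3 :- x2 ⟫ refl refl refl refl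
  where
  α = var (# 0)
  D′ = var (# 1)
  x0 = var (# 2)
  x1 = var (# 3)
  x2 = var (# 4)
  x3 = var (# 5)

module Units (a : ℤ) where
  D = disc a

  θη·θ̄ : ∀ x → mulK D (mulK D (θ a) (η a)) (mulK D (θ̄ a) x) ≡ x
  θη·θ̄ ⟨ e0 , e1 , e2 , e3 ⟩ = ringK (a ∷ e0 ∷ e1 ∷ e2 ∷ e3 ∷ [])
    (mulP (δ α) (mulP (δ α) (θP α) (ηP α)) (mulP (δ α) (θ̄P α) ePoly)) ePoly refl refl refl refl
    where α = var (# 0)

  θ·θ̄η : ∀ x → mulK D (θ a) (mulK D (mulK D (θ̄ a) (η a)) x) ≡ x
  θ·θ̄η ⟨ e0 , e1 , e2 , e3 ⟩ = ringK (a ∷ e0 ∷ e1 ∷ e2 ∷ e3 ∷ [])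
    (mulP (δ α) (θP α) (mulP (δ α) (mulP (δ α) (θ̄P α) (ηP α)) ePoly)) ePoly refl refl refl refl
    where α = var (# 0)

  κ·θ̄θ̄η : ∀ x → mulK D (κ a) (mulK D (θ̄ a) (mulK D (mulK D (θ̄ a) (η a)) x)) ≡ x
  κ·θ̄θ̄η x = trans (mulK-assoc D (θ a) _ _) (trans (cong (mulK D (θ a)) (θη·θ̄ _)) (θ·θ̄η x))

  κ·κ̄ : ∀ x → mulK D (κ a) (mulK D (conj (κ a)) x) ≡ x
  κ·κ̄ x = trans (cong (mulK D (κ a)) (trans (cong (λ k → mulK D k x) conj-κ) (mulK-assoc D (θ̄ a) _ x))) (κ·θ̄θ̄η x)
    where
    conj-κ : conj (κ a) ≡ mulK D (θ̄ a) (mulK D (θ̄ a) (η a))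
    conj-κ = trans (conj-mul D (θ a) _) (cong (mulK D (θ̄ a)) (conj-mul D (θ a) (η a)))

  record HasNorm (p q : ℤ) (x : ZK) : Set where
    constructor norm
    field
      n₀ : N₀ D x ≡ p
      n₂ : N₂ D x ≡ q

  mul-norm : ∀ {p q r s x y} → HasNorm p q x → HasNorm r s y →
    HasNorm (p * r + D * (q * s)) (p * s + q * r) (mulK D x y)
  mul-norm {x = x} {y} (norm refl refl) (norm refl refl) = norm (N₀-mul D x y) (N₂-mul D x y)

  renorm : ∀ {p q r s x} → p ≡ r → q ≡ s → HasNorm p q x → HasNorm r s x
  renorm refl refl h = h

  conj-norm : ∀ {p q x} → HasNorm p q x → HasNorm p q (conj x)
  conj-norm {x = ⟨ e0 , e1 , e2 , e3 ⟩} (norm refl refl) = norm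
    (ring 5 (λ D e0 e1 e2 e3 → N₀P D (conjP ⟪ e0 , e1 , e2 , e3 ⟫) := N₀P D ⟪ e0 , e1 , e2 , e3 ⟫) refl D e0 e1 e2 e3)
    (ring 5 (λ D e0 e1 e2 e3 → N₂P D (conjP ⟪ e0 , e1 , e2 , e3 ⟫) := N₂P D ⟪ e0 , e1 , e2 , e3 ⟫) refl D e0 e1 e2 e3)

  θ̄-norm : HasNorm (a * a) -1ℤ (θ̄ a)
  θ̄-norm = norm (ring 1 (λ a → N₀P (δ a) (θ̄P a) := a :* a) refl a)
                (ring 1 (λ a → N₂P (δ a) (θ̄P a) := con -1ℤ) refl a)

  θ̄η-norm : HasNorm (a * a) 1ℤ (mulK D (θ̄ a) (η a))
  θ̄η-norm = norm (ring 1 (λ a → N₀P (δ a) (mulP (δ a) (θ̄P a) (ηP a)) := a :* a) refl a)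
                 (ring 1 (λ a → N₂P (δ a) (mulP (δ a) (θ̄P a) (ηP a)) := :1) refl a)

  θ̄·-norm : ∀ {x} → HasNorm (a * a) 1ℤ x → HasNorm 1ℤ 0ℤ (mulK D (θ̄ a) x)
  θ̄·-norm h = renorm (ring 1 (λ a → a :* a :* (a :* a) :+ δ a :* (con -1ℤ :* :1) := :1) refl a)
                     (ring 1 (λ a → a :* a :* :1 :+ con -1ℤ :* (a :* a) := :0) refl a)
                     (mul-norm θ̄-norm h)

  θ̄η·-norm : ∀ {x} → HasNorm 1ℤ 0ℤ x → HasNorm (a * a) 1ℤ (mulK D (mulK D (θ̄ a) (η a)) x)
  θ̄η·-norm h = renorm (ring 1 (λ a → a :* a :* :1 :+ δ a :* (:1 :* :0) := a :* a) refl a)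
                      (ring 1 (λ a → a :* a :* :0 :+ :1 :* :1 := :1) refl a)
                      (mul-norm θ̄η-norm h)

  -- As conj (κ^j) = κ^(-j), the two constructors together cover all integer exponents.
  data Power± (x : ZK) : Set where
    plus  : ∀ j → x ≡ powK D (κ a) j → Power± x
    minus : ∀ j → x ≡ conj (powK D (κ a) j) → Power± x

  κ·-power : ∀ {x} → Power± x → Power± (mulK D (κ a) x)
  κ·-power (plus j refl) = plus (suc j) refl
  κ·-power (minus zero refl) = plus 1 refl
  κ·-power (minus (suc j) refl) = minus j (trans (cong (mulK D (κ a)) (conj-mul D (κ a) _)) (κ·κ̄ _))

  conj-power : ∀ {x} → Power± (conj x) → Power± x
  conj-power {x} (plus j eq) = minus j (trans (sym (conj-involutive x)) (cong conj eq))
  conj-power {x} (minus j eq) = plus j (trans (sym (conj-involutive x)) (trans (cong conj eq) (conj-involutive _)))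

  module _ (2≤a : 0ℤ ≤ a - + 2) where
    open Bounds a 2≤a

    1≤c0 : ∀ e0 e1 e2 e3 → N₂ D ⟨ e0 , e1 , e2 , e3 ⟩ ≡ 0ℤ → 0ℤ ≤ e2 - 1ℤ → 0ℤ ≤ e1 - 1ℤ → 0ℤ ≤ e0 - 1ℤ
    1≤c0 e0 e1 e2 e3 n₂ 1≤e2 1≤e1 with sign? (e0 - 1ℤ)
    ... | inj₁ p = p
    ... | inj₂ n = ⊥-elim (¬0≤-1
        (0≤+ (0≤+ (0≤+ (0≤i*i (e1 - 1ℤ)) (0≤* (0≤n {2}) 1≤e1)) (0≤* 0≤D (0≤i*i e3))) (0≤* (0≤n {2}) (0≤* n (weaken 1≤e2))))
        (modulo -1ℤ (ring 5 (λ D e0 e1 e2 e3 →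
           (e1 :- :1) :^2 :+ :2 :* (e1 :- :1) :+ D :* e3 :^2 :+ :2 :* ((:- (e0 :- :1) :- :1) :* e2) :=
           con -1ℤ :+ con -1ℤ :* (N₂P D ⟪ e0 , e1 , e2 , e3 ⟫ :- :0)) refl D e0 e1 e2 e3) n₂))

    -- With g = e/θ one has e = θg and e/κ = θ̄g. Their √D coefficients are a g2 + g1 and a g2 - g1;
    -- they differ by 2 g1, and g1 ≥ 1 makes the second strictly smaller.
    divideθ : ∀ g0 g1 g2 g3 {e x} → HasNorm (a * a) 1ℤ ⟨ g0 , g1 , g2 , g3 ⟩ →
      ⟨ a * g0 + D * g3 , a * g1 + g0 , a * g2 + g1 , a * g3 + g2 ⟩ ≡ e →
      ⟨ a * g0 - D * g3 , a * g1 - g0 , a * g2 - g1 , a * g3 - g2 ⟩ ≡ x →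
      0ℤ ≤ c0 e - 1ℤ → 0ℤ ≤ c1 e - 1ℤ → 0ℤ ≤ c2 e - 1ℤ → 0ℤ ≤ c3 e - 1ℤ →
      0ℤ ≤ c0 x × 0ℤ ≤ c2 x × 0ℤ ≤ c2 e - c2 x - 1ℤ
    divideθ g0 g1 g2 g3 (norm n₀ n₂) refl refl p0 p1 p2 p3 = proj₁ r , proj₂ r ,
      subst (0ℤ ≤_) (drop-by a g1 g2) (0≤+ (proj₁ (proj₂ q)) (weaken (proj₁ (proj₂ q))))
      where
      q = quotient-positive g0 g1 g2 g3 n₀ n₂ p0 p1 p2 p3
      r = descend-nonneg g0 g1 g2 g3 (weaken (proj₁ q)) (weaken (proj₁ (proj₂ (proj₂ q)))) n₀ n₂

      drop-by : ∀ a g1 g2 → g1 - 1ℤ + g1 ≡ a * g2 + g1 - (a * g2 - g1) - 1ℤ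
      drop-by = ring 3 (λ a g1 g2 → g1 :- :1 :+ g1 := a :* g2 :+ g1 :- (a :* g2 :- g1) :- :1) refl

    divide : ∀ {e} → HasNorm 1ℤ 0ℤ e → 0ℤ ≤ c0 e → 0ℤ ≤ c2 e - 1ℤ → 0ℤ ≤ c1 e - 1ℤ → 0ℤ ≤ c3 e - 1ℤ →
      ∃ λ x → mulK D (κ a) x ≡ e × HasNorm 1ℤ 0ℤ x × 0ℤ ≤ c0 x × 0ℤ ≤ c2 x × 0ℤ ≤ c2 e - c2 x - 1ℤ
    divide {e} h 0≤e0 1≤e2 1≤e1 1≤e3 = go (mulK D (mulK D (θ̄ a) (η a)) e) (θ·θ̄η e) (κ·θ̄θ̄η e) (θ̄η·-norm h)
      where
      go : ∀ g → mulK D (θ a) g ≡ e → mulK D (κ a) (mulK D (θ̄ a) g) ≡ e → HasNorm (a * a) 1ℤ g →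
        ∃ λ x → mulK D (κ a) x ≡ e × HasNorm 1ℤ 0ℤ x × 0ℤ ≤ c0 x × 0ℤ ≤ c2 x × 0ℤ ≤ c2 e - c2 x - 1ℤ
      go g@(⟨ g0 , g1 , g2 , g3 ⟩) θg≡e κx≡e hg = mulK D (θ̄ a) g , κx≡e , θ̄·-norm hg ,
        divideθ g0 g1 g2 g3 hg (trans (sym (θ·-coords a D g0 g1 g2 g3)) θg≡e) (sym (θ̄·-coords a D g0 g1 g2 g3))
          (1≤c0 (c0 e) (c1 e) (c2 e) (c3 e) (HasNorm.n₂ h) 1≤e2 1≤e1) 1≤e1 1≤e2 1≤e3

    1≤c1c3 : ∀ e0 e1 e2 e3 → N₀ D ⟨ e0 , e1 , e2 , e3 ⟩ ≡ 1ℤ → 0ℤ ≤ e2 - 1ℤ → 0ℤ ≤ e1 * e3 - 1ℤ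
    1≤c1c3 e0 e1 e2 e3 n₀ 1≤e2 = go (sign? (e1 * e3 - 1ℤ))
      where
      identity : ∀ a D e0 e1 e2 e3 → e0 * e0 + D * ((e2 - 1ℤ) * (e2 - 1ℤ) + + 2 * (e2 - 1ℤ)) + (D - a * a - 1ℤ)
        + + 2 * (D * (- (e1 * e3 - 1ℤ) - 1ℤ)) + (a * a - 1ℤ) ≡ -1ℤ + 1ℤ * (N₀ D ⟨ e0 , e1 , e2 , e3 ⟩ - 1ℤ)
      identity = ring 6 (λ a D e0 e1 e2 e3 →
          e0 :^2 :+ D :* ((e2 :- :1) :* (e2 :- :1) :+ :2 :* (e2 :- :1)) :+ (D :- a :* a :- :1)
          :+ :2 :* (D :* (:- (e1 :* e3 :- :1) :- :1)) :+ (a :* a :- :1) :=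
          con -1ℤ :+ :1 :* (N₀P D ⟪ e0 , e1 , e2 , e3 ⟫ :- :1)) refl

      go : 0ℤ ≤ e1 * e3 - 1ℤ ⊎ 0ℤ ≤ - (e1 * e3 - 1ℤ) - 1ℤ → 0ℤ ≤ e1 * e3 - 1ℤ
      go (inj₁ p) = p
      go (inj₂ q) = ⊥-elim (¬0≤-1
        (0≤+ (0≤+ (0≤+ (0≤+ (0≤i*i e0) (0≤* 0≤D (0≤+ (0≤* 1≤e2 1≤e2) (0≤* (0≤n {2}) 1≤e2)))) a²<D) (0≤* (0≤n {2}) (0≤* 0≤D q))) 1≤a²)
        (modulo 1ℤ (identity a D e0 e1 e2 e3) n₀))

    trivial-unit : ∀ e0 e1 e3 → HasNorm 1ℤ 0ℤ ⟨ e0 , e1 , 0ℤ , e3 ⟩ → 0ℤ ≤ e0 → ⟨ e0 , e1 , 0ℤ , e3 ⟩ ≡ 1K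
    trivial-unit e0 e1 e3 (norm n₀ n₂) 0≤e0 = zk≡ e0≡1 e1≡0 refl e3≡0
      where
      e1≡0 : e1 ≡ 0ℤ
      e1≡0 = go (zero-or-square e1)
        where
        identity : ∀ D e0 e1 e3 → e1 * e1 - 1ℤ + D * (e3 * e3) ≡ -1ℤ + -1ℤ * (N₂ D ⟨ e0 , e1 , 0ℤ , e3 ⟩ - 0ℤ)
        identity = ring 4 (λ D e0 e1 e3 → e1 :* e1 :- :1 :+ D :* e3 :^2 := con -1ℤ :+ con -1ℤ :* (N₂P D ⟪ e0 , e1 , :0 , e3 ⟫ :- :0)) refl
        go : e1 ≡ 0ℤ ⊎ 0ℤ ≤ e1 * e1 - 1ℤ → e1 ≡ 0ℤ
        go (inj₁ p) = p
        go (inj₂ p) = ⊥-elim (¬0≤-1 (0≤+ p (0≤* 0≤D (0≤i*i e3))) (modulo -1ℤ (identity D e0 e1 e3) n₂))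

      e3≡0 : e3 ≡ 0ℤ
      e3≡0 = go (zero-or-square e3)
        where
        identity : ∀ a D e0 e1 e3 → e1 * e1 + D * (e3 * e3 - 1ℤ) + (D - a * a - 1ℤ) + a * a ≡ -1ℤ + -1ℤ * (N₂ D ⟨ e0 , e1 , 0ℤ , e3 ⟩ - 0ℤ)
        identity = ring 5 (λ a D e0 e1 e3 →
           e1 :^2 :+ D :* (e3 :* e3 :- :1) :+ (D :- a :* a :- :1) :+ a :* a := con -1ℤ :+ con -1ℤ :* (N₂P D ⟪ e0 , e1 , :0 , e3 ⟫ :- :0)) refl
        go : e3 ≡ 0ℤ ⊎ 0ℤ ≤ e3 * e3 - 1ℤ → e3 ≡ 0ℤ
        go (inj₁ p) = p
        go (inj₂ p) = ⊥-elim (¬0≤-1 (0≤+ (0≤+ (0≤+ (0≤i*i e1) (0≤* 0≤D p)) a²<D) (0≤i*i a)) (modulo -1ℤ (identity a D e0 e1 e3) n₂))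

      e0≡1 : e0 ≡ 1ℤ
      e0≡1 = square-one 0≤e0 (modulo 1ℤ (modulo (+ 2 * (D * e3)) (identity D e0 e1 e3) e1≡0) n₀)
        where
        identity : ∀ D e0 e1 e3 → e0 * e0 ≡ 1ℤ + 1ℤ * (N₀ D ⟨ e0 , e1 , 0ℤ , e3 ⟩ - 1ℤ) + + 2 * (D * e3) * (e1 - 0ℤ)
        identity = ring 4 (λ D e0 e1 e3 →
          e0 :* e0 := :1 :+ :1 :* (N₀P D ⟪ e0 , e1 , :0 , e3 ⟫ :- :1) :+ :2 :* (D :* e3) :* (e1 :- :0)) refl

    -- Descent on e2, with n as a bound: division by κ lowers e2 and preserves the hypotheses. When
    -- e1 and e3 are negative, conjugation makes them positive first and changes neither e0, e2 nor
    -- the norm. At e2 = 0 only 1 remains.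
    norm-one-power : ∀ n e0 e1 e2 e3 → HasNorm 1ℤ 0ℤ ⟨ e0 , e1 , e2 , e3 ⟩ → 0ℤ ≤ e0 → 0ℤ ≤ e2 → 0ℤ ≤ + n - e2 →
      Power± ⟨ e0 , e1 , e2 , e3 ⟩
    norm-one-power n e0 e1 e2 e3 h 0≤e0 0≤e2 e2≤n = cases n e2≤n (sign? (e2 - 1ℤ))
      where
      smaller : ∀ n e x → 1ℤ + n - e + (e - x - 1ℤ) ≡ n - x
      smaller = ring 3 (λ n e x → :1 :+ n :- e :+ (e :- x :- :1) := n :- x) refl

      go : ∀ n → 0ℤ ≤ + n - e2 → 0ℤ ≤ e2 - 1ℤ →
        (0ℤ ≤ e1 - 1ℤ × 0ℤ ≤ e3 - 1ℤ) ⊎ (0ℤ ≤ - e1 - 1ℤ × 0ℤ ≤ - e3 - 1ℤ) → Power± ⟨ e0 , e1 , e2 , e3 ⟩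
      recurse : ∀ n {e} → 0ℤ ≤ + suc n - c2 e →
        (∃ λ x → mulK D (κ a) x ≡ e × HasNorm 1ℤ 0ℤ x × 0ℤ ≤ c0 x × 0ℤ ≤ c2 x × 0ℤ ≤ c2 e - c2 x - 1ℤ) → Power± e
      recurse n {e} p (x@(⟨ x0 , x1 , x2 , x3 ⟩) , eq , hx , 0≤x0 , 0≤x2 , lt) =
        subst Power± eq (κ·-power (norm-one-power n x0 x1 x2 x3 hx 0≤x0 0≤x2
          (subst (0ℤ ≤_) (smaller (+ n) (c2 e) x2) (0≤+ p lt))))

      go zero p 1≤e2 _ = ⊥-elim (¬0≤-1 (0≤+ p 1≤e2) (ring 1 (λ e → :0 :- e :+ (e :- :1) := con -1ℤ) refl e2))
      go (suc n) p 1≤e2 (inj₁ (1≤e1 , 1≤e3)) = recurse n p (divide h 0≤e0 1≤e2 1≤e1 1≤e3)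
      go (suc n) p 1≤e2 (inj₂ (1≤e1 , 1≤e3)) =
        conj-power (recurse n p (divide (conj-norm h) 0≤e0 1≤e2 1≤e1 1≤e3))

      cases : ∀ n → 0ℤ ≤ + n - e2 → 0ℤ ≤ e2 - 1ℤ ⊎ 0ℤ ≤ - (e2 - 1ℤ) - 1ℤ → Power± ⟨ e0 , e1 , e2 , e3 ⟩
      cases n p (inj₁ 1≤e2) = go n p 1≤e2 (positive-product e1 e3 (1≤c1c3 e0 e1 e2 e3 (HasNorm.n₀ h) 1≤e2))
      cases n p (inj₂ e2<1) = at-zero e2≡0 h
        where
        e2≡0 : e2 ≡ 0ℤ
        e2≡0 = 0≤-antisym 0≤e2 (subst (0ℤ ≤_) (ring 1 (λ e → :- (e :- :1) :- :1 := :- e) refl e2) e2<1)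

        at-zero : ∀ {e2} → e2 ≡ 0ℤ → HasNorm 1ℤ 0ℤ ⟨ e0 , e1 , e2 , e3 ⟩ → Power± ⟨ e0 , e1 , e2 , e3 ⟩
        at-zero refl h = plus 0 (trivial-unit e0 e1 e3 h 0≤e0)

-- Nonvanishing of W on the powers of θ

-- The shape of θ^(4q). All its monomials have total degree in a and β divisible by 4, which
-- explains the factors a³, a², a; splitting them off leaves parities that do not depend on that of
-- a. The factors 4, 2, 4 come from θ⁴.
form : ℤ → ℤ → ℤ → ℤ → ℤ → ℤ → ZK
form a k u x y z = ⟨ u , + 4 * k * (a * a * a) * x , + 2 * k * (a * a) * y , + 4 * k * a * z ⟩

:4 :8 :16 : ∀ {n} → Polynomial n
:4 = con (+ 4)
:8 = con (+ 8)
:16 = con (+ 16)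

formP : ∀ {n} (a k u x y z : Polynomial n) → Quartic n
formP a k u x y z = ⟪ u , :4 :* k :* (a :* a :* a) :* x , :2 :* k :* (a :* a) :* y , :4 :* k :* a :* z ⟫

form-square : ∀ a D k u x y z → let a⁴ = a * a * (a * a) in
  mulK D (form a k u x y z) (form a k u x y z) ≡
  form a (+ 2 * k)
    (u * u + + 2 * (D * (k * k * a⁴ * (+ 16 * (x * z) + + 2 * (y * y)))))
    (u * x + + 2 * k * D * (y * z))
    (u * y + + 2 * (+ 2 * k * (a⁴ * (x * x) + D * (z * z))))
    (u * z + + 2 * (k * a⁴ * (x * y)))
form-square a D k u x y z = ringK (a ∷ D ∷ k ∷ u ∷ x ∷ y ∷ z ∷ [])
  (mulP D′ (formP a′ k′ u′ x′ y′ z′) (formP a′ k′ u′ x′ y′ z′))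
  (formP a′ (:2 :* k′)
    (u′ :* u′ :+ :2 :* (D′ :* (k′ :* k′ :* a⁴ :* (:16 :* (x′ :* z′) :+ :2 :* (y′ :* y′)))))
    (u′ :* x′ :+ :2 :* k′ :* D′ :* (y′ :* z′))
    (u′ :* y′ :+ :2 :* (:2 :* k′ :* (a⁴ :* (x′ :* x′) :+ D′ :* (z′ :* z′))))
    (u′ :* z′ :+ :2 :* (k′ :* a⁴ :* (x′ :* y′))))
  refl refl refl refl
  where
  a′ = var (# 0)
  D′ = var (# 1)
  k′ = var (# 2)
  u′ = var (# 3)
  x′ = var (# 4)
  y′ = var (# 5)
  z′ = var (# 6)
  a⁴ = a′ :* a′ :* (a′ :* a′)

form-product : ∀ a D k t u x y z → let a⁴ = a * a * (a * a) in
  mulK D (form a 1ℤ t 1ℤ (+ 3) 1ℤ) (form a (+ 2 * k) u x y z) ≡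
  form a 1ℤ
    (t * u + D * (k * a⁴ * (+ 32 * z + + 24 * y + + 32 * x)))
    (u + + 2 * k * (t * x + + 2 * (D * (+ 3 * z + y))))
    (+ 3 * u + + 2 * (k * (t * y + + 8 * (a⁴ * x + D * z))))
    (u + + 2 * (k * (t * z + + 2 * (a⁴ * (y + + 3 * x)))))
form-product a D k t u x y z = ringK (a ∷ D ∷ k ∷ t ∷ u ∷ x ∷ y ∷ z ∷ [])
  (mulP D′ (formP a′ :1 t′ :1 :3 :1) (formP a′ (:2 :* k′) u′ x′ y′ z′))
  (formP a′ :1
    (t′ :* u′ :+ D′ :* (k′ :* a⁴ :* (con (+ 32) :* z′ :+ con (+ 24) :* y′ :+ con (+ 32) :* x′)))
    (u′ :+ :2 :* k′ :* (t′ :* x′ :+ :2 :* (D′ :* (:3 :* z′ :+ y′))))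
    (:3 :* u′ :+ :2 :* (k′ :* (t′ :* y′ :+ :8 :* (a⁴ :* x′ :+ D′ :* z′))))
    (u′ :+ :2 :* (k′ :* (t′ :* z′ :+ :2 :* (a⁴ :* (y′ :+ :3 :* x′))))))
  refl refl refl refl
  where
  a′ = var (# 0)
  D′ = var (# 1)
  k′ = var (# 2)
  t′ = var (# 3)
  u′ = var (# 4)
  x′ = var (# 5)
  y′ = var (# 6)
  z′ = var (# 7)
  a⁴ = a′ :* a′ :* (a′ :* a′)
  :3 = con (+ 3)

W-form : ∀ a k u x y z → W (form a k u x y z) ≡ + 4 * (k * a) * (u * z - + 2 * (k * (a * a * (a * a)) * (x * y)))
W-form = ring 6 (λ a k u x y z →
  u :* (:4 :* k :* a :* z) :- (:4 :* k :* (a :* a :* a) :* x) :* (:2 :* k :* (a :* a) :* y) :=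
  :4 :* (k :* a) :* (u :* z :- :2 :* (k :* (a :* a :* (a :* a)) :* (x :* y)))) refl

WP : ∀ {n} → Quartic n → Polynomial n
WP ⟪ a , b , c , d ⟫ = a :* d :- b :* c

W-θ·form : ∀ a D k u x y z → let a⁴ = a * a * (a * a) in
  W (mulK D (θ a) (form a k u x y z)) ≡ + 4 * (k * (a * a * a)) *
    (u * (z - x) + + 2 * k * (+ 2 * (D * (z * z)) + y * (D * z - a⁴ * x) - + 2 * (a⁴ * (x * x))))
W-θ·form = ring 7 (λ a D k u x y z → let a⁴ = a :* a :* (a :* a) in
  WP (mulP D (θP a) (formP a k u x y z)) := :4 :* (k :* (a :* a :* a)) :*
    (u :* (z :- x) :+ :2 :* k :* (:2 :* (D :* (z :* z)) :+ y :* (D :* z :- a⁴ :* x) :- :2 :* (a⁴ :* (x :* x))))) refl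

W-θ̄·form : ∀ a D k u x y z → let a⁴ = a * a * (a * a) in
  W (mulK D (θ̄ a) (form a k u x y z)) ≡ + 4 * (k * (a * a * a)) *
    (u * (z - x) - + 2 * k * (+ 2 * (D * (z * z)) - y * (D * z - a⁴ * x) - + 2 * (a⁴ * (x * x))))
W-θ̄·form = ring 7 (λ a D k u x y z → let a⁴ = a :* a :* (a :* a) in
  WP (mulP D (θ̄P a) (formP a k u x y z)) := :4 :* (k :* (a :* a :* a)) :*
    (u :* (z :- x) :- :2 :* k :* (:2 :* (D :* (z :* z)) :- y :* (D :* z :- a⁴ :* x) :- :2 :* (a⁴ :* (x :* x))))) refl

W-θ²·form : ∀ a D k u x y z → let a⁴ = a * a * (a * a) in
  W (mulK D (θ a) (mulK D (θ a) (form a k u x y z))) ≡ + 2 * a *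
    ((a * a * u + D * (+ 2 * k * (a * a) * (+ 4 * z + y))) * (+ 2 * (k * (a * a) * (z + y + x)))
     - (u + + 2 * (k * a⁴ * (y + + 4 * x))) * (u + + 2 * (k * (a⁴ * x + D * z))))
W-θ²·form = ring 7 (λ a D k u x y z → let a⁴ = a :* a :* (a :* a) in
  WP (mulP D (θP a) (mulP D (θP a) (formP a k u x y z))) := :2 :* a :*
    ((a :* a :* u :+ D :* (:2 :* k :* (a :* a) :* (:4 :* z :+ y))) :* (:2 :* (k :* (a :* a) :* (z :+ y :+ x)))
     :- (u :+ :2 :* (k :* a⁴ :* (y :+ :4 :* x))) :* (u :+ :2 :* (k :* (a⁴ :* x :+ D :* z))))) refl

odd≢0 : ∀ i → 1ℤ + + 2 * i ≢ 0ℤ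
odd≢0 i eq with sign? i
... | inj₁ p = ¬0≤-1 (0≤* (0≤n {2}) p) (modulo 1ℤ (ring 1 (λ i → :2 :* i := con -1ℤ :+ :1 :* (:1 :+ :2 :* i :- :0)) refl i) eq)
... | inj₂ p = ¬0≤-1 (0≤* (0≤n {2}) p) (modulo -1ℤ (ring 1 (λ i → :2 :* (:- i :- :1) := con -1ℤ :+ con -1ℤ :* (:1 :+ :2 :* i :- :0)) refl i) eq)

*-≢0 : ∀ {i j} → i ≢ 0ℤ → j ≢ 0ℤ → i * j ≢ 0ℤ
*-≢0 {i} i≢0 j≢0 eq with ℤ.i*j≡0⇒i≡0∨j≡0 i eq
... | inj₁ p = i≢0 p
... | inj₂ p = j≢0 p

2≢0 : + 2 ≢ 0ℤ
2≢0 ()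

4≢0 : + 4 ≢ 0ℤ
4≢0 ()

form≡ : ∀ a k {u u′ x x′ y y′ z z′} → u ≡ u′ → x ≡ x′ → y ≡ y′ → z ≡ z′ → form a k u x y z ≡ form a k u′ x′ y′ z′
form≡ a k refl refl refl refl = refl

-- θ^(4q) has this shape with k the largest power of 2 dividing q.  The relation between the second and
-- the last entry is the 2-adic information that keeps W nonzero after multiplication by θ or θ̄.
data Good (a k : ℤ) : ZK → Set where
  good : ∀ p q d r →
    Good a k (form a k (1ℤ + + 2 * p) (1ℤ + + 2 * d - + 2 * (1ℤ + k + + 2 * r)) (1ℤ + + 2 * q) (1ℤ + + 2 * d))

-- Modulo 4 squaring adds to z - x the number 2k times an odd one, because D = a⁴ - 1 turns a⁴x - Dz
-- into z minus a multiple of z - x. So z - x passes from 2(1 + k) to 2 + 4k, which is the value 2(1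
-- + 2k) required for the doubled k.
good-square : ∀ {a k s} → Good a k s → Good a (+ 2 * k) (mulK (disc a) s s)
good-square {a} {k} (good p q d r) = subst (Good a (+ 2 * k))
  (sym (trans (form-square a (disc a) k (1ℤ + + 2 * p) x y z)
    (form≡ a (+ 2 * k) (lemma-p p E) (lemma-x (a * a * (a * a)) k p q d r) (lemma-q p q F) (lemma-q p d G))))
  (good (+ 2 * p + + 2 * p * p + E) (p + q + + 2 * p * q + F) (p + d + + 2 * p * d + G)
    (r + p * (1ℤ + k + + 2 * r) - k * (a * a * (a * a)) * y * (1ℤ + k + + 2 * r) + k * (q + d + + 2 * q * d)))
  where
  a⁴ = a * a * (a * a)
  x = 1ℤ + + 2 * d - + 2 * (1ℤ + k + + 2 * r)
  y = 1ℤ + + 2 * q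
  z = 1ℤ + + 2 * d
  E = disc a * (k * k * a⁴ * (+ 16 * (x * z) + + 2 * (y * y)))
  F = + 2 * k * (a⁴ * (x * x) + disc a * (z * z))
  G = k * a⁴ * (x * y)

  lemma-p : ∀ p E → (1ℤ + + 2 * p) * (1ℤ + + 2 * p) + + 2 * E ≡ 1ℤ + + 2 * (+ 2 * p + + 2 * p * p + E)
  lemma-p = ring 2 (λ p E → (:1 :+ :2 :* p) :* (:1 :+ :2 :* p) :+ :2 :* E := :1 :+ :2 :* (:2 :* p :+ :2 :* p :* p :+ E)) refl

  lemma-q : ∀ p q F → (1ℤ + + 2 * p) * (1ℤ + + 2 * q) + + 2 * F ≡ 1ℤ + + 2 * (p + q + + 2 * p * q + F)
  lemma-q = ring 3 (λ p q F → (:1 :+ :2 :* p) :* (:1 :+ :2 :* q) :+ :2 :* F := :1 :+ :2 :* (p :+ q :+ :2 :* p :* q :+ F)) refl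

  lemma-x : ∀ A k p q d r → let x = 1ℤ + + 2 * d - + 2 * (1ℤ + k + + 2 * r); y = 1ℤ + + 2 * q; z = 1ℤ + + 2 * d in
    (1ℤ + + 2 * p) * x + + 2 * k * (A - 1ℤ) * (y * z) ≡
    1ℤ + + 2 * (p + d + + 2 * p * d + k * A * (x * y))
      - + 2 * (1ℤ + + 2 * k + + 2 * (r + p * (1ℤ + k + + 2 * r) - k * A * y * (1ℤ + k + + 2 * r) + k * (q + d + + 2 * q * d)))
  lemma-x = ring 6 (λ A k p q d r → let x = :1 :+ :2 :* d :- :2 :* (:1 :+ k :+ :2 :* r); y = :1 :+ :2 :* q; z = :1 :+ :2 :* d in
    (:1 :+ :2 :* p) :* x :+ :2 :* k :* (A :- :1) :* (y :* z) :=
    :1 :+ :2 :* (p :+ d :+ :2 :* p :* d :+ k :* A :* (x :* y))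
      :- :2 :* (:1 :+ :2 :* k :+ :2 :* (r :+ p :* (:1 :+ k :+ :2 :* r) :- k :* A :* y :* (:1 :+ k :+ :2 :* r) :+ k :* (q :+ d :+ :2 :* q :* d)))) refl

θ⁴ : ∀ a → powK (disc a) (θ a) 4 ≡ form a 1ℤ (1ℤ + + 2 * disc a) 1ℤ (+ 3) 1ℤ
θ⁴ a = ringK (a ∷ []) (mulP (δ α) (θP α) (mulP (δ α) (θP α) (mulP (δ α) (θP α) (mulP (δ α) (θP α) ⟪ :1 , :0 , :0 , :0 ⟫))))
  (formP α :1 (:1 :+ :2 :* δ α) :1 (con (+ 3)) :1) refl refl refl refl
  where α = var (# 0)

good-base : ∀ a → Good a 1ℤ (powK (disc a) (θ a) 4)
-- In θ⁴ the entries x and z are both 1, so 1 + k + 2r has to vanish at k = 1.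
good-base a = subst (Good a 1ℤ) (sym (θ⁴ a)) (good (disc a) 1ℤ 0ℤ -1ℤ)

-- Both new outer entries are u plus 2k times an odd number, so their difference is divisible by 4,
-- as the relation demands for k = 1. An odd q thus restarts the 2-adic count.
good-product : ∀ {a k s} → Good a (+ 2 * k) s → Good a 1ℤ (mulK (disc a) (powK (disc a) (θ a) 4) s)
good-product {a} {k} (good p q d r) = subst (Good a 1ℤ)
  (sym (trans (cong (λ e → mulK D e (form a (+ 2 * k) (1ℤ + + 2 * p) x y z)) (θ⁴ a))
    (trans (form-product a D k (1ℤ + + 2 * D) (1ℤ + + 2 * p) x y z)
      (form≡ a 1ℤ (lemma-p D p E x y z) (lemma-x (a * a * (a * a)) D k p q d r) (lemma-y p F) (lemma-z p G)))))
  (good (p + D + + 2 * D * p + D * (E * (+ 16 * z + + 12 * y + + 16 * x))) (1ℤ + + 3 * p + F) (p + G)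
    (k * (1ℤ + + 2 * D) * (1ℤ + + 2 * k + + 2 * r) + k * a⁴ * (y + + 3 * x) - k * D * (+ 3 * z + y) - 1ℤ))
  where
  D = disc a
  a⁴ = a * a * (a * a)
  x = 1ℤ + + 2 * d - + 2 * (1ℤ + + 2 * k + + 2 * r)
  y = 1ℤ + + 2 * q
  z = 1ℤ + + 2 * d
  E = k * a⁴
  F = k * ((1ℤ + + 2 * D) * y + + 8 * (a⁴ * x + D * z))
  G = k * ((1ℤ + + 2 * D) * z + + 2 * (a⁴ * (y + + 3 * x)))

  lemma-p : ∀ D p E x y z → (1ℤ + + 2 * D) * (1ℤ + + 2 * p) + D * (E * (+ 32 * z + + 24 * y + + 32 * x)) ≡
    1ℤ + + 2 * (p + D + + 2 * D * p + D * (E * (+ 16 * z + + 12 * y + + 16 * x)))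
  lemma-p = ring 6 (λ D p E x y z → (:1 :+ :2 :* D) :* (:1 :+ :2 :* p) :+ D :* (E :* (con (+ 32) :* z :+ con (+ 24) :* y :+ con (+ 32) :* x)) :=
    :1 :+ :2 :* (p :+ D :+ :2 :* D :* p :+ D :* (E :* (con (+ 16) :* z :+ con (+ 12) :* y :+ con (+ 16) :* x)))) refl

  lemma-y : ∀ p F → + 3 * (1ℤ + + 2 * p) + + 2 * F ≡ 1ℤ + + 2 * (1ℤ + + 3 * p + F)
  lemma-y = ring 2 (λ p F → con (+ 3) :* (:1 :+ :2 :* p) :+ :2 :* F := :1 :+ :2 :* (:1 :+ con (+ 3) :* p :+ F)) refl

  lemma-z : ∀ p G → 1ℤ + + 2 * p + + 2 * G ≡ 1ℤ + + 2 * (p + G)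
  lemma-z = ring 2 (λ p G → :1 :+ :2 :* p :+ :2 :* G := :1 :+ :2 :* (p :+ G)) refl

  lemma-x : ∀ A D k p q d r → let x = 1ℤ + + 2 * d - + 2 * (1ℤ + + 2 * k + + 2 * r); y = 1ℤ + + 2 * q; z = 1ℤ + + 2 * d; t = 1ℤ + + 2 * D in
    1ℤ + + 2 * p + + 2 * k * (t * x + + 2 * (D * (+ 3 * z + y))) ≡
    1ℤ + + 2 * (p + k * (t * z + + 2 * (A * (y + + 3 * x))))
      - + 2 * (1ℤ + 1ℤ + + 2 * (k * t * (1ℤ + + 2 * k + + 2 * r) + k * A * (y + + 3 * x) - k * D * (+ 3 * z + y) - 1ℤ))
  lemma-x = ring 7 (λ A D k p q d r → let x = :1 :+ :2 :* d :- :2 :* (:1 :+ :2 :* k :+ :2 :* r); y = :1 :+ :2 :* q; z = :1 :+ :2 :* d; t = :1 :+ :2 :* D; :3 = con (+ 3) in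
    :1 :+ :2 :* p :+ :2 :* k :* (t :* x :+ :2 :* (D :* (:3 :* z :+ y))) :=
    :1 :+ :2 :* (p :+ k :* (t :* z :+ :2 :* (A :* (y :+ :3 :* x))))
      :- :2 :* (:1 :+ :1 :+ :2 :* (k :* t :* (:1 :+ :2 :* k :+ :2 :* r) :+ k :* A :* (y :+ :3 :* x) :- k :* D :* (:3 :* z :+ y) :- :1))) refl

powK-+ : ∀ m x i j → powK m x (i ℕ.+ j) ≡ mulK m (powK m x i) (powK m x j)
powK-+ m x zero j = sym (mulK-identityˡ m (powK m x j))
powK-+ m x (suc i) j = trans (cong (mulK m x) (powK-+ m x i j)) (sym (mulK-assoc m x (powK m x i) (powK m x j)))

halve : ∀ n → ∃ λ h → n ≡ h ℕ.+ h ⊎ n ≡ suc (h ℕ.+ h)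
halve zero = 0 , inj₁ refl
halve (suc n) with halve n
... | h , inj₁ refl = h , inj₂ refl
... | h , inj₂ refl = suc h , inj₁ (cong suc (sym (ℕ.+-suc h h)))

mod4 : ∀ n → ∃ λ q → n ≡ q ℕ.* 4 ⊎ n ≡ suc (q ℕ.* 4) ⊎ n ≡ suc (suc (q ℕ.* 4)) ⊎ n ≡ suc (suc (suc (q ℕ.* 4)))
mod4 zero = 0 , inj₁ refl
mod4 (suc n) with mod4 n
... | q , inj₁ eq = q , inj₂ (inj₁ (cong suc eq))
... | q , inj₂ (inj₁ eq) = q , inj₂ (inj₂ (inj₁ (cong suc eq)))
... | q , inj₂ (inj₂ (inj₁ eq)) = q , inj₂ (inj₂ (inj₂ (cong suc eq)))
... | q , inj₂ (inj₂ (inj₂ eq)) = suc q , inj₁ (cong suc eq)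

η·θ̄·θ : ∀ a x → mulK (disc a) (η a) (mulK (disc a) (θ̄ a) (mulK (disc a) (θ a) x)) ≡ x
η·θ̄·θ a x = begin
  mulK D (η a) (mulK D (θ̄ a) (mulK D (θ a) x)) ≡⟨ cong (mulK D (η a)) (sym (mulK-assoc D (θ̄ a) (θ a) x)) ⟩
  mulK D (η a) (mulK D (mulK D (θ̄ a) (θ a)) x) ≡⟨ cong (λ y → mulK D (η a) (mulK D y x)) (mulK-comm D (θ̄ a) (θ a)) ⟩
  mulK D (η a) (mulK D (mulK D (θ a) (θ̄ a)) x) ≡⟨ cong (mulK D (η a)) (mulK-assoc D (θ a) (θ̄ a) x) ⟩
  mulK D (η a) (mulK D (θ a) (mulK D (θ̄ a) x)) ≡⟨ sym (mulK-assoc D (η a) (θ a) (mulK D (θ̄ a) x)) ⟩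
  mulK D (mulK D (η a) (θ a)) (mulK D (θ̄ a) x) ≡⟨ cong (λ y → mulK D y (mulK D (θ̄ a) x)) (mulK-comm D (η a) (θ a)) ⟩
  mulK D (mulK D (θ a) (η a)) (mulK D (θ̄ a) x) ≡⟨ Units.θη·θ̄ a x ⟩
  x ∎
  where
  open ≡-Reasoning
  D = disc a

module _ (a : ℤ) where
  private
    D = disc a
    θ^_ : ℕ → ZK
    θ^ n = powK D (θ a) n

  θ^double : ∀ h → θ^ ((h ℕ.+ h) ℕ.* 4) ≡ mulK D (θ^ (h ℕ.* 4)) (θ^ (h ℕ.* 4))
  θ^double h = trans (cong θ^_ (ℕ.*-distribʳ-+ 4 h h)) (powK-+ D (θ a) (h ℕ.* 4) (h ℕ.* 4))

  GoodPower : ℕ → Set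
  GoodPower n = ∃ λ k → k ≢ 0ℤ × Good a k (θ^ (n ℕ.* 4))

  good-double : ∀ h → GoodPower h → GoodPower (h ℕ.+ h)
  good-double h (k , k≢0 , g) = + 2 * k , *-≢0 2≢0 k≢0 , subst (Good a (+ 2 * k)) (sym (θ^double h)) (good-square g)

  good-suc-double : ∀ h → GoodPower h → GoodPower (suc (h ℕ.+ h))
  good-suc-double h (k , k≢0 , g) = 1ℤ , (λ ()) , subst (Good a 1ℤ)
    (sym (trans (powK-+ D (θ a) 4 ((h ℕ.+ h) ℕ.* 4)) (cong (mulK D (θ^ 4)) (θ^double h))))
    (good-product (good-square g))

  -- Binary recursion on the exponent: squaring θ^(4h) gives 2h, and one further factor θ⁴ gives 2h
  -- + 1.
  good-power : ∀ n → GoodPower (suc n)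
  good-power n = go (suc n) n ℕ.≤-refl
    where
    go : ∀ fuel n → n ℕ.< fuel → GoodPower (suc n)
    step : ∀ fuel n → n ℕ.< suc fuel → (∃ λ h → n ≡ h ℕ.+ h ⊎ n ≡ suc (h ℕ.+ h)) → GoodPower (suc n)
    step fuel _ n<fuel (zero , inj₁ refl) = 1ℤ , (λ ()) , good-base a
    step fuel _ n<fuel (suc h , inj₁ refl) =
      good-suc-double (suc h) (go fuel h (ℕ.≤-trans (ℕ.m≤m+n (suc h) (suc h)) (ℕ.s≤s⁻¹ n<fuel)))
    step fuel _ n<fuel (h , inj₂ refl) = subst GoodPower (cong suc (ℕ.+-suc h h))
      (good-double (suc h) (go fuel h (ℕ.≤-trans (ℕ.s≤s (ℕ.m≤m+n h h)) (ℕ.s≤s⁻¹ n<fuel))))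

    go (suc fuel) n n<fuel = step fuel n n<fuel (halve n)

  W-η : ∀ e → W (mulK D (η a) e) ≡ W e
  W-η ⟨ e0 , e1 , e2 , e3 ⟩ = identity a e0 e1 e2 e3
    where
    identity : ∀ a e0 e1 e2 e3 → W (mulK (disc a) (η a) ⟨ e0 , e1 , e2 , e3 ⟩) ≡ W ⟨ e0 , e1 , e2 , e3 ⟩
    identity = ring 5 (λ a e0 e1 e2 e3 → WP (mulP (δ a) (ηP a) ⟪ e0 , e1 , e2 , e3 ⟫) := WP ⟪ e0 , e1 , e2 , e3 ⟫) refl

  module _ (a≢0 : a ≢ 0ℤ) where
    private
      a³≢0 : a * a * a ≢ 0ℤ
      a³≢0 = *-≢0 (*-≢0 a≢0 a≢0) a≢0

      by : ∀ {i} c j w → i ≡ c * w → w ≡ j → c ≢ 0ℤ → j ≢ 0ℤ → i ≢ 0ℤ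
      by c j w refl refl c≢0 j≢0 = *-≢0 c≢0 j≢0

    -- Besides 4ka, the value has the factor uz - 2(...), which is odd because u and z are.
    W-good : ∀ {k s} → k ≢ 0ℤ → Good a k s → W s ≢ 0ℤ
    W-good {k} k≢0 (good p q d r) = by (+ 4 * (k * a)) (1ℤ + + 2 * v) w
      (W-form a k (1ℤ + + 2 * p) x (1ℤ + + 2 * q) (1ℤ + + 2 * d)) (identity p d u)
      (*-≢0 4≢0 (*-≢0 k≢0 a≢0)) (odd≢0 v)
      where
      x u v w : ℤ
      x = 1ℤ + + 2 * d - + 2 * (1ℤ + k + + 2 * r)
      u = k * (a * a * (a * a)) * (x * (1ℤ + + 2 * q))
      v = p + d + + 2 * p * d - u
      w = (1ℤ + + 2 * p) * (1ℤ + + 2 * d) - + 2 * u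
      identity : ∀ p d w → (1ℤ + + 2 * p) * (1ℤ + + 2 * d) - + 2 * w ≡ 1ℤ + + 2 * (p + d + + 2 * p * d - w)
      identity = ring 3 (λ p d w → (:1 :+ :2 :* p) :* (:1 :+ :2 :* d) :- :2 :* w := :1 :+ :2 :* (p :+ d :+ :2 :* p :* d :- w)) refl

    W-θ·form≢0 : ∀ D k u x y z v → k ≢ 0ℤ → (let a⁴ = a * a * (a * a)) →
      u * (z - x) + + 2 * k * (+ 2 * (D * (z * z)) + y * (D * z - a⁴ * x) - + 2 * (a⁴ * (x * x))) ≡ + 2 * (1ℤ + + 2 * v) →
      W (mulK D (θ a) (form a k u x y z)) ≢ 0ℤ
    W-θ·form≢0 D k u x y z v k≢0 eq = by (+ 4 * (k * (a * a * a))) (+ 2 * (1ℤ + + 2 * v))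
      (u * (z - x) + + 2 * k * (+ 2 * (D * (z * z)) + y * (D * z - a * a * (a * a) * x) - + 2 * (a * a * (a * a) * (x * x))))
      (W-θ·form a D k u x y z) eq (*-≢0 4≢0 (*-≢0 k≢0 a³≢0)) (*-≢0 2≢0 (odd≢0 v))

    -- Modulo 4 the bracket in `W-θ·form` is (z - x) + 2k, since u is odd and so is y(Dz - a⁴x). The
    -- relation in `Good` makes this 2(1 + k) + 2k, that is 2 modulo 4, whatever the parity of k;
    -- the term 1 + k there is chosen for this purpose.
    W-θ·good : ∀ {k s} → k ≢ 0ℤ → Good a k s → W (mulK D (θ a) s) ≢ 0ℤ
    W-θ·good {k} k≢0 (good p q d r) = W-θ·form≢0 D k
      (1ℤ + + 2 * p) (1ℤ + + 2 * d - + 2 * (1ℤ + k + + 2 * r)) (1ℤ + + 2 * q) (1ℤ + + 2 * d)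
      (proj₁ (identity (a * a * (a * a)) D k p q d r refl)) k≢0
      (proj₂ (identity (a * a * (a * a)) D k p q d r refl))
      where
      identity : ∀ A D k p q d r → D ≡ A - 1ℤ →
        let x = 1ℤ + + 2 * d - + 2 * (1ℤ + k + + 2 * r); y = 1ℤ + + 2 * q; z = 1ℤ + + 2 * d in
        ∃ λ v → (1ℤ + + 2 * p) * (z - x) + + 2 * k * (+ 2 * (D * (z * z)) + y * (D * z - A * x) - + 2 * (A * (x * x))) ≡ + 2 * (1ℤ + + 2 * v)
      identity A _ k p q d r refl =
        (let x = 1ℤ + + 2 * d - + 2 * (1ℤ + k + + 2 * r); y = 1ℤ + + 2 * q; z = 1ℤ + + 2 * d; D = A - 1ℤ in
        r + p * (1ℤ + k + + 2 * r) + k * D * (z * z) + k * A * y * (1ℤ + k + + 2 * r) - k * (q + d + + 2 * q * d) - k * A * (x * x)) ,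
        ring 6 (λ A k p q d r → let x = :1 :+ :2 :* d :- :2 :* (:1 :+ k :+ :2 :* r); y = :1 :+ :2 :* q; z = :1 :+ :2 :* d; D = A :- :1 in
        (:1 :+ :2 :* p) :* (z :- x) :+ :2 :* k :* (:2 :* (D :* (z :* z)) :+ y :* (D :* z :- A :* x) :- :2 :* (A :* (x :* x))) :=
        :2 :* (:1 :+ :2 :* (r :+ p :* (:1 :+ k :+ :2 :* r) :+ k :* D :* (z :* z) :+ k :* A :* y :* (:1 :+ k :+ :2 :* r) :- k :* (q :+ d :+ :2 :* q :* d) :- k :* A :* (x :* x)))) refl A k p q d r

    W-θ̄·form≢0 : ∀ D k u x y z v → k ≢ 0ℤ → (let a⁴ = a * a * (a * a)) →
      u * (z - x) - + 2 * k * (+ 2 * (D * (z * z)) - y * (D * z - a⁴ * x) - + 2 * (a⁴ * (x * x))) ≡ + 2 * (1ℤ + + 2 * v) →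
      W (mulK D (θ̄ a) (form a k u x y z)) ≢ 0ℤ
    W-θ̄·form≢0 D k u x y z v k≢0 eq = by (+ 4 * (k * (a * a * a))) (+ 2 * (1ℤ + + 2 * v))
      (u * (z - x) - + 2 * k * (+ 2 * (D * (z * z)) - y * (D * z - a * a * (a * a) * x) - + 2 * (a * a * (a * a) * (x * x))))
      (W-θ̄·form a D k u x y z) eq (*-≢0 4≢0 (*-≢0 k≢0 a³≢0)) (*-≢0 2≢0 (odd≢0 v))

    W-θ̄·good : ∀ {k s} → k ≢ 0ℤ → Good a k s → W (mulK D (θ̄ a) s) ≢ 0ℤ
    W-θ̄·good {k} k≢0 (good p q d r) = W-θ̄·form≢0 D k
      (1ℤ + + 2 * p) (1ℤ + + 2 * d - + 2 * (1ℤ + k + + 2 * r)) (1ℤ + + 2 * q) (1ℤ + + 2 * d)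
      (proj₁ (identity (a * a * (a * a)) D k p q d r refl)) k≢0
      (proj₂ (identity (a * a * (a * a)) D k p q d r refl))
      where
      identity : ∀ A D k p q d r → D ≡ A - 1ℤ →
        let x = 1ℤ + + 2 * d - + 2 * (1ℤ + k + + 2 * r); y = 1ℤ + + 2 * q; z = 1ℤ + + 2 * d in
        ∃ λ v → (1ℤ + + 2 * p) * (z - x) - + 2 * k * (+ 2 * (D * (z * z)) - y * (D * z - A * x) - + 2 * (A * (x * x))) ≡ + 2 * (1ℤ + + 2 * v)
      identity A _ k p q d r refl =
        (let x = 1ℤ + + 2 * d - + 2 * (1ℤ + k + + 2 * r); y = 1ℤ + + 2 * q; z = 1ℤ + + 2 * d; D = A - 1ℤ in
        r + p * (1ℤ + k + + 2 * r) - k * D * (z * z) + k * A * y * (1ℤ + k + + 2 * r) - k * (q + d + + 2 * q * d) + k * A * (x * x)) ,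
        ring 6 (λ A k p q d r → let x = :1 :+ :2 :* d :- :2 :* (:1 :+ k :+ :2 :* r); y = :1 :+ :2 :* q; z = :1 :+ :2 :* d; D = A :- :1 in
        (:1 :+ :2 :* p) :* (z :- x) :- :2 :* k :* (:2 :* (D :* (z :* z)) :- y :* (D :* z :- A :* x) :- :2 :* (A :* (x :* x))) :=
        :2 :* (:1 :+ :2 :* (r :+ p :* (:1 :+ k :+ :2 :* r) :- k :* D :* (z :* z) :+ k :* A :* y :* (:1 :+ k :+ :2 :* r) :- k :* (q :+ d :+ :2 :* q :* d) :+ k :* A :* (x :* x)))) refl A k p q d r

    -- With u odd the bracket in `W-θ²·form` is an even number minus a product of two odd ones.
    W-θ²·form≢0 : ∀ k p x y z → W (mulK D (θ a) (mulK D (θ a) (form a k (1ℤ + + 2 * p) x y z))) ≢ 0ℤ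
    W-θ²·form≢0 k p x y z = conclude
      (a * a * (1ℤ + + 2 * p) + D * (+ 2 * k * (a * a) * (+ 4 * z + y)))
      (k * (a * a) * (z + y + x))
      (k * (a * a * (a * a)) * (y + + 4 * x))
      (k * (a * a * (a * a) * x + D * z))
      (W-θ²·form a D k (1ℤ + + 2 * p) x y z)
      where
      identity : ∀ p R S T V → R * (+ 2 * S) - (1ℤ + + 2 * p + + 2 * T) * (1ℤ + + 2 * p + + 2 * V) ≡
        1ℤ + + 2 * (R * S - 1ℤ - + 2 * p - + 2 * p * p - T - V - + 2 * p * (T + V) - + 2 * T * V)
      identity = ring 5 (λ p R S T V → R :* (:2 :* S) :- (:1 :+ :2 :* p :+ :2 :* T) :* (:1 :+ :2 :* p :+ :2 :* V) :=
        :1 :+ :2 :* (R :* S :- :1 :- :2 :* p :- :2 :* p :* p :- T :- V :- :2 :* p :* (T :+ V) :- :2 :* T :* V)) refl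

      conclude : ∀ {i} R S T V → i ≡ + 2 * a * (R * (+ 2 * S) - (1ℤ + + 2 * p + + 2 * T) * (1ℤ + + 2 * p + + 2 * V)) → i ≢ 0ℤ
      conclude R S T V eq = by (+ 2 * a) (1ℤ + + 2 * (R * S - 1ℤ - + 2 * p - + 2 * p * p - T - V - + 2 * p * (T + V) - + 2 * T * V))
        (R * (+ 2 * S) - (1ℤ + + 2 * p + + 2 * T) * (1ℤ + + 2 * p + + 2 * V))
        eq (identity p R S T V) (*-≢0 2≢0 a≢0)
        (odd≢0 (R * S - 1ℤ - + 2 * p - + 2 * p * p - T - V - + 2 * p * (T + V) - + 2 * T * V))

    record OddForm (k : ℤ) (s : ZK) : Set where
      field
        p x y z : ℤ
        eq : s ≡ form a k (1ℤ + + 2 * p) x y z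

    good⇒odd-form : ∀ {k s} → Good a k s → OddForm k s
    good⇒odd-form (good p q d r) = record { p = p ; eq = refl }

    W-θ²·good : ∀ {k s} → Good a k s → W (mulK D (θ a) (mulK D (θ a) s)) ≢ 0ℤ
    W-θ²·good {k} {s} g = subst (λ s → W (mulK D (θ a) (mulK D (θ a) s)) ≢ 0ℤ) (sym eq) (W-θ²·form≢0 k p x y z)
      where
      open OddForm (good⇒odd-form g)

    W-θ^ : ∀ n → 2 ℕ.≤ n → W (θ^ n) ≢ 0ℤ
    W-θ^ n = go (mod4 n)
      where
      θ^suc : ∀ n → θ^ (suc n) ≡ mulK D (θ a) (θ^ n)
      θ^suc n = refl

      θ^2+ : ∀ n → θ^ (suc (suc n)) ≡ mulK D (θ a) (mulK D (θ a) (θ^ n))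
      θ^2+ n = refl

      NonZeroW : ℕ → Set
      NonZeroW n = W (θ^ n) ≢ 0ℤ

      case0 : ∀ q → GoodPower (suc q) → NonZeroW (suc q ℕ.* 4)
      case0 q (k , k≢0 , g) = W-good {k} {θ^ (suc q ℕ.* 4)} k≢0 g

      case1 : ∀ q → GoodPower (suc q) → NonZeroW (suc (suc q ℕ.* 4))
      case1 q (k , k≢0 , g) = subst (λ e → W e ≢ 0ℤ) (sym (θ^suc (suc q ℕ.* 4))) (W-θ·good {k} {θ^ (suc q ℕ.* 4)} k≢0 g)

      case2 : ∀ q → GoodPower (suc q) → NonZeroW (suc (suc (suc q ℕ.* 4)))
      case2 q (k , k≢0 , g) = subst (λ e → W e ≢ 0ℤ) (sym (θ^2+ (suc q ℕ.* 4))) (W-θ²·good {k} {θ^ (suc q ℕ.* 4)} g)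

      -- The exponent 2 lies below θ⁴, but 1 is the degenerate form with k = 0 and odd constant
      -- term.
      case2′ : NonZeroW 2
      case2′ = subst (λ e → W e ≢ 0ℤ) (sym (trans (θ^2+ 0) (cong (λ e → mulK D (θ a) (mulK D (θ a) e)) 1K≡)))
        (W-θ²·form≢0 0ℤ 0ℤ 0ℤ 0ℤ 0ℤ)
        where
        1K≡ : θ^ 0 ≡ form a 0ℤ (1ℤ + + 2 * 0ℤ) 0ℤ 0ℤ 0ℤ
        1K≡ = refl

      -- The exponent 4n + 3 is reached from above: it belongs to η θ̄ θ^(4n+4), and W does not see
      -- η.
      case3 : ∀ n → GoodPower (suc n) → suc n ℕ.* 4 ≡ suc (suc (suc (suc (n ℕ.* 4)))) → NonZeroW (suc (suc (suc (n ℕ.* 4))))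
      case3 q (k , k≢0 , g) e eq = W-θ̄·good {k} {θ^ (suc q ℕ.* 4)} k≢0 g
        (trans (sym (W-η (mulK D (θ̄ a) (θ^ (suc q ℕ.* 4)))))
          (trans (cong W (trans (cong (λ x → mulK D (η a) (mulK D (θ̄ a) x)) (trans (cong θ^_ e) (θ^suc (suc (suc (suc (q ℕ.* 4)))))))
            (η·θ̄·θ a (θ^ (suc (suc (suc (q ℕ.* 4)))))))) eq))

      go : (∃ λ q → n ≡ q ℕ.* 4 ⊎ n ≡ suc (q ℕ.* 4) ⊎ n ≡ suc (suc (q ℕ.* 4)) ⊎ n ≡ suc (suc (suc (q ℕ.* 4)))) →
        2 ℕ.≤ n → NonZeroW n
      go (zero , inj₁ n≡) 2≤n = ⊥-elim (ℕ.n≮0 (subst (2 ℕ.≤_) n≡ 2≤n))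
      go (suc q , inj₁ n≡) _ = subst NonZeroW (sym n≡) (case0 q (good-power q))
      go (zero , inj₂ (inj₁ n≡)) 2≤n = ⊥-elim (ℕ.<-irrefl (sym n≡) 2≤n)
      go (suc q , inj₂ (inj₁ n≡)) _ = subst NonZeroW (sym n≡) (case1 q (good-power q))
      go (zero , inj₂ (inj₂ (inj₁ n≡))) _ = subst NonZeroW (sym n≡) case2′
      go (suc q , inj₂ (inj₂ (inj₁ n≡))) _ = subst NonZeroW (sym n≡) (case2 q (good-power q))
      go (q , inj₂ (inj₂ (inj₂ n≡))) _ = subst NonZeroW (sym n≡) (case3 q (good-power q) refl)

-- The equation X⁴ − (a⁴ − 1) Y⁴ = 1

mutual
  T U : ℤ → ℕ → ℤ
  T a zero = 1ℤ
  T a (suc l) = a * a * T a l + disc a * U a l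
  U a zero = 0ℤ
  U a (suc l) = T a l + a * a * U a l

-- This is r + 2i. Accumulating in r lets the induction over the factors η proceed without
-- rewriting: each η lowers the index of `T` and `U` by two.
add-twice : ℕ → ℕ → ℕ
add-twice zero r = r
add-twice (suc i) r = add-twice i (suc (suc r))

add-twice-suc : ∀ i r → suc (add-twice i r) ≡ add-twice i (suc r)
add-twice-suc zero r = refl
add-twice-suc (suc i) r = add-twice-suc i (suc (suc r))

parity : ∀ l → ∃ λ i → l ≡ add-twice i 0 ⊎ l ≡ add-twice i 1
parity zero = 0 , inj₁ refl
parity (suc l) with parity l
... | i , inj₁ eq = i , inj₂ (trans (cong suc eq) (add-twice-suc i 0))
... | i , inj₂ eq = suc i , inj₁ (trans (cong suc eq) (add-twice-suc i 1))

W-conj : ∀ x → W (conj x) ≡ - W x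
W-conj ⟨ e0 , e1 , e2 , e3 ⟩ = identity e0 e1 e2 e3
  where
  identity : ∀ e0 e1 e2 e3 → e0 * (- e3) - (- e1) * e2 ≡ - (e0 * e3 - e1 * e2)
  identity = ring 4 (λ e0 e1 e2 e3 → e0 :* (:- e3) :- (:- e1) :* e2 := :- (e0 :* e3 :- e1 :* e2)) refl

record Nonneg (x : ZK) : Set where
  constructor nonneg
  field
    0≤c0 : 0ℤ ≤ c0 x
    0≤c1 : 0ℤ ≤ c1 x
    0≤c2 : 0ℤ ≤ c2 x
    0≤c3 : 0ℤ ≤ c3 x

mul-nonneg : ∀ {m} → 0ℤ ≤ m → ∀ x y → Nonneg x → Nonneg y → Nonneg (mulK m x y)
mul-nonneg m ⟨ _ , _ , _ , _ ⟩ ⟨ _ , _ , _ , _ ⟩ (nonneg a0 a1 a2 a3) (nonneg b0 b1 b2 b3) = nonneg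
  (0≤+ (0≤* a0 b0) (0≤* m (0≤+ (0≤+ (0≤* a1 b3) (0≤* a2 b2)) (0≤* a3 b1))))
  (0≤+ (0≤+ (0≤* a0 b1) (0≤* a1 b0)) (0≤* m (0≤+ (0≤* a2 b3) (0≤* a3 b2))))
  (0≤+ (0≤+ (0≤+ (0≤* a0 b2) (0≤* a1 b1)) (0≤* a2 b0)) (0≤* m (0≤* a3 b3)))
  (0≤+ (0≤+ (0≤+ (0≤* a0 b3) (0≤* a1 b2)) (0≤* a2 b1)) (0≤* a3 b0))

module KappaPowers (a : ℤ) where
  open Units a

  κ^ θ^ : ℕ → ZK
  κ^ j = powK D (κ a) j
  θ^ n = powK D (θ a) n

  pull-η : ∀ x k → mulK D x (mulK D (κ a) k) ≡ mulK D (η a) (mulK D (mulK D x (mulK D (θ a) (θ a))) k)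
  pull-η x k = begin
    mulK D x (mulK D (mulK D t (mulK D t n)) k)   ≡⟨ cong (λ y → mulK D x (mulK D y k)) (sym (mulK-assoc D t t n)) ⟩
    mulK D x (mulK D (mulK D (mulK D t t) n) k)   ≡⟨ sym (mulK-assoc D x (mulK D (mulK D t t) n) k) ⟩
    mulK D (mulK D x (mulK D (mulK D t t) n)) k   ≡⟨ cong (λ y → mulK D y k) (sym (mulK-assoc D x (mulK D t t) n)) ⟩
    mulK D (mulK D (mulK D x (mulK D t t)) n) k   ≡⟨ cong (λ y → mulK D y k) (mulK-comm D (mulK D x (mulK D t t)) n) ⟩
    mulK D (mulK D n (mulK D x (mulK D t t))) k   ≡⟨ mulK-assoc D n (mulK D x (mulK D t t)) k ⟩
    mulK D n (mulK D (mulK D x (mulK D t t)) k)   ∎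
    where
    open ≡-Reasoning
    t = θ a
    n = η a

  push-θ : ∀ x k → mulK D (mulK D x (mulK D (θ a) (θ a))) k ≡ mulK D x (mulK D (θ a) (mulK D (θ a) k))
  push-θ x k = trans (mulK-assoc D x (mulK D (θ a) (θ a)) k) (cong (mulK D x) (mulK-assoc D (θ a) (θ a) k))

  double : ℕ → ℕ
  double zero = 0
  double (suc j) = suc (suc (double j))

  -- The factor x is kept arbitrary so that each κ = θ²η can hand its θ² over to x, while its η
  -- disappears from W.
  W-κ^ : ∀ x j → W (mulK D x (κ^ j)) ≡ W (mulK D x (θ^ (double j)))
  W-κ^ x zero = refl
  W-κ^ x (suc j) = begin
    W (mulK D x (mulK D (κ a) (κ^ j)))            ≡⟨ cong W (pull-η x (κ^ j)) ⟩
    W (mulK D (η a) (mulK D x′ (κ^ j)))           ≡⟨ W-η a (mulK D x′ (κ^ j)) ⟩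
    W (mulK D x′ (κ^ j))                          ≡⟨ W-κ^ x′ j ⟩
    W (mulK D x′ (θ^ (double j)))                 ≡⟨ cong W (push-θ x (θ^ (double j))) ⟩
    W (mulK D x (mulK D (θ a) (mulK D (θ a) (θ^ (double j))))) ∎
    where
    open ≡-Reasoning
    x′ = mulK D x (mulK D (θ a) (θ a))

  module _ (a≢0 : a ≢ 0ℤ) where

    W-κ^≢0 : ∀ j → W (κ^ (suc j)) ≢ 0ℤ
    W-κ^≢0 j eq = W-θ^ a a≢0 (double (suc j)) (ℕ.s≤s (ℕ.s≤s ℕ.z≤n))
      (trans (cong W (sym (mulK-identityˡ D (θ^ (double (suc j))))))
        (trans (sym (W-κ^ 1K (suc j))) (trans (cong W (mulK-identityˡ D (κ^ (suc j)))) eq)))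

    W-θη·κ^≢0 : ∀ j → W (mulK D (mulK D (θ a) (η a)) (κ^ (suc j))) ≢ 0ℤ
    W-θη·κ^≢0 j eq = W-θ^ a a≢0 (suc (double (suc j))) (ℕ.s≤s (ℕ.s≤s ℕ.z≤n))
      (trans (sym (W-κ^ (θ a) (suc j)))
        (trans (sym (W-η a (mulK D (θ a) (κ^ (suc j))))) (trans (cong W move) eq)))
      where
      move : mulK D (η a) (mulK D (θ a) (κ^ (suc j))) ≡ mulK D (mulK D (θ a) (η a)) (κ^ (suc j))
      move = trans (sym (mulK-assoc D (η a) (θ a) (κ^ (suc j)))) (cong (λ y → mulK D y (κ^ (suc j))) (mulK-comm D (η a) (θ a)))

η·-coords : ∀ a D g0 g1 g2 g3 → mulK D (η a) ⟨ g0 , g1 , g2 , g3 ⟩ ≡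
  ⟨ a * a * g0 + D * g2 , a * a * g1 + D * g3 , a * a * g2 + g0 , a * a * g3 + g1 ⟩
η·-coords a D g0 g1 g2 g3 = ringK (a ∷ D ∷ g0 ∷ g1 ∷ g2 ∷ g3 ∷ []) (mulP D′ (ηP α) ⟪ x0 , x1 , x2 , x3 ⟫)
  ⟪ α :* α :* x0 :+ D′ :* x2 , α :* α :* x1 :+ D′ :* x3 , α :* α :* x2 :+ x0 , α :* α :* x3 :+ x1 ⟫ refl refl refl refl
  where
  α = var (# 0)
  D′ = var (# 1)
  x0 = var (# 2)
  x1 = var (# 3)
  x2 = var (# 4)
  x3 = var (# 5)

module QuarticEquation (a : ℤ) (2≤a : 0ℤ ≤ a - + 2) where
  open Bounds a 2≤a
  open Units a
  open KappaPowers a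

  a≢0 : a ≢ 0ℤ
  a≢0 a≡0 = ¬2≤0 a≡0 2≤a
    where
    ¬2≤0 : ∀ {i} → i ≡ 0ℤ → 0ℤ ≤ i - + 2 → ⊥
    ¬2≤0 refl ()

  η·^ : ℕ → ZK → ZK
  η·^ zero x = x
  η·^ (suc i) x = mulK D (η a) (η·^ i x)

  W-η·^ : ∀ i x → W (η·^ i x) ≡ W x
  W-η·^ zero x = refl
  W-η·^ (suc i) x = trans (W-η a (η·^ i x)) (W-η·^ i x)

  -- The bound on c1 excludes 1 and elements whose conjugate has nonnegative coefficients. The bound
  -- on c0 makes c2 positive after one multiplication by η.
  record Pos (x : ZK) : Set where
    constructor pos
    field
      1≤x0 : 0ℤ ≤ c0 x - 1ℤ
      1≤x1 : 0ℤ ≤ c1 x - 1ℤ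
      0≤x2 : 0ℤ ≤ c2 x
      0≤x3 : 0ℤ ≤ c3 x

  η·-pos : ∀ x → Pos x → Pos (mulK D (η a) x) × 0ℤ ≤ c2 (mulK D (η a) x) - 1ℤ
  η·-pos ⟨ e0 , e1 , e2 , e3 ⟩ (pos p0 p1 p2 p3) =
    subst (λ y → Pos y × 0ℤ ≤ c2 y - 1ℤ) (sym (η·-coords a D e0 e1 e2 e3))
      ( pos (grow (a * a) D e0 e2 1≤a² p0 0≤D p2) (grow (a * a) D e1 e3 1≤a² p1 0≤D p3) (0≤+ (0≤* (0≤i*i a) p2) (weaken p0)) (0≤+ (0≤* (0≤i*i a) p3) (weaken p1))
      , subst (0ℤ ≤_) (ring 3 (λ A x y → A :* x :+ (y :- :1) := A :* x :+ y :- :1) refl (a * a) e2 e0) (0≤+ (0≤* (0≤i*i a) p2) p0))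
    where
    grow : ∀ A D x y → 0ℤ ≤ A - 1ℤ → 0ℤ ≤ x - 1ℤ → 0ℤ ≤ D → 0ℤ ≤ y → 0ℤ ≤ A * x + D * y - 1ℤ
    grow A D x y hA hx hD hy = subst (0ℤ ≤_) (ring 4 (λ A D x y → (A :- :1) :* x :+ (x :- :1) :+ D :* y := A :* x :+ D :* y :- :1) refl A D x y)
      (0≤+ (0≤+ (0≤* hA (weaken hx)) hx) (0≤* hD hy))

  η·^-pos : ∀ i {x} → Pos x → Pos (η·^ i x)
  η·^-pos zero p = p
  η·^-pos (suc i) p = proj₁ (η·-pos _ (η·^-pos i p))

  η-norm : HasNorm (a * a * (a * a) + disc a) (+ 2 * (a * a)) (η a)
  η-norm = norm (ring 1 (λ a → N₀P (δ a) (ηP a) := a :* a :* (a :* a) :+ δ a) refl a)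
                (ring 1 (λ a → N₂P (δ a) (ηP a) := :2 :* (a :* a)) refl a)

  -- The relative norm of η is η², which undoes two steps of the recursion defining `T` and `U`.
  η·-norm : ∀ {t u x} → let t′ = a * a * t + D * u; u′ = t + a * a * u in
    HasNorm (a * a * t′ + D * u′) (- (t′ + a * a * u′)) x → HasNorm t (- u) (mulK D (η a) x)
  η·-norm {t} {u} h = renorm (identity₀ a t u) (identity₂ a t u) (mul-norm η-norm h)
    where
    identity₀ : ∀ a t u → let D = disc a; t′ = a * a * t + D * u; u′ = t + a * a * u in
      (a * a * (a * a) + D) * (a * a * t′ + D * u′) + D * (+ 2 * (a * a) * - (t′ + a * a * u′)) ≡ t
    identity₀ = ring 3 (λ a t u → let D = δ a; t′ = a :* a :* t :+ D :* u; u′ = t :+ a :* a :* u in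
      (a :* a :* (a :* a) :+ D) :* (a :* a :* t′ :+ D :* u′) :+ D :* (:2 :* (a :* a) :* :- (t′ :+ a :* a :* u′)) := t) refl
    identity₂ : ∀ a t u → let D = disc a; t′ = a * a * t + D * u; u′ = t + a * a * u in
      (a * a * (a * a) + D) * - (t′ + a * a * u′) + + 2 * (a * a) * (a * a * t′ + D * u′) ≡ - u
    identity₂ = ring 3 (λ a t u → let D = δ a; t′ = a :* a :* t :+ D :* u; u′ = t :+ a :* a :* u in
      (a :* a :* (a :* a) :+ D) :* :- (t′ :+ a :* a :* u′) :+ :2 :* (a :* a) :* (a :* a :* t′ :+ D :* u′) := :- u) refl

  η·^-norm : ∀ i r {x} → HasNorm (T a (add-twice i r)) (- U a (add-twice i r)) x → HasNorm (T a r) (- U a r) (η·^ i x)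
  η·^-norm zero r h = h
  η·^-norm (suc i) r h = η·-norm {T a r} {U a r} (η·^-norm i (suc (suc r)) h)

  norm-one⇒power : ∀ {x} → HasNorm 1ℤ 0ℤ x → 0ℤ ≤ c0 x → 0ℤ ≤ c2 x → Power± x
  norm-one⇒power {⟨ e0 , e1 , e2 , e3 ⟩} h p0 p2 = norm-one-power 2≤a ∣ e2 ∣ e0 e1 e2 e3 h p0 p2
    (subst (λ i → 0ℤ ≤ i - e2) (sym (ℤ.0≤i⇒+∣i∣≡i p2)) (subst (0ℤ ≤_) (sym (ℤ.+-inverseʳ e2)) 0≤n))

  binomial : ℤ → ℤ → ZK
  binomial x y = ⟨ x , y , 0ℤ , 0ℤ ⟩

  binomial-norm : ∀ {x y t u} → x * x ≡ t → y * y ≡ u → HasNorm t (- u) (binomial x y)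
  binomial-norm {x} {y} refl refl = norm
    (ring 3 (λ D x y → N₀P D ⟪ x , y , :0 , :0 ⟫ := x :* x) refl D x y)
    (ring 3 (λ D x y → N₂P D ⟪ x , y , :0 , :0 ⟫ := :- (y :* y)) refl D x y)

  W-binomial : ∀ x y → W (binomial x y) ≡ 0ℤ
  W-binomial = ring 2 (λ x y → WP ⟪ x , y , :0 , :0 ⟫ := :0) refl

  -- Such an e is κ^j for an integer j. For j ≠ 0 this contradicts W e = 0, and for j = 0 the
  -- positive β coefficient.
  even-impossible : ∀ {e} → HasNorm 1ℤ 0ℤ e → Pos e → W e ≡ 0ℤ → ⊥
  even-impossible {e} h (pos p0 p1 p2 p3) w = go (norm-one⇒power h (weaken p0) p2)
    where
    trivial : 1K ≡ e → ⊥
    trivial refl = ¬0≤-1 p1 refl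

    go : Power± e → ⊥
    go (plus zero eq) = trivial (sym eq)
    go (minus zero eq) = trivial (sym eq)
    go (plus (suc j) eq) = W-κ^≢0 a≢0 j (trans (cong W (sym eq)) w)
    go (minus (suc j) eq) = W-κ^≢0 a≢0 j
      (trans (cong W (sym (conj-involutive (κ^ (suc j))))) (trans (cong (λ x → W (conj x)) (sym eq)) (trans (W-conj e) (cong -_ w))))

  θη-nonneg : Nonneg (mulK D (θ a) (η a))
  θη-nonneg = mul-nonneg 0≤D (θ a) (η a) (nonneg 0≤a 0≤n 0≤n 0≤n) (nonneg (0≤i*i a) 0≤n 0≤n 0≤n)

  κ^-nonneg : ∀ j → Nonneg (κ^ j)
  κ^-nonneg zero = nonneg 0≤n 0≤n 0≤n 0≤n
  κ^-nonneg (suc j) = mul-nonneg 0≤D (κ a) (κ^ j)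
    (mul-nonneg 0≤D (θ a) (mulK D (θ a) (η a)) (nonneg 0≤a 0≤n 0≤n 0≤n) θη-nonneg) (κ^-nonneg j)

  θ̄·-nonneg : ∀ g → HasNorm (a * a) 1ℤ g → Pos g → 0ℤ ≤ c0 (mulK D (θ̄ a) g) × 0ℤ ≤ c2 (mulK D (θ̄ a) g)
  θ̄·-nonneg ⟨ g0 , g1 , g2 , g3 ⟩ (norm n₀ n₂) (pos p0 p1 p2 p3) =
    subst (λ x → 0ℤ ≤ c0 x × 0ℤ ≤ c2 x) (sym (θ̄·-coords a D g0 g1 g2 g3))
      (descend-nonneg g0 g1 g2 g3 (weaken p0) p2 n₀ n₂)

  -- The element θ̄g has relative norm 1, so g = θηκ^j for an integer j. For j > 0, W g = W
  -- (θ^(2j+1)) is not 0. For j < 0, θ̄κ = θ gives conj g = θηκ^(-j-1); its coefficients are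
  -- nonnegative, against the positive β coefficient of g.
  odd-unique : ∀ {g} → HasNorm (a * a) 1ℤ g → Pos g → W g ≡ 0ℤ → g ≡ mulK D (θ a) (η a)
  odd-unique {g} h p w = go (norm-one⇒power (θ̄·-norm h) (proj₁ q) (proj₂ q))
    where
    q = θ̄·-nonneg g h p
    θη = mulK D (θ a) (η a)

    recover : ∀ {x} → mulK D (θ̄ a) g ≡ x → g ≡ mulK D θη x
    recover eq = trans (sym (θη·θ̄ g)) (cong (mulK D θη) eq)

    at-one : g ≡ mulK D θη 1K → g ≡ θη
    at-one eq = trans eq (trans (mulK-comm D θη 1K) (mulK-identityˡ D θη))

    conj-recover : ∀ j → mulK D (θ̄ a) g ≡ conj (κ^ (suc j)) → conj g ≡ mulK D θη (κ^ j)
    conj-recover j eq = begin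
      conj g                                          ≡⟨ cong conj (recover eq) ⟩
      conj (mulK D θη (conj (κ^ (suc j))))            ≡⟨ conj-mul D θη (conj (κ^ (suc j))) ⟩
      mulK D (conj θη) (conj (conj (κ^ (suc j))))     ≡⟨ cong₂ (mulK D) (conj-mul D (θ a) (η a)) (conj-involutive (κ^ (suc j))) ⟩
      mulK D θ̄η (mulK D (κ a) (κ^ j))                 ≡⟨ cong (mulK D θ̄η) (mulK-assoc D (θ a) θη (κ^ j)) ⟩
      mulK D θ̄η (mulK D (θ a) (mulK D θη (κ^ j)))     ≡⟨ sym (mulK-assoc D θ̄η (θ a) (mulK D θη (κ^ j))) ⟩
      mulK D (mulK D θ̄η (θ a)) (mulK D θη (κ^ j))     ≡⟨ cong (λ y → mulK D y (mulK D θη (κ^ j))) (mulK-comm D θ̄η (θ a)) ⟩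
      mulK D (mulK D (θ a) θ̄η) (mulK D θη (κ^ j))     ≡⟨ mulK-assoc D (θ a) θ̄η (mulK D θη (κ^ j)) ⟩
      mulK D (θ a) (mulK D θ̄η (mulK D θη (κ^ j)))     ≡⟨ θ·θ̄η (mulK D θη (κ^ j)) ⟩
      mulK D θη (κ^ j)                                ∎
      where
      open ≡-Reasoning
      θ̄η = mulK D (θ̄ a) (η a)

    negative : ∀ {y} → conj g ≡ y → Nonneg y → ⊥
    negative refl nn = ¬0≤-1 (0≤+ (Pos.1≤x1 p) (Nonneg.0≤c1 nn)) (ring 1 (λ i → i :- :1 :+ :- i := con -1ℤ) refl (c1 g))

    go : Power± (mulK D (θ̄ a) g) → g ≡ θη
    go (plus zero eq) = at-one (recover eq)
    go (minus zero eq) = at-one (recover eq)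
    go (plus (suc j) eq) = ⊥-elim (W-θη·κ^≢0 a≢0 j (trans (cong W (sym (recover eq))) w))
    go (minus (suc j) eq) = ⊥-elim (negative (conj-recover j eq) (mul-nonneg 0≤D θη (κ^ j) θη-nonneg (κ^-nonneg j)))

  η-cancel : ∀ {x} → mulK D (η a) x ≡ mulK D (θ a) (η a) → x ≡ θ a
  η-cancel {x} eq = trans (sym (cancel x)) (trans (cong (λ y → mulK D (θ a) (mulK D (θ̄ a) y)) (trans eq (mulK-comm D (θ a) (η a)))) (cancel (θ a)))
    where
    cancel : ∀ x → mulK D (θ a) (mulK D (θ̄ a) (mulK D (η a) x)) ≡ x
    cancel x = trans (cong (mulK D (θ a)) (sym (mulK-assoc D (θ̄ a) (η a) x))) (θ·θ̄η x)

  quartic-unique : ∀ {x y} l → 0ℤ ≤ x - 1ℤ → 0ℤ ≤ y - 1ℤ → x * x ≡ T a l → y * y ≡ U a l → x ≡ a × y ≡ 1ℤ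
  quartic-unique {x} {y} l 1≤x 1≤y x² y² = go (parity l)
    where
    B = binomial x y

    B-norm : ∀ {l′} → l ≡ l′ → HasNorm (T a l′) (- U a l′) B
    B-norm refl = binomial-norm x² y²

    B-pos : Pos B
    B-pos = pos 1≤x 1≤y 0≤n 0≤n

    W-B : ∀ i → W (η·^ i B) ≡ 0ℤ
    W-B i = trans (W-η·^ i B) (W-binomial x y)

    -- One more factor η turns the norm 1/η into η, the norm for which `descend-nonneg` supplies the
    -- signs.
    odd-norm : ∀ {z} → HasNorm (T a 1) (- U a 1) z → HasNorm (a * a) 1ℤ (mulK D (η a) z)
    odd-norm h = renorm (identity₀ a) (identity₂ a) (mul-norm η-norm h)
      where
      identity₀ : ∀ a → (a * a * (a * a) + disc a) * (a * a * 1ℤ + disc a * 0ℤ) + disc a * (+ 2 * (a * a) * - (1ℤ + a * a * 0ℤ)) ≡ a * a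
      identity₀ = ring 1 (λ a → (a :* a :* (a :* a) :+ δ a) :* (a :* a :* :1 :+ δ a :* :0) :+ δ a :* (:2 :* (a :* a) :* :- (:1 :+ a :* a :* :0)) := a :* a) refl
      identity₂ : ∀ a → (a * a * (a * a) + disc a) * - (1ℤ + a * a * 0ℤ) + + 2 * (a * a) * (a * a * 1ℤ + disc a * 0ℤ) ≡ 1ℤ
      identity₂ = ring 1 (λ a → (a :* a :* (a :* a) :+ δ a) :* :- (:1 :+ a :* a :* :0) :+ :2 :* (a :* a) :* (a :* a :* :1 :+ δ a :* :0) := :1) refl

    conclude : ∀ i → η·^ i B ≡ θ a → x ≡ a × y ≡ 1ℤ
    conclude zero eq = cong c0 eq , cong c1 eq
    -- θ has no √D coefficient, whereas a factor η would create a positive one.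
    conclude (suc i) eq = ⊥-elim (¬0≤-1 (subst (λ z → 0ℤ ≤ c2 z - 1ℤ) eq (proj₂ (η·-pos (η·^ i B) (η·^-pos i B-pos)))) refl)

    go : (∃ λ i → l ≡ add-twice i 0 ⊎ l ≡ add-twice i 1) → x ≡ a × y ≡ 1ℤ
    go (i , inj₁ eq) = ⊥-elim (even-impossible {η·^ i B} (η·^-norm i 0 (B-norm eq)) (η·^-pos i B-pos) (W-B i))
    go (i , inj₂ eq) = conclude i (η-cancel (odd-unique {mulK D (η a) (η·^ i B)} (odd-norm (η·^-norm i 1 (B-norm eq)))
      (proj₁ (η·-pos (η·^ i B) (η·^-pos i B-pos))) (trans (W-η a (η·^ i B)) (W-B i))))

-- The Pell equation u² − m v² = 1

sq-≤ : ∀ p q → 0ℤ ≤ q → 0ℤ ≤ q * q - p * p → 0ℤ ≤ q - p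
sq-≤ p q 0≤q h with sign? (q - p)
... | inj₁ r = r
... | inj₂ r = ⊥-elim (¬0≤-1 (0≤+ (0≤+ h (0≤* r (0≤+ (0≤+ (0≤* (0≤n {2}) 0≤q) r) (0≤n {2})))) (0≤* (0≤n {2}) 0≤q))
  (ring 2 (λ p q → let d = :- (q :- p) :- :1 in q :* q :- p :* p :+ d :* (:2 :* q :+ d :+ :2) :+ :2 :* q := con -1ℤ) refl p q))

sq-< : ∀ p q → 0ℤ ≤ p → 0ℤ ≤ p * p - q * q - 1ℤ → 0ℤ ≤ p - q - 1ℤ
sq-< p q 0≤p h with sign? (p - q - 1ℤ)
... | inj₁ r = r
... | inj₂ r = ⊥-elim (¬0≤-1 (0≤+ h (0≤* r (0≤+ r (0≤* (0≤n {2}) 0≤p))))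
  (ring 2 (λ p q → let d = :- (p :- q :- :1) :- :1 in p :* p :- q :* q :- :1 :+ d :* (d :+ :2 :* p) := con -1ℤ) refl p q))

module Pell (a S m : ℤ) (2≤a : 0ℤ ≤ a - + 2) (1≤S : 0ℤ ≤ S - 1ℤ)
  (S²m : S * S * m ≡ disc a) (S²≤a+1 : 0ℤ ≤ a + 1ℤ - S * S) where
  open Bounds a 2≤a

  0≤S : 0ℤ ≤ S
  0≤S = weaken 1≤S

  S²m′ : S * S * m ≡ a * a * (a * a) - 1ℤ
  S²m′ = S²m

  -- If v < S, then (S u)² − (a² v)² = S² − v² ≤ a, although S u + a² v > a².
  S≤v : ∀ u v → 0ℤ ≤ u → 0ℤ ≤ v - 1ℤ → u * u - m * (v * v) ≡ 1ℤ → 0ℤ ≤ v - S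
  S≤v u v 0≤u 1≤v N with sign? (v - S)
  ... | inj₁ r = r
  ... | inj₂ r = ⊥-elim (¬0≤-1
    (0≤+ (0≤+ (0≤+ (0≤+ S²≤a+1 1≤v²) (0≤* (0≤n {2}) (0≤* (0≤i*i a) 1≤v))) (0≤* d (0≤+ (0≤+ (0≤* (0≤n {2}) (0≤* (0≤i*i a) (weaken 1≤v))) d) (0≤n {2})))) a≤2a²)
    (modulo (S * S) (modulo (v * v) (final a S m u v) S²m′) N))
    where
    difference : ∀ a S m u v → S * u * (S * u) - a * a * v * (a * a * v) - 1ℤ ≡
      (S - v - 1ℤ) * (S - v - 1ℤ + + 2 * v) + (S - v - 1ℤ) + (S - v - 1ℤ) + + 2 * v + + 0
        + S * S * (u * u - m * (v * v) - 1ℤ) + v * v * (S * S * m - (a * a * (a * a) - 1ℤ))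
    difference = ring 5 (λ a S m u v → S :* u :* (S :* u) :- a :* a :* v :* (a :* a :* v) :- :1 :=
      (S :- v :- :1) :* (S :- v :- :1 :+ :2 :* v) :+ (S :- v :- :1) :+ (S :- v :- :1) :+ :2 :* v :+ :0
        :+ S :* S :* (u :* u :- m :* (v :* v) :- :1) :+ v :* v :* (S :* S :* m :- (a :* a :* (a :* a) :- :1))) refl

    v<S : 0ℤ ≤ S - v - 1ℤ
    v<S = subst (0ℤ ≤_) (ring 2 (λ S v → :- (v :- S) :- :1 := S :- v :- :1) refl S v) r

    1≤v² : 0ℤ ≤ v * v - 1ℤ
    1≤v² = subst (0ℤ ≤_) (ring 1 (λ v → (v :- :1) :* (v :- :1) :+ :2 :* (v :- :1) := v :* v :- :1) refl v) (0≤+ (0≤* 1≤v 1≤v) (0≤* (0≤n {2}) 1≤v))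

    a≤2a² : 0ℤ ≤ + 2 * (a * a) - a
    a≤2a² = subst (0ℤ ≤_) (ring 1 (λ a → a :* (:2 :* (a :- :2) :+ con (+ 3)) := :2 :* (a :* a) :- a) refl a) (0≤* 0≤a (0≤+ (0≤* (0≤n {2}) 2≤a) (0≤n {3})))

    d : 0ℤ ≤ S * u - a * a * v - 1ℤ
    d = sq-< (S * u) (a * a * v) (0≤* 0≤S 0≤u)
      (subst (0ℤ ≤_) (sym (modulo (S * S) (modulo (v * v) (difference a S m u v) S²m′) N))
        (0≤+ (0≤+ (0≤+ (0≤+ (0≤* v<S (0≤+ v<S (0≤* (0≤n {2}) (weaken 1≤v)))) v<S) v<S) (0≤* (0≤n {2}) (weaken 1≤v))) (0≤n {0})))

    final : ∀ a S m u v → let q = a * a * v; d = S * u - q - 1ℤ in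
      a + 1ℤ - S * S + (v * v - 1ℤ) + + 2 * (a * a * (v - 1ℤ)) + d * (+ 2 * (a * a * v) + d + + 2) + (+ 2 * (a * a) - a) ≡
      -1ℤ + S * S * (u * u - m * (v * v) - 1ℤ) + v * v * (S * S * m - (a * a * (a * a) - 1ℤ))
    final = ring 5 (λ a S m u v → let q = a :* a :* v; d = S :* u :- q :- :1 in
      a :+ :1 :- S :* S :+ (v :* v :- :1) :+ :2 :* (a :* a :* (v :- :1)) :+ d :* (:2 :* (a :* a :* v) :+ d :+ :2) :+ (:2 :* (a :* a) :- a) :=
      con -1ℤ :+ S :* S :* (u :* u :- m :* (v :* v) :- :1) :+ v :* v :* (S :* S :* m :- (a :* a :* (a :* a) :- :1))) refl

  record Solution (u v : ℤ) : Set where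
    field
      l : ℕ
      u≡ : u ≡ T a l
      v≡ : v ≡ S * U a l

  -- Descent on v: u* + v*√m is u + v√m divided by a² + S√m, and this divisor is η because S√m = √D.
  pell : ∀ n u v → 0ℤ ≤ u - 1ℤ → 0ℤ ≤ v → 0ℤ ≤ + n - v → u * u - m * (v * v) ≡ 1ℤ → Solution u v
  pell n u v 1≤u 0≤v v≤n N = go n v≤n (sign? (v - 1ℤ))
    where
    u* v* : ℤ
    u* = a * a * u - m * S * v
    v* = a * a * v - S * u

    N* : u* * u* - m * (v* * v*) ≡ 1ℤ
    N* = modulo 1ℤ (modulo (m * (v * v) - u * u) (identity a S m u v) S²m′) N
      where
      identity : ∀ a S m u v → let u* = a * a * u - m * S * v; v* = a * a * v - S * u in
        u* * u* - m * (v* * v*) ≡ 1ℤ + 1ℤ * (u * u - m * (v * v) - 1ℤ) + (m * (v * v) - u * u) * (S * S * m - (a * a * (a * a) - 1ℤ))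
      identity = ring 5 (λ a S m u v → let u* = a :* a :* u :- m :* S :* v; v* = a :* a :* v :- S :* u in
        u* :* u* :- m :* (v* :* v*) := :1 :+ :1 :* (u :* u :- m :* (v :* v) :- :1) :+ (m :* (v :* v) :- u :* u) :* (S :* S :* m :- (a :* a :* (a :* a) :- :1))) refl

    1≤u* : 0ℤ ≤ u* - 1ℤ
    1≤u* = sq-< (a * a * u) (m * S * v) (0≤* (0≤i*i a) (weaken {u} 1≤u))
      (subst (0ℤ ≤_) (sym (modulo (S * S * m) (modulo (1ℤ - u * u) (identity a S m u v) S²m′) N))
        (0≤+ (0≤i*i u) (0≤+ a²<D (0≤i*i a))))
      where
      identity : ∀ a S m u v → a * a * u * (a * a * u) - m * S * v * (m * S * v) - 1ℤ ≡
        u * u + (a * a * (a * a) - 1ℤ - a * a - 1ℤ + a * a) + S * S * m * (u * u - m * (v * v) - 1ℤ)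
          + (1ℤ - u * u) * (S * S * m - (a * a * (a * a) - 1ℤ))
      identity = ring 5 (λ a S m u v → a :* a :* u :* (a :* a :* u) :- m :* S :* v :* (m :* S :* v) :- :1 :=
        u :* u :+ (a :* a :* (a :* a) :- :1 :- a :* a :- :1 :+ a :* a) :+ S :* S :* m :* (u :* u :- m :* (v :* v) :- :1)
          :+ (:1 :- u :* u) :* (S :* S :* m :- (a :* a :* (a :* a) :- :1))) refl

    -- The squares of a²v and Su differ by v² - S², so v* has the sign of v - S.
    0≤v* : 0ℤ ≤ v - 1ℤ → 0ℤ ≤ v*
    0≤v* 1≤v = sq-≤ (S * u) (a * a * v) (0≤* (0≤i*i a) 0≤v)
      (subst (0ℤ ≤_) (sym (modulo (- (S * S)) (modulo (- (v * v)) (identity a S m u v) S²m′) N))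
        (0≤* (S≤v u v (weaken {u} 1≤u) 1≤v N) (0≤+ 0≤v 0≤S)))
      where
      identity : ∀ a S m u v → a * a * v * (a * a * v) - S * u * (S * u) ≡
        (v - S) * (v + S) + - (S * S) * (u * u - m * (v * v) - 1ℤ) + - (v * v) * (S * S * m - (a * a * (a * a) - 1ℤ))
      identity = ring 5 (λ a S m u v → a :* a :* v :* (a :* a :* v) :- S :* u :* (S :* u) :=
        (v :- S) :* (v :+ S) :+ :- (S :* S) :* (u :* u :- m :* (v :* v) :- :1) :+ :- (v :* v) :* (S :* S :* m :- (a :* a :* (a :* a) :- :1))) refl

    -- v* < v means (a² - 1)v < Su; here the squares differ by S² + 2(a² - 1)v².
    v*<v : 0ℤ ≤ S * u - (a * a - 1ℤ) * v - 1ℤ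
    v*<v = sq-< (S * u) ((a * a - 1ℤ) * v) (0≤* 0≤S (weaken {u} 1≤u))
      (subst (0ℤ ≤_) (sym (modulo (S * S) (modulo (v * v) (identity a S m u v) S²m′) N))
        (0≤+ (0≤+ (0≤* 1≤S 1≤S) (0≤* (0≤n {2}) 1≤S)) (0≤* (0≤* (0≤n {2}) 1≤a²) (0≤i*i v))))
      where
      identity : ∀ a S m u v → S * u * (S * u) - (a * a - 1ℤ) * v * ((a * a - 1ℤ) * v) - 1ℤ ≡
        (S - 1ℤ) * (S - 1ℤ) + + 2 * (S - 1ℤ) + + 2 * (a * a - 1ℤ) * (v * v)
          + S * S * (u * u - m * (v * v) - 1ℤ) + v * v * (S * S * m - (a * a * (a * a) - 1ℤ))
      identity = ring 5 (λ a S m u v → S :* u :* (S :* u) :- (a :* a :- :1) :* v :* ((a :* a :- :1) :* v) :- :1 :=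
        (S :- :1) :* (S :- :1) :+ :2 :* (S :- :1) :+ :2 :* (a :* a :- :1) :* (v :* v)
          :+ S :* S :* (u :* u :- m :* (v :* v) :- :1) :+ v :* v :* (S :* S :* m :- (a :* a :* (a :* a) :- :1))) refl

    lift : Solution u* v* → Solution u v
    lift sol = record
      { l = suc l
      ; u≡ = trans (modulo u (u-identity a S m u v) S²m′) (trans (cong₂ (λ x y → a * a * x + m * S * y) u≡ v≡)
               (modulo (U a l) (u-identity′ a S m (T a l) (U a l)) S²m′))
      ; v≡ = trans (modulo v (v-identity a S m u v) S²m′) (trans (cong₂ (λ x y → S * x + a * a * y) u≡ v≡) (v-identity′ a S (T a l) (U a l)))
      }
      where
      open Solution sol
      u-identity : ∀ a S m u v → let u* = a * a * u - m * S * v; v* = a * a * v - S * u in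
        u ≡ a * a * u* + m * S * v* + u * (S * S * m - (a * a * (a * a) - 1ℤ))
      u-identity = ring 5 (λ a S m u v → let u* = a :* a :* u :- m :* S :* v; v* = a :* a :* v :- S :* u in
        u := a :* a :* u* :+ m :* S :* v* :+ u :* (S :* S :* m :- (a :* a :* (a :* a) :- :1))) refl
      v-identity : ∀ a S m u v → let u* = a * a * u - m * S * v; v* = a * a * v - S * u in
        v ≡ S * u* + a * a * v* + v * (S * S * m - (a * a * (a * a) - 1ℤ))
      v-identity = ring 5 (λ a S m u v → let u* = a :* a :* u :- m :* S :* v; v* = a :* a :* v :- S :* u in
        v := S :* u* :+ a :* a :* v* :+ v :* (S :* S :* m :- (a :* a :* (a :* a) :- :1))) refl
      u-identity′ : ∀ a S m t u → a * a * t + m * S * (S * u) ≡ a * a * t + (a * a * (a * a) - 1ℤ) * u + u * (S * S * m - (a * a * (a * a) - 1ℤ))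
      u-identity′ = ring 5 (λ a S m t u → a :* a :* t :+ m :* S :* (S :* u) := a :* a :* t :+ (a :* a :* (a :* a) :- :1) :* u :+ u :* (S :* S :* m :- (a :* a :* (a :* a) :- :1))) refl
      v-identity′ : ∀ a S t u → S * t + a * a * (S * u) ≡ S * (t + a * a * u)
      v-identity′ = ring 4 (λ a S t u → S :* t :+ a :* a :* (S :* u) := S :* (t :+ a :* a :* u)) refl

    at-zero : v ≡ 0ℤ → Solution u v
    at-zero v≡0 = record
      { l = 0
      ; u≡ = square-one (weaken {u} 1≤u) (modulo 1ℤ (modulo (m * v) (ring 3 (λ m u v → u :* u := :1 :+ :1 :* (u :* u :- m :* (v :* v) :- :1) :+ m :* v :* (v :- :0)) refl m u v) v≡0) N)
      ; v≡ = trans v≡0 (sym (ℤ.*-zeroʳ S))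
      }

    go : ∀ n → 0ℤ ≤ + n - v → 0ℤ ≤ v - 1ℤ ⊎ 0ℤ ≤ - (v - 1ℤ) - 1ℤ → Solution u v
    go _ _ (inj₂ v<1) = at-zero (0≤-antisym 0≤v (subst (0ℤ ≤_) (ring 1 (λ v → :- (v :- :1) :- :1 := :- v) refl v) v<1))
    go zero v≤0 (inj₁ 1≤v) = ⊥-elim (¬0≤-1 (0≤+ v≤0 1≤v) (ring 1 (λ v → :0 :- v :+ (v :- :1) := con -1ℤ) refl v))
    go (suc n) v≤n (inj₁ 1≤v) = lift (pell n u* v* 1≤u* (0≤v* 1≤v)
      (subst (0ℤ ≤_) (identity a S u v (+ n)) (0≤+ v≤n v*<v)) N*)
      where
      identity : ∀ a S u v n → 1ℤ + n - v + (S * u - (a * a - 1ℤ) * v - 1ℤ) ≡ n - (a * a * v - S * u)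
      identity = ring 5 (λ a S u v n → :1 :+ n :- v :+ (S :* u :- (a :* a :- :1) :* v :- :1) := n :- (a :* a :* v :- S :* u)) refl

-- Square factors, and the Pell solutions whose product is a square

-- No factorization into primes is needed: distributivity of the gcd gives first that t divides y g
-- and then that t divides g², while g² divides both t t and t w, whose gcd is t.
coprime-square : ∀ t w y → Coprime t w → t ℕ.* w ≡ y ℕ.* y → t ≡ gcd t y ℕ.* gcd t y
coprime-square t w y cop tw≡y² = ∣-antisym t∣g² g²∣t
  where
  g = gcd t y

  g∣t = gcd[m,n]∣m t y
  g∣y = gcd[m,n]∣n t y

  t∣yg : t ∣ℕ y ℕ.* g
  t∣yg = subst (t ∣ℕ_) (sym (c*gcd[m,n]≡gcd[cm,cn] y t y))
    (gcd-greatest (n∣m*n y) (subst (t ∣ℕ_) tw≡y² (m∣m*n w)))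

  t∣g² : t ∣ℕ g ℕ.* g
  t∣g² = subst (t ∣ℕ_) (sym (c*gcd[m,n]≡gcd[cm,cn] g t y))
    (gcd-greatest (n∣m*n g) (subst (t ∣ℕ_) (ℕ.*-comm y g) t∣yg))

  g²∣t : g ℕ.* g ∣ℕ t
  g²∣t = subst (g ℕ.* g ∣ℕ_)
    (trans (sym (c*gcd[m,n]≡gcd[cm,cn] t t w)) (trans (cong (t ℕ.*_) (coprime⇒gcd≡1 cop)) (ℕ.*-identityʳ t)))
    (gcd-greatest (*-pres-∣ g∣t g∣t) (subst (g ℕ.* g ∣ℕ_) (sym tw≡y²) (*-pres-∣ g∣y g∣y)))

-- After division by the gcd of s and z, s′ divides z′² and is prime to z′. Hence s′ = 1, so s
-- divides z and u is the square of the quotient.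
square-cofactor : ∀ s z u .{{_ : NonZero s}} → z ℕ.* z ≡ s ℕ.* s ℕ.* u → ∃ λ y → u ≡ y ℕ.* y
square-cofactor s z u eq = z′ , ℕ.*-cancelˡ-≡ u (z′ ℕ.* z′) (g ℕ.* g) {{ℕ.m*n≢0 g g}} (sym (trans (rearrange g z′ z′) (trans (cong₂ ℕ._*_ z≡ z≡) (trans eq (cong (ℕ._* u) (cong₂ ℕ._*_ s≡g s≡g))))))
  where
  g = gcd s z
  instance
    g≢0 : NonZero g
    g≢0 = ℕ.≢-nonZero λ eq → ℕ.≢-nonZero⁻¹ s (gcd[m,n]≡0⇒m≡0 eq)
  s′ = s ℕ./ g
  z′ = z ℕ./ g

  s≡′ : g ℕ.* s′ ≡ s
  s≡′ = ℕ.m*[n/m]≡n (gcd[m,n]∣m s z)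

  z≡ : g ℕ.* z′ ≡ z
  z≡ = ℕ.m*[n/m]≡n (gcd[m,n]∣n s z)

  rearrange : ∀ g x y → g ℕ.* g ℕ.* (x ℕ.* y) ≡ g ℕ.* x ℕ.* (g ℕ.* y)
  rearrange g x y = ℕ.[m*n]*[o*p]≡[m*o]*[n*p] g g x y

  cop : Coprime s′ z′
  cop = coprime-/gcd s z

  z′²≡ : z′ ℕ.* z′ ≡ s′ ℕ.* (s′ ℕ.* u)
  z′²≡ = ℕ.*-cancelˡ-≡ _ _ (g ℕ.* g) {{ℕ.m*n≢0 g g}} (begin
    g ℕ.* g ℕ.* (z′ ℕ.* z′)          ≡⟨ rearrange g z′ z′ ⟩
    g ℕ.* z′ ℕ.* (g ℕ.* z′)          ≡⟨ cong₂ ℕ._*_ z≡ z≡ ⟩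
    z ℕ.* z                          ≡⟨ eq ⟩
    s ℕ.* s ℕ.* u                    ≡⟨ cong (λ i → i ℕ.* i ℕ.* u) (sym s≡′) ⟩
    g ℕ.* s′ ℕ.* (g ℕ.* s′) ℕ.* u    ≡⟨ cong (ℕ._* u) (sym (rearrange g s′ s′)) ⟩
    g ℕ.* g ℕ.* (s′ ℕ.* s′) ℕ.* u    ≡⟨ ℕ.*-assoc (g ℕ.* g) (s′ ℕ.* s′) u ⟩
    g ℕ.* g ℕ.* (s′ ℕ.* s′ ℕ.* u)    ≡⟨ cong (g ℕ.* g ℕ.*_) (ℕ.*-assoc s′ s′ u) ⟩
    g ℕ.* g ℕ.* (s′ ℕ.* (s′ ℕ.* u))  ∎)
    where open ≡-Reasoning

  s′≡1 : s′ ≡ 1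
  s′≡1 = cop (∣-refl , coprime-divisor cop (divides (s′ ℕ.* u) (trans z′²≡ (ℕ.*-comm s′ _))))

  s≡g : s ≡ g
  s≡g = trans (sym s≡′) (trans (cong (g ℕ.*_) s′≡1) (ℕ.*-identityʳ g))

unit-coprime : ∀ t w m → + t * + t - m * (+ w * + w) ≡ 1ℤ → Coprime t w
unit-coprime t w m N {d} (divides p t≡ , divides q w≡) = ℕ.m*n≡1⇒m≡1 d ∣ r ∣
  (trans (sym (ℤ.abs-* (+ d) r)) (cong ∣_∣ (trans (sym identity) N)))
  where
  r = + p * (+ p * + d) - m * (+ q * (+ q * + d))
  identity : + t * + t - m * (+ w * + w) ≡ + d * r
  identity = trans (cong₂ (λ x y → x * x - m * (y * y)) (trans (cong +_ t≡) (ℤ.pos-* p d)) (trans (cong +_ w≡) (ℤ.pos-* q d)))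
    (ring 4 (λ m p q d → p :* d :* (p :* d) :- m :* (q :* d :* (q :* d)) := d :* (p :* (p :* d) :- m :* (q :* (q :* d)))) refl m (+ p) (+ q) (+ d))

module SquareSolutions (a : ℤ) (s : ℕ) (m : ℤ) .{{_ : NonZero s}} (2≤a : 0ℤ ≤ a - + 2)
  (S²m : + s * + s * (+ s * + s) * m ≡ disc a) (S²≤a+1 : 0ℤ ≤ a + 1ℤ - + s * + s * (+ s * + s)) where
  private
    S = + s * + s

  1≤square : ∀ n .{{_ : NonZero n}} → 0ℤ ≤ + n * + n - 1ℤ
  1≤square (suc n) = 0≤n

  open Pell a S m 2≤a (1≤square s) S²m S²≤a+1

  -- Coprimality splits t w = y² into two squares. The Pell equation gives w = s²U, so U is a square
  -- as well, and the quartic equation applies to the roots of T and U.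
  solve : ∀ t w y → 0ℤ ≤ + t - 1ℤ → 0ℤ ≤ + w - 1ℤ → + t * + t - m * (+ w * + w) ≡ 1ℤ → y ℕ.* y ≡ t ℕ.* w →
    + t ≡ a * a × + w ≡ S
  solve t w y 1≤t 1≤w N y²≡ = go (pell w (+ t) (+ w) 1≤t 0≤n (subst (0ℤ ≤_) (sym (ℤ.+-inverseʳ (+ w))) 0≤n) N)
    where
    cop : Coprime t w
    cop = unit-coprime t w m N

    x z : ℕ
    x = gcd t y
    z = gcd w y

    t≡x² : t ≡ x ℕ.* x
    t≡x² = coprime-square t w y cop (sym y²≡)

    w≡z² : w ≡ z ℕ.* z
    w≡z² = coprime-square w t y (coprime-sym cop) (trans (ℕ.*-comm w t) (sym y²≡))

    positive : ∀ x {t} → t ≡ x ℕ.* x → 0ℤ ≤ + t - 1ℤ → 0ℤ ≤ + x - 1ℤ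
    positive zero refl ()
    positive (suc x) _ _ = 0≤n

    go : Solution (+ t) (+ w) → + t ≡ a * a × + w ≡ S
    go sol = finish (square-cofactor s z ∣ U a l ∣ (trans (sym w≡z²) w≡))
      where
      open Solution sol
      w≡ : w ≡ s ℕ.* s ℕ.* ∣ U a l ∣
      w≡ = trans (cong ∣_∣ v≡) (trans (ℤ.abs-* S (U a l)) (cong (ℕ._* ∣ U a l ∣) (ℤ.abs-* (+ s) (+ s))))

      finish : (∃ λ y → ∣ U a l ∣ ≡ y ℕ.* y) → + t ≡ a * a × + w ≡ S
      finish (y′ , U≡) = trans (cong +_ t≡x²) (trans (ℤ.pos-* x x) (cong₂ _*_ (proj₁ r) (proj₁ r)))
                       , trans v≡ (trans (cong (S *_) (trans (sym y′²≡U) (cong₂ _*_ (proj₂ r) (proj₂ r)))) (ℤ.*-identityʳ S))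
        where
        y′²≡U : + y′ * + y′ ≡ U a l
        y′²≡U = ℤ.*-cancelˡ-≡ S (+ y′ * + y′) (U a l) {{S≢0}} (trans (trans (cong (S *_) (sym (ℤ.pos-* y′ y′)))
            (trans (cong (_* + (y′ ℕ.* y′)) (sym (ℤ.pos-* s s))) (trans (sym (ℤ.pos-* (s ℕ.* s) (y′ ℕ.* y′))) (cong +_ (sym (trans w≡ (cong (s ℕ.* s ℕ.*_) U≡)))))))
            v≡)
          where
          S≢0 : ℤ.NonZero S
          S≢0 = ℤ.i*j≢0 (+ s) (+ s)

        1≤y′ : 0ℤ ≤ + y′ - 1ℤ
        1≤y′ = positive′ y′ refl
          where
          positive′ : ∀ i → y′ ≡ i → 0ℤ ≤ + i - 1ℤ
          positive′ zero eq = ⊥-elim (¬0≤-1 1≤w (cong (λ i → + i - 1ℤ) (trans w≡ (trans (cong (s ℕ.* s ℕ.*_) (trans U≡ (cong (λ i → i ℕ.* i) eq))) (ℕ.*-zeroʳ (s ℕ.* s))))))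
          positive′ (suc i) _ = 0≤n

        r = QuarticEquation.quartic-unique a 2≤a {+ x} {+ y′} l (positive x t≡x² 1≤t) 1≤y′
          (trans (sym (ℤ.pos-* x x)) (trans (cong +_ (sym t≡x²)) u≡)) y′²≡U

-- The index form

det : (p1 p2 p3 q1 q2 q3 r1 r2 r3 : ℤ) → ℤ
det p1 p2 p3 q1 q2 q3 r1 r2 r3 = p1 * (q2 * r3 - q3 * r2) - p2 * (q1 * r3 - q3 * r1) + p3 * (q1 * r2 - q2 * r1)

detP : ∀ {n} (p1 p2 p3 q1 q2 q3 r1 r2 r3 : Polynomial n) → Polynomial n
detP p1 p2 p3 q1 q2 q3 r1 r2 r3 = p1 :* (q2 :* r3 :- q3 :* r2) :- p2 :* (q1 :* r3 :- q3 :* r1) :+ p3 :* (q1 :* r2 :- q2 :* r1)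

det-mul : ∀ a1 a2 a3 b1 b2 b3 d1 d2 d3 p1 p2 p3 q1 q2 q3 r1 r2 r3 →
  det (a1 * p1 + a2 * q1 + a3 * r1) (a1 * p2 + a2 * q2 + a3 * r2) (a1 * p3 + a2 * q3 + a3 * r3)
      (b1 * p1 + b2 * q1 + b3 * r1) (b1 * p2 + b2 * q2 + b3 * r2) (b1 * p3 + b2 * q3 + b3 * r3)
      (d1 * p1 + d2 * q1 + d3 * r1) (d1 * p2 + d2 * q2 + d3 * r2) (d1 * p3 + d2 * q3 + d3 * r3)
  ≡ det a1 a2 a3 b1 b2 b3 d1 d2 d3 * det p1 p2 p3 q1 q2 q3 r1 r2 r3
det-mul = ring 18 (λ a1 a2 a3 b1 b2 b3 d1 d2 d3 p1 p2 p3 q1 q2 q3 r1 r2 r3 →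
  detP (a1 :* p1 :+ a2 :* q1 :+ a3 :* r1) (a1 :* p2 :+ a2 :* q2 :+ a3 :* r2) (a1 :* p3 :+ a2 :* q3 :+ a3 :* r3)
      (b1 :* p1 :+ b2 :* q1 :+ b3 :* r1) (b1 :* p2 :+ b2 :* q2 :+ b3 :* r2) (b1 :* p3 :+ b2 :* q3 :+ b3 :* r3)
      (d1 :* p1 :+ d2 :* q1 :+ d3 :* r1) (d1 :* p2 :+ d2 :* q2 :+ d3 :* r2) (d1 :* p3 :+ d2 :* q3 :+ d3 :* r3)
  := detP a1 a2 a3 b1 b2 b3 d1 d2 d3 :* detP p1 p2 p3 q1 q2 q3 r1 r2 r3) refl

det-cramer : ∀ v1 v2 v3 p1 p2 p3 q1 q2 q3 r1 r2 r3 →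
  det v1 v2 v3 q1 q2 q3 r1 r2 r3 * p1 + det p1 p2 p3 v1 v2 v3 r1 r2 r3 * q1 + det p1 p2 p3 q1 q2 q3 v1 v2 v3 * r1
  ≡ det p1 p2 p3 q1 q2 q3 r1 r2 r3 * v1
det-cramer = ring 12 (λ v1 v2 v3 p1 p2 p3 q1 q2 q3 r1 r2 r3 →
  detP v1 v2 v3 q1 q2 q3 r1 r2 r3 :* p1 :+ detP p1 p2 p3 v1 v2 v3 r1 r2 r3 :* q1 :+ detP p1 p2 p3 q1 q2 q3 v1 v2 v3 :* r1
  := detP p1 p2 p3 q1 q2 q3 r1 r2 r3 :* v1) refl

det-cyclic : ∀ p1 p2 p3 q1 q2 q3 r1 r2 r3 → det p1 p2 p3 q1 q2 q3 r1 r2 r3 ≡ det p2 p3 p1 q2 q3 q1 r2 r3 r1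
det-cyclic = ring 9 (λ p1 p2 p3 q1 q2 q3 r1 r2 r3 → detP p1 p2 p3 q1 q2 q3 r1 r2 r3 := detP p2 p3 p1 q2 q3 q1 r2 r3 r1) refl

det-cols : ∀ a b d p1 p2 p3 q1 q2 q3 r1 r2 r3 →
  det (a * p1 + b * q1 + d * r1) (a * p2 + b * q2 + d * r2) (a * p3 + b * q3 + d * r3) q1 q2 q3 r1 r2 r3
    ≡ det p1 p2 p3 q1 q2 q3 r1 r2 r3 * a
  × det p1 p2 p3 (a * p1 + b * q1 + d * r1) (a * p2 + b * q2 + d * r2) (a * p3 + b * q3 + d * r3) r1 r2 r3
    ≡ det p1 p2 p3 q1 q2 q3 r1 r2 r3 * b
  × det p1 p2 p3 q1 q2 q3 (a * p1 + b * q1 + d * r1) (a * p2 + b * q2 + d * r2) (a * p3 + b * q3 + d * r3)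
    ≡ det p1 p2 p3 q1 q2 q3 r1 r2 r3 * d
det-cols a b d p1 p2 p3 q1 q2 q3 r1 r2 r3 =
    ring 12 (λ a b d p1 p2 p3 q1 q2 q3 r1 r2 r3 →
      detP (a :* p1 :+ b :* q1 :+ d :* r1) (a :* p2 :+ b :* q2 :+ d :* r2) (a :* p3 :+ b :* q3 :+ d :* r3) q1 q2 q3 r1 r2 r3
      := detP p1 p2 p3 q1 q2 q3 r1 r2 r3 :* a) refl a b d p1 p2 p3 q1 q2 q3 r1 r2 r3
  , ring 12 (λ a b d p1 p2 p3 q1 q2 q3 r1 r2 r3 →
      detP p1 p2 p3 (a :* p1 :+ b :* q1 :+ d :* r1) (a :* p2 :+ b :* q2 :+ d :* r2) (a :* p3 :+ b :* q3 :+ d :* r3) r1 r2 r3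
      := detP p1 p2 p3 q1 q2 q3 r1 r2 r3 :* b) refl a b d p1 p2 p3 q1 q2 q3 r1 r2 r3
  , ring 12 (λ a b d p1 p2 p3 q1 q2 q3 r1 r2 r3 →
      detP p1 p2 p3 q1 q2 q3 (a :* p1 :+ b :* q1 :+ d :* r1) (a :* p2 :+ b :* q2 :+ d :* r2) (a :* p3 :+ b :* q3 :+ d :* r3)
      := detP p1 p2 p3 q1 q2 q3 r1 r2 r3 :* d) refl a b d p1 p2 p3 q1 q2 q3 r1 r2 r3

detK : ZK → ZK → ZK → ℤ
detK p q r = det (c1 p) (c2 p) (c3 p) (c1 q) (c2 q) (c3 q) (c1 r) (c2 r) (c3 r)

module _ (b : Fin 4 → ZK) (b0≡1 : b zero ≡ 1K) where
  private
    p = b (# 1)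
    q = b (# 2)
    r = b (# 3)
    Δ = detK p q r

    coord : ∀ c → c 1K ≡ 0ℤ → ∀ (a : Fin 4 → ℤ) →
      a zero * c (b zero) + (a (# 1) * c p + (a (# 2) * c q + a (# 3) * c r)) ≡ a (# 1) * c p + a (# 2) * c q + a (# 3) * c r
    coord c c1K a = trans (cong (λ z → a zero * z + (a (# 1) * c p + (a (# 2) * c q + a (# 3) * c r))) (trans (cong c b0≡1) c1K))
      (ring 7 (λ a0 a1 a2 a3 x y z → a0 :* :0 :+ (a1 :* x :+ (a2 :* y :+ a3 :* z)) := a1 :* x :+ a2 :* y :+ a3 :* z)
        refl (a zero) (a (# 1)) (a (# 2)) (a (# 3)) (c p) (c q) (c r))

    module Coords (a : Fin 4 → ℤ) where
      a1 = a (# 1)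
      a2 = a (# 2)
      a3 = a (# 3)

      eq1 : c1 (lincomb b a) ≡ a1 * c1 p + a2 * c1 q + a3 * c1 r
      eq1 = coord c1 refl a

      eq2 : c2 (lincomb b a) ≡ a1 * c2 p + a2 * c2 q + a3 * c2 r
      eq2 = coord c2 refl a

      eq3 : c3 (lincomb b a) ≡ a1 * c3 p + a2 * c3 q + a3 * c3 r
      eq3 = coord c3 refl a

  det≡ : ∀ {p1 p1′ p2 p2′ p3 p3′ q1 q1′ q2 q2′ q3 q3′ r1 r1′ r2 r2′ r3 r3′} →
    p1 ≡ p1′ → p2 ≡ p2′ → p3 ≡ p3′ → q1 ≡ q1′ → q2 ≡ q2′ → q3 ≡ q3′ → r1 ≡ r1′ → r2 ≡ r2′ → r3 ≡ r3′ →
    det p1 p2 p3 q1 q2 q3 r1 r2 r3 ≡ det p1′ p2′ p3′ q1′ q2′ q3′ r1′ r2′ r3′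
  det≡ refl refl refl refl refl refl refl refl refl = refl

  -- Writing α, α², α³ in terms of b yields an inverse of the matrix of b, and determinants
  -- multiply. Since b starts with 1, the last three coordinates are enough.
  basis⇒unit : IsIntegralBasis b → ∃ λ k → k * Δ ≡ 1ℤ
  basis⇒unit (span , _) = det (a1 f) (a2 f) (a3 f) (a1 g) (a2 g) (a3 g) (a1 h) (a2 h) (a3 h) , sym (trans
      (det≡ (row c1 f≡ (eq1 f)) (row c2 f≡ (eq2 f)) (row c3 f≡ (eq3 f)) (row c1 g≡ (eq1 g)) (row c2 g≡ (eq2 g)) (row c3 g≡ (eq3 g)) (row c1 h≡ (eq1 h)) (row c2 h≡ (eq2 h)) (row c3 h≡ (eq3 h)))
      (det-mul (a1 f) (a2 f) (a3 f) (a1 g) (a2 g) (a3 g) (a1 h) (a2 h) (a3 h) (c1 p) (c2 p) (c3 p) (c1 q) (c2 q) (c3 q) (c1 r) (c2 r) (c3 r)))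
    where
    open Coords
    e1 e2 e3 : ZK
    e1 = ⟨ 0ℤ , 1ℤ , 0ℤ , 0ℤ ⟩
    e2 = ⟨ 0ℤ , 0ℤ , 1ℤ , 0ℤ ⟩
    e3 = ⟨ 0ℤ , 0ℤ , 0ℤ , 1ℤ ⟩
    f g h : Fin 4 → ℤ
    f = proj₁ (span e1)
    g = proj₁ (span e2)
    h = proj₁ (span e3)
    f≡ = proj₂ (span e1)
    g≡ = proj₂ (span e2)
    h≡ = proj₂ (span e3)

    row : ∀ (c : ZK → ℤ) {x y w} → x ≡ y → c x ≡ w → c y ≡ w
    row c refl eq = eq

  -- Cramer's rule, in which Δ² = 1 turns division by Δ into multiplication by Δ.
  unit⇒basis : Δ * Δ ≡ 1ℤ → IsIntegralBasis b
  unit⇒basis Δ²≡1 = span , independent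
    where
    open Coords

    scale : ∀ x → Δ * (Δ * x) ≡ x
    scale x = trans (sym (ℤ.*-assoc Δ Δ x)) (trans (cong (_* x) Δ²≡1) (ℤ.*-identityˡ x))

    distrib : ∀ D k l m x y z w → k * x + l * y + m * z ≡ D * w → D * k * x + D * l * y + D * m * z ≡ D * (D * w)
    distrib D k l m x y z w eq = trans (ring 7 (λ D k l m x y z → D :* k :* x :+ D :* l :* y :+ D :* m :* z := D :* (k :* x :+ l :* y :+ m :* z)) refl D k l m x y z) (cong (D *_) eq)

    span : ∀ v → ∃ λ a → lincomb b a ≡ v
    span v = a , zk≡ eq0
        (trans (eq1 a) (trans (distrib Δ k1 k2 k3 (c1 p) (c1 q) (c1 r) (c1 v) cramer1) (scale (c1 v))))
        (trans (eq2 a) (trans (distrib Δ k1 k2 k3 (c2 p) (c2 q) (c2 r) (c2 v) cramer2) (scale (c2 v))))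
        (trans (eq3 a) (trans (distrib Δ k1 k2 k3 (c3 p) (c3 q) (c3 r) (c3 v) cramer3) (scale (c3 v))))
      where
      k1 k2 k3 : ℤ
      k1 = detK v q r
      k2 = detK p v r
      k3 = detK p q v

      tail : ℤ
      tail = Δ * k1 * c0 p + (Δ * k2 * c0 q + Δ * k3 * c0 r)

      a : Fin 4 → ℤ
      -- The first basis element is 1, so its coefficient can correct the constant coordinate alone.
      a zero = c0 v - tail
      a (suc zero) = Δ * k1
      a (suc (suc zero)) = Δ * k2
      a (suc (suc (suc zero))) = Δ * k3

      cramer1 : k1 * c1 p + k2 * c1 q + k3 * c1 r ≡ Δ * c1 v
      cramer1 = det-cramer (c1 v) (c2 v) (c3 v) (c1 p) (c2 p) (c3 p) (c1 q) (c2 q) (c3 q) (c1 r) (c2 r) (c3 r)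

      rotate : ∀ x y z → detK x y z ≡ det (c2 x) (c3 x) (c1 x) (c2 y) (c3 y) (c1 y) (c2 z) (c3 z) (c1 z)
      rotate x y z = det-cyclic (c1 x) (c2 x) (c3 x) (c1 y) (c2 y) (c3 y) (c1 z) (c2 z) (c3 z)

      rotate² : ∀ x y z → detK x y z ≡ det (c3 x) (c1 x) (c2 x) (c3 y) (c1 y) (c2 y) (c3 z) (c1 z) (c2 z)
      rotate² x y z = trans (rotate x y z) (det-cyclic (c2 x) (c3 x) (c1 x) (c2 y) (c3 y) (c1 y) (c2 z) (c3 z) (c1 z))

      combine : ∀ {k k′ l l′ m m′ D D′} x y z w → k ≡ k′ → l ≡ l′ → m ≡ m′ → D ≡ D′ →
        k′ * x + l′ * y + m′ * z ≡ D′ * w → k * x + l * y + m * z ≡ D * w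
      combine x y z w refl refl refl refl eq = eq

      cramer2 : k1 * c2 p + k2 * c2 q + k3 * c2 r ≡ Δ * c2 v
      cramer2 = combine (c2 p) (c2 q) (c2 r) (c2 v) (rotate v q r) (rotate p v r) (rotate p q v) (rotate p q r)
        (det-cramer (c2 v) (c3 v) (c1 v) (c2 p) (c3 p) (c1 p) (c2 q) (c3 q) (c1 q) (c2 r) (c3 r) (c1 r))

      cramer3 : k1 * c3 p + k2 * c3 q + k3 * c3 r ≡ Δ * c3 v
      cramer3 = combine (c3 p) (c3 q) (c3 r) (c3 v) (rotate² v q r) (rotate² p v r) (rotate² p q v) (rotate² p q r)
        (det-cramer (c3 v) (c1 v) (c2 v) (c3 p) (c1 p) (c2 p) (c3 q) (c1 q) (c2 q) (c3 r) (c1 r) (c2 r))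

      eq0 : (c0 v - tail) * c0 (b zero) + tail ≡ c0 v
      eq0 = trans (cong (λ z → (c0 v - tail) * c0 z + tail) b0≡1)
        (ring 2 (λ v t → (v :- t) :* :1 :+ t := v) refl (c0 v) tail)

    independent : ∀ a → lincomb b a ≡ 0K → ∀ i → a i ≡ 0ℤ
    independent a eq = all
      where
      zero1 : a1 a * c1 p + a2 a * c1 q + a3 a * c1 r ≡ 0ℤ
      zero1 = trans (sym (eq1 a)) (cong c1 eq)
      zero2 : a1 a * c2 p + a2 a * c2 q + a3 a * c2 r ≡ 0ℤ
      zero2 = trans (sym (eq2 a)) (cong c2 eq)
      zero3 : a1 a * c3 p + a2 a * c3 q + a3 a * c3 r ≡ 0ℤ
      zero3 = trans (sym (eq3 a)) (cong c3 eq)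

      cols = det-cols (a1 a) (a2 a) (a3 a) (c1 p) (c2 p) (c3 p) (c1 q) (c2 q) (c3 q) (c1 r) (c2 r) (c3 r)

      cancel : ∀ x → 0ℤ ≡ Δ * x → x ≡ 0ℤ
      cancel x eq = trans (sym (scale x)) (trans (cong (Δ *_) (sym eq)) (ℤ.*-zeroʳ Δ))

      zero-row₁ : ∀ q1 q2 q3 r1 r2 r3 {x y z} → x ≡ 0ℤ → y ≡ 0ℤ → z ≡ 0ℤ → det x y z q1 q2 q3 r1 r2 r3 ≡ 0ℤ
      zero-row₁ q1 q2 q3 r1 r2 r3 refl refl refl = ring 6 (λ q1 q2 q3 r1 r2 r3 → detP :0 :0 :0 q1 q2 q3 r1 r2 r3 := :0) refl q1 q2 q3 r1 r2 r3

      zero-row₂ : ∀ q1 q2 q3 r1 r2 r3 {x y z} → x ≡ 0ℤ → y ≡ 0ℤ → z ≡ 0ℤ → det q1 q2 q3 x y z r1 r2 r3 ≡ 0ℤ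
      zero-row₂ q1 q2 q3 r1 r2 r3 refl refl refl = ring 6 (λ q1 q2 q3 r1 r2 r3 → detP q1 q2 q3 :0 :0 :0 r1 r2 r3 := :0) refl q1 q2 q3 r1 r2 r3

      zero-row₃ : ∀ q1 q2 q3 r1 r2 r3 {x y z} → x ≡ 0ℤ → y ≡ 0ℤ → z ≡ 0ℤ → det q1 q2 q3 r1 r2 r3 x y z ≡ 0ℤ
      zero-row₃ q1 q2 q3 r1 r2 r3 refl refl refl = ring 6 (λ q1 q2 q3 r1 r2 r3 → detP q1 q2 q3 r1 r2 r3 :0 :0 :0 := :0) refl q1 q2 q3 r1 r2 r3

      a1≡0 : a1 a ≡ 0ℤ
      a1≡0 = cancel (a1 a) (trans (sym (zero-row₁ (c1 q) (c2 q) (c3 q) (c1 r) (c2 r) (c3 r) zero1 zero2 zero3)) (proj₁ cols))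
      a2≡0 : a2 a ≡ 0ℤ
      a2≡0 = cancel (a2 a) (trans (sym (zero-row₂ (c1 p) (c2 p) (c3 p) (c1 r) (c2 r) (c3 r) zero1 zero2 zero3)) (proj₁ (proj₂ cols)))
      a3≡0 : a3 a ≡ 0ℤ
      a3≡0 = cancel (a3 a) (trans (sym (zero-row₃ (c1 p) (c2 p) (c3 p) (c1 q) (c2 q) (c3 q) zero1 zero2 zero3)) (proj₂ (proj₂ cols)))

      a0≡0 : a zero ≡ 0ℤ
      a0≡0 = trans (reduce a1≡0 a2≡0 a3≡0 (cong c0 b0≡1)) (cong c0 eq)
        where
        reduce : ∀ {a0 a1 a2 a3 one x y z} → a1 ≡ 0ℤ → a2 ≡ 0ℤ → a3 ≡ 0ℤ → one ≡ 1ℤ →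
          a0 ≡ a0 * one + (a1 * x + (a2 * y + a3 * z))
        reduce {a0} {x = x} {y} {z} refl refl refl refl =
          ring 4 (λ a0 x y z → a0 := a0 :* :1 :+ (:0 :* x :+ (:0 :* y :+ :0 :* z))) refl a0 x y z

      all : ∀ i → a i ≡ 0ℤ
      all zero = a0≡0
      all (suc zero) = a1≡0
      all (suc (suc zero)) = a2≡0
      all (suc (suc (suc zero))) = a3≡0

-- The product of the differences of the conjugates of γ, divided by that for α. The factor n comes
-- from the two pairs in which α changes sign, the factor n² + 4mw² from the other four pairs.
indexForm : ℤ → ℤ → ℤ → ℤ → ℤ
indexForm m x y z = let n = x * x - m * (z * z); w = y * y - x * z in n * (n * n + + 4 * (m * (w * w)))

power-det : ∀ m c x y z → detK (powers m ⟨ c , x , y , z ⟩ (# 1)) (powers m ⟨ c , x , y , z ⟩ (# 2)) (powers m ⟨ c , x , y , z ⟩ (# 3)) ≡ indexForm m x y z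
power-det = ring 5 (λ m c x y z → let γ = ⟪ c , x , y , z ⟫; one = ⟪ :1 , :0 , :0 , :0 ⟫; γ₁ = mulP m γ one; γ₂ = mulP m γ γ₁; γ₃ = mulP m γ γ₂
                                      n = x :* x :- m :* (z :* z); w = y :* y :- x :* z in
  detP (p1 γ₁) (p2 γ₁) (p3 γ₁) (p1 γ₂) (p2 γ₂) (p3 γ₂) (p1 γ₃) (p2 γ₃) (p3 γ₃) := n :* (n :* n :+ con (+ 4) :* (m :* (w :* w)))) refl
  where open Quartic

unit-signs : ∀ i j → i * j ≡ 1ℤ → i ≡ 1ℤ ⊎ i ≡ -1ℤ
unit-signs i j eq = go i (ℕ.m*n≡1⇒m≡1 ∣ i ∣ ∣ j ∣ (trans (sym (ℤ.abs-* i j)) (cong ∣_∣ eq)))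
  where
  go : ∀ i → ∣ i ∣ ≡ 1 → i ≡ 1ℤ ⊎ i ≡ -1ℤ
  go (+ _) refl = inj₁ refl
  go -[1+ _ ] refl = inj₂ refl

parityℤ : ∀ i → ∃ λ h → i ≡ + 2 * h ⊎ i ≡ 1ℤ + + 2 * h
parityℤ i = i /ℕ 2 , go (i %ℕ 2) (ℤ.n%ℕd<d i 2) (ℤ.a≡a%ℕn+[a/ℕn]*n i 2)
  where
  go : ∀ r → r ℕ.< 2 → i ≡ + r + i /ℕ 2 * + 2 → i ≡ + 2 * (i /ℕ 2) ⊎ i ≡ 1ℤ + + 2 * (i /ℕ 2)
  go 0 _ eq = inj₁ (trans eq (ring 1 (λ h → :0 :+ h :* :2 := :2 :* h) refl (i /ℕ 2)))
  go 1 _ eq = inj₂ (trans eq (ring 1 (λ h → :1 :+ h :* :2 := :1 :+ :2 :* h) refl (i /ℕ 2)))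
  go (suc (suc _)) (ℕ.s≤s (ℕ.s≤s ())) _

-- Both factors of the index form are units. If w were nonzero, the second would be at least 4m.
index-form-unit : ∀ m x y z k → 0ℤ ≤ m - + 2 → k * indexForm m x y z ≡ 1ℤ →
  (x * x - m * (z * z) ≡ 1ℤ ⊎ x * x - m * (z * z) ≡ -1ℤ) × y * y - x * z ≡ 0ℤ
index-form-unit m x y z k 2≤m eq = n±1 , w≡0 (zero-or-square w)
  where
  n w q : ℤ
  n = x * x - m * (z * z)
  w = y * y - x * z
  q = n * n + + 4 * (m * (w * w))

  n±1 : n ≡ 1ℤ ⊎ n ≡ -1ℤ
  n±1 = unit-signs n (k * q) (trans (ring 3 (λ n k q → n :* (k :* q) := k :* (n :* q)) refl n k q) eq)

  q±1 : q ≡ 1ℤ ⊎ q ≡ -1ℤ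
  q±1 = unit-signs q (k * n) (trans (ring 3 (λ n k q → q :* (k :* n) := k :* (n :* q)) refl n k q) eq)

  large : 0ℤ ≤ w * w - 1ℤ → 0ℤ ≤ + 4 * ((m - + 2 + 1ℤ) * (w * w) + (w * w - 1ℤ)) + n * n
  large h = 0≤+ (0≤* (0≤n {4}) (0≤+ (0≤* (0≤+ 2≤m (0≤n {1})) (0≤i*i w)) h)) (0≤i*i n)

  w≡0 : w ≡ 0ℤ ⊎ 0ℤ ≤ w * w - 1ℤ → w ≡ 0ℤ
  w≡0 (inj₁ p) = p
  w≡0 (inj₂ h) = ⊥-elim (go q±1)
    where
    go : q ≡ 1ℤ ⊎ q ≡ -1ℤ → ⊥
    go (inj₁ p) = ¬0≤-1 (0≤+ (large h) (0≤n {2}))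
      (modulo 1ℤ (ring 3 (λ m w n → :4 :* ((m :- :2 :+ :1) :* (w :* w) :+ (w :* w :- :1)) :+ n :* n :+ :2 :=
        con -1ℤ :+ :1 :* (n :* n :+ :4 :* (m :* (w :* w)) :- :1)) refl m w n) p)
    go (inj₂ p) = ¬0≤-1 (0≤+ (large h) (0≤n {4}))
      (modulo 1ℤ (ring 3 (λ m w n → :4 :* ((m :- :2 :+ :1) :* (w :* w) :+ (w :* w :- :1)) :+ n :* n :+ :4 :=
        con -1ℤ :+ :1 :* (n :* n :+ :4 :* (m :* (w :* w)) :- con -1ℤ)) refl m w n) p)

generator⇒ : ∀ m γ → 0ℤ ≤ m - + 2 → GeneratesPowerIntegralBasis m γ →
  (c1 γ * c1 γ - m * (c3 γ * c3 γ) ≡ 1ℤ ⊎ c1 γ * c1 γ - m * (c3 γ * c3 γ) ≡ -1ℤ) × c2 γ * c2 γ - c1 γ * c3 γ ≡ 0ℤ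
generator⇒ m γ@(⟨ c , x , y , z ⟩) 2≤m basis = go (basis⇒unit (powers m γ) refl basis)
  where
  go : (∃ λ k → k * detK (powers m γ (# 1)) (powers m γ (# 2)) (powers m γ (# 3)) ≡ 1ℤ) → _
  go (k , eq) = index-form-unit m x y z k 2≤m (trans (cong (k *_) (sym (power-det m c x y z))) eq)

⇒generator : ∀ m γ → c1 γ * c1 γ - m * (c3 γ * c3 γ) ≡ 1ℤ → c2 γ * c2 γ - c1 γ * c3 γ ≡ 0ℤ →
  GeneratesPowerIntegralBasis m γ
⇒generator m γ@(⟨ c , x , y , z ⟩) n≡1 w≡0 = unit⇒basis (powers m γ) refl
  (trans (cong (λ i → i * i) (power-det m c x y z)) (cong (λ i → i * i) (trans (cong₂ (λ n w → n * (n * n + + 4 * (m * (w * w)))) n≡1 w≡0)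
    (ring 1 (λ m → :1 :* (:1 :* :1 :+ :4 :* (m :* (:0 :* :0))) := :1) refl m))))

-- A norm −1 is impossible since x² + 1 is never 0 or 3 mod 4.
no-norm-minus-one : ∀ q x z → x * x - (+ 3 + + 4 * q) * (z * z) ≢ -1ℤ
no-norm-minus-one q x z eq = go (parityℤ x) (parityℤ z)
  where
  go : (∃ λ h → x ≡ + 2 * h ⊎ x ≡ 1ℤ + + 2 * h) → (∃ λ h → z ≡ + 2 * h ⊎ z ≡ 1ℤ + + 2 * h) → ⊥
  go (i , inj₁ refl) (j , inj₁ refl) = odd≢0 (+ 2 * (i * i) - + 2 * ((+ 3 + + 4 * q) * (j * j)))
    (modulo 1ℤ (ring 3 (λ q i j → :1 :+ :2 :* (:2 :* (i :* i) :- :2 :* ((con (+ 3) :+ :4 :* q) :* (j :* j))) :=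
      :0 :+ :1 :* (:2 :* i :* (:2 :* i) :- (con (+ 3) :+ :4 :* q) :* (:2 :* j :* (:2 :* j)) :- con -1ℤ)) refl q i j) eq)
  go (i , inj₂ refl) (j , inj₁ refl) = *-≢0 2≢0 (odd≢0 (i * i + i - (+ 3 + + 4 * q) * (j * j)))
    (modulo 1ℤ (ring 3 (λ q i j → :2 :* (:1 :+ :2 :* (i :* i :+ i :- (con (+ 3) :+ :4 :* q) :* (j :* j))) :=
      :0 :+ :1 :* ((:1 :+ :2 :* i) :* (:1 :+ :2 :* i) :- (con (+ 3) :+ :4 :* q) :* (:2 :* j :* (:2 :* j)) :- con -1ℤ)) refl q i j) eq)
  go (i , inj₁ refl) (j , inj₂ refl) = *-≢0 2≢0 (odd≢0 (i * i - (+ 3 + + 4 * q) * (j * j + j) - 1ℤ - q))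
    (modulo 1ℤ (ring 3 (λ q i j → :2 :* (:1 :+ :2 :* (i :* i :- (con (+ 3) :+ :4 :* q) :* (j :* j :+ j) :- :1 :- q)) :=
      :0 :+ :1 :* (:2 :* i :* (:2 :* i) :- (con (+ 3) :+ :4 :* q) :* ((:1 :+ :2 :* j) :* (:1 :+ :2 :* j)) :- con -1ℤ)) refl q i j) eq)
  go (i , inj₂ refl) (j , inj₂ refl) = odd≢0 (+ 2 * (i * i + i) - + 2 * ((+ 3 + + 4 * q) * (j * j + j)) - 1ℤ - + 2 * q)
    (modulo 1ℤ (ring 3 (λ q i j → :1 :+ :2 :* (:2 :* (i :* i :+ i) :- :2 :* ((con (+ 3) :+ :4 :* q) :* (j :* j :+ j)) :- :1 :- :2 :* q) :=
      :0 :+ :1 :* ((:1 :+ :2 :* i) :* (:1 :+ :2 :* i) :- (con (+ 3) :+ :4 :* q) :* ((:1 :+ :2 :* j) :* (:1 :+ :2 :* j)) :- con -1ℤ)) refl q i j) eq)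

-- The parameters s, t, ε

module _ (s t : ℕ) .{{_ : NonZero s}} .{{_ : NonZero t}} (ε : ℤ) (ε±1 : ε ≡ 1ℤ ⊎ ε ≡ -1ℤ) (m : ℤ) where
  private
    S = + s * + s

  module Parameters (a : ℤ) (a≡ : a ≡ S * S * + t + ε) (2≤m : 0ℤ ≤ m - + 2) (S²m : S * S * m ≡ disc a) where

    1≤S² : 0ℤ ≤ S * S - 1ℤ
    1≤S² = go s
      where
      go : ∀ s .{{_ : NonZero s}} → 0ℤ ≤ + s * + s * (+ s * + s) - 1ℤ
      go (suc s) = 0≤n

    ε²≡1 : ε * ε ≡ 1ℤ
    ε²≡1 = go ε±1
      where
      go : ∀ {ε} → ε ≡ 1ℤ ⊎ ε ≡ -1ℤ → ε * ε ≡ 1ℤ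
      go (inj₁ refl) = refl
      go (inj₂ refl) = refl

    -- The difference is s⁴(t - 1) + (ε + 1). This is the size condition behind the minimality of η
    -- in the Pell descent.
    S²≤a+1 : 0ℤ ≤ a + 1ℤ - S * S
    S²≤a+1 = subst (λ a → 0ℤ ≤ a + 1ℤ - S * S) (sym a≡)
      (subst (0ℤ ≤_) (ring 3 (λ Q t ε → Q :* (t :- :1) :+ (ε :+ :1) := Q :* t :+ ε :+ :1 :- Q) refl (S * S) (+ t) ε)
        (0≤+ (0≤* (weaken {S * S} 1≤S²) (1≤t t)) (0≤ε+1 ε±1)))
      where
      1≤t : ∀ t .{{_ : NonZero t}} → 0ℤ ≤ + t - 1ℤ
      1≤t (suc t) = 0≤n
      0≤ε+1 : ∀ {ε} → ε ≡ 1ℤ ⊎ ε ≡ -1ℤ → 0ℤ ≤ ε + 1ℤ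
      0≤ε+1 (inj₁ refl) = 0≤n
      0≤ε+1 (inj₂ refl) = 0≤n

    0≤a′ : 0ℤ ≤ a
    0≤a′ = subst (0ℤ ≤_) (ring 2 (λ a Q → a :+ :1 :- Q :+ (Q :- :1) := a) refl a (S * S)) (0≤+ S²≤a+1 1≤S²)

    -- Otherwise a⁴ - 1 ≤ 0, although it equals s⁴m ≥ 2.
    2≤a : 0ℤ ≤ a - + 2
    2≤a = go (sign? (a - + 2))
      where
      identity : ∀ a Q m → (Q - 1ℤ) * (m - + 2 + + 2) + (m - + 2) + 1ℤ + (- (a - + 2) - 1ℤ) * ((1ℤ + a) * (1ℤ + a * a)) ≡
        -1ℤ + 1ℤ * (Q * m - (a * a * (a * a) - 1ℤ))
      identity = ring 3 (λ a Q m → (Q :- :1) :* (m :- :2 :+ :2) :+ (m :- :2) :+ :1 :+ (:- (a :- :2) :- :1) :* ((:1 :+ a) :* (:1 :+ a :* a)) :=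
        con -1ℤ :+ :1 :* (Q :* m :- (a :* a :* (a :* a) :- :1))) refl
      go : 0ℤ ≤ a - + 2 ⊎ 0ℤ ≤ - (a - + 2) - 1ℤ → 0ℤ ≤ a - + 2
      go (inj₁ h) = h
      go (inj₂ h) = ⊥-elim (¬0≤-1
        (0≤+ (0≤+ (0≤+ (0≤* 1≤S² (0≤+ 2≤m (0≤n {2}))) 2≤m) (0≤n {1})) (0≤* h (0≤* (0≤+ (0≤n {1}) 0≤a′) (0≤+ (0≤n {1}) (0≤i*i a)))))
        (modulo 1ℤ (identity a (S * S) m) S²m))

    S²≢0 : S * S ≢ 0ℤ
    S²≢0 eq = ¬0≤-1 1≤S² (cong (_- 1ℤ) eq)

    -- As ε² = 1, a⁴ - 1 = (a - ε)(a + ε)(a² + 1), and a - ε = s⁴t cancels against s⁴.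
    m-factors : m ≡ + t * (a + ε) * (a * a + 1ℤ)
    m-factors = ℤ.*-cancelˡ-≡ (S * S) m (+ t * (a + ε) * (a * a + 1ℤ)) {{ℤ.≢-nonZero S²≢0}}
      (modulo 1ℤ (modulo ((a + ε) * (a * a + 1ℤ)) (modulo (a * a + 1ℤ) (identity (S * S) (+ t) ε a m) ε²≡1) a≡) S²m)
      where
      identity : ∀ Q t ε a m → Q * m ≡ Q * (t * (a + ε) * (a * a + 1ℤ)) + 1ℤ * (Q * m - (a * a * (a * a) - 1ℤ))
        + (a + ε) * (a * a + 1ℤ) * (a - (Q * t + ε)) + (a * a + 1ℤ) * (ε * ε - 1ℤ)
      identity = ring 5 (λ Q t ε a m → Q :* m := Q :* (t :* (a :+ ε) :* (a :* a :+ :1)) :+ :1 :* (Q :* m :- (a :* a :* (a :* a) :- :1))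
        :+ (a :+ ε) :* (a :* a :+ :1) :* (a :- (Q :* t :+ ε)) :+ (a :* a :+ :1) :* (ε :* ε :- :1)) refl

    odd⇒4∣m : ∀ h → a ≡ 1ℤ + + 2 * h → ∃ λ k → m ≡ + 4 * k
    odd⇒4∣m h a-odd = go ε±1
      where
      go : ε ≡ 1ℤ ⊎ ε ≡ -1ℤ → ∃ λ k → m ≡ + 4 * k
      go (inj₁ ε≡) = + t * (h + 1ℤ) * (+ 2 * (h * h) + + 2 * h + 1ℤ) , trans m-factors
        (trans (cong₂ (λ a ε → + t * (a + ε) * (a * a + 1ℤ)) a-odd ε≡)
          (ring 2 (λ t h → let a = :1 :+ :2 :* h in t :* (a :+ :1) :* (a :* a :+ :1) := :4 :* (t :* (h :+ :1) :* (:2 :* (h :* h) :+ :2 :* h :+ :1))) refl (+ t) h))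
      go (inj₂ ε≡) = + t * h * (+ 2 * (h * h) + + 2 * h + 1ℤ) , trans m-factors
        (trans (cong₂ (λ a ε → + t * (a + ε) * (a * a + 1ℤ)) a-odd ε≡)
          (ring 2 (λ t h → let a = :1 :+ :2 :* h in t :* (a :+ con -1ℤ) :* (a :* a :+ :1) := :4 :* (t :* h :* (:2 :* (h :* h) :+ :2 :* h :+ :1))) refl (+ t) h))

    -- The residue 2 is excluded by the parity of a: if a is even, s⁴m = a⁴ - 1 is odd; if a is odd,
    -- a + ε and a² + 1 are even and 4 divides m.
    m≡3[4] : m % + 4 ≡ 2 ⊎ m % + 4 ≡ 3 → ∃ λ q → m ≡ + 3 + + 4 * q
    m≡3[4] (inj₂ r≡3) = q , trans (ℤ.a≡a%n+[a/n]*n m (+ 4)) (trans (cong (λ r → + r + q * + 4) r≡3) (cong (λ z → + 3 + z) (ℤ.*-comm q (+ 4))))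
      where q = m ℤ./ + 4
    m≡3[4] (inj₁ r≡2) = ⊥-elim (go (parityℤ a))
      where
      q = m ℤ./ + 4
      m≡ : m ≡ + 2 + q * + 4
      m≡ = trans (ℤ.a≡a%n+[a/n]*n m (+ 4)) (cong (λ r → + r + q * + 4) r≡2)

      go : (∃ λ h → a ≡ + 2 * h ⊎ a ≡ 1ℤ + + 2 * h) → ⊥
      go (h , inj₁ a≡2h) = odd≢0 (S * S * (1ℤ + + 2 * q) - + 8 * (h * h * (h * h)))
        (modulo 1ℤ (identity (S * S) q h) (trans (cong (S * S *_) (sym m≡)) (trans S²m (cong disc a≡2h))))
        where
        identity : ∀ Q q h → let a = + 2 * h in 1ℤ + + 2 * (Q * (1ℤ + + 2 * q) - + 8 * (h * h * (h * h))) ≡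
          0ℤ + 1ℤ * (Q * (+ 2 + q * + 4) - (a * a * (a * a) - 1ℤ))
        identity = ring 3 (λ Q q h → let a = :2 :* h in :1 :+ :2 :* (Q :* (:1 :+ :2 :* q) :- :8 :* (h :* h :* (h :* h))) :=
          :0 :+ :1 :* (Q :* (:2 :+ q :* :4) :- (a :* a :* (a :* a) :- :1))) refl
      go (h , inj₂ a-odd) = finish (odd⇒4∣m h a-odd)
        where
        finish : (∃ λ k → m ≡ + 4 * k) → ⊥
        finish (k , m≡4k) = *-≢0 2≢0 (odd≢0 (q - k))
          (modulo 1ℤ (ring 2 (λ q k → :2 :* (:1 :+ :2 :* (q :- k)) := :0 :+ :1 :* (:2 :+ q :* :4 :- :4 :* k)) refl q k)
            (trans (sym m≡) m≡4k))

    open SquareSolutions a s m 2≤a S²m S²≤a+1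

    data Coefficients (x y z : ℤ) : Set where
      trivial   : x * x ≡ 1ℤ → y ≡ 0ℤ → z ≡ 0ℤ → Coefficients x y z
      nontrivial : ∀ σ → σ ≡ 1ℤ ⊎ σ ≡ -1ℤ → x ≡ σ * (a * a) → z ≡ σ * S →
        y ≡ a * + s ⊎ y ≡ - (a * + s) → Coefficients x y z

    square-roots : ∀ x y → x * x ≡ y * y → x ≡ y ⊎ x ≡ - y
    square-roots x y eq = go (ℤ.i*j≡0⇒i≡0∨j≡0 (x - y) (modulo 1ℤ (ring 2 (λ x y → (x :- y) :* (x :+ y) := :0 :+ :1 :* (x :* x :- y :* y)) refl x y) eq))
      where
      go : x - y ≡ 0ℤ ⊎ x + y ≡ 0ℤ → x ≡ y ⊎ x ≡ - y
      go (inj₁ p) = inj₁ (modulo 1ℤ (ring 2 (λ x y → x := y :+ :1 :* (x :- y :- :0)) refl x y) p)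
      go (inj₂ p) = inj₂ (modulo 1ℤ (ring 2 (λ x y → x := :- y :+ :1 :* (x :+ y :- :0)) refl x y) p)

    coefficients : ∀ x y z → x * x - m * (z * z) ≡ 1ℤ → y * y - x * z ≡ 0ℤ → Coefficients x y z
    coefficients x y z N Q = go (zero-or-square z)
      where
      abs² : ∀ i → + ∣ i ∣ * + ∣ i ∣ ≡ i * i
      abs² (+ n) = refl
      abs² -[1+ n ] = refl

      y²≡xz : y * y ≡ x * z
      y²≡xz = ℤ.i-j≡0⇒i≡j (y * y) (x * z) Q

      go : z ≡ 0ℤ ⊎ 0ℤ ≤ z * z - 1ℤ → Coefficients x y z
      go (inj₁ z≡0) = trivial
        (modulo 1ℤ (modulo (m * z) (ring 3 (λ m x z → x :* x := :1 :+ :1 :* (x :* x :- m :* (z :* z) :- :1) :+ m :* z :* (z :- :0)) refl m x z) z≡0) N)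
        (case-zero (ℤ.i*j≡0⇒i≡0∨j≡0 y (trans y²≡xz (trans (cong (x *_) z≡0) (ℤ.*-zeroʳ x))))) z≡0
        where
        case-zero : ∀ {i} → i ≡ 0ℤ ⊎ i ≡ 0ℤ → i ≡ 0ℤ
        case-zero (inj₁ p) = p
        case-zero (inj₂ p) = p
      go (inj₂ 1≤z²) = signs (square-root-of x (a * a) (proj₁ solved)) (square-root-of z S (proj₂ solved))
        where
        1≤abs : ∀ i → 0ℤ ≤ i * i - 1ℤ → 0ℤ ≤ + ∣ i ∣ - 1ℤ
        1≤abs (+ suc _) _ = 0≤n
        1≤abs -[1+ _ ] _ = 0≤n

        1≤x² : 0ℤ ≤ x * x - 1ℤ
        1≤x² = subst (0ℤ ≤_) (sym (modulo 1ℤ (ring 3 (λ m x z → x :* x :- :1 := (m :- :2 :+ :2) :* (z :* z) :+ :1 :* (x :* x :- m :* (z :* z) :- :1)) refl m x z) N))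
          (0≤* (0≤+ 2≤m (0≤n {2})) (0≤i*i z))

        solved : + ∣ x ∣ ≡ a * a × + ∣ z ∣ ≡ S
        solved = solve (∣ x ∣) (∣ z ∣) (∣ y ∣) (1≤abs x 1≤x²) (1≤abs z 1≤z²)
          (trans (cong₂ (λ i j → i - m * j) (abs² x) (abs² z)) N)
          (trans (sym (ℤ.abs-* y y)) (trans (cong ∣_∣ y²≡xz) (ℤ.abs-* x z)))

        square-root-of : ∀ i j → + ∣ i ∣ ≡ j → i ≡ j ⊎ i ≡ - j
        square-root-of i j eq = square-roots i j (trans (sym (abs² i)) (cong (λ k → k * k) eq))

        y-root : y * y ≡ a * a * S → y ≡ a * + s ⊎ y ≡ - (a * + s)
        y-root eq = square-roots y (a * + s) (trans eq (ring 2 (λ a s → a :* a :* (s :* s) := a :* s :* (a :* s)) refl a (+ s)))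

        -- Opposite signs of x and z would make y² equal to -(a s)², which is negative.
        opposite : y * y ≡ - (a * a * S) → ⊥
        opposite eq = *-≢0 (*-≢0 a≢0 s≢0) (*-≢0 a≢0 s≢0) (0≤-antisym (0≤i*i (a * + s))
          (subst (0ℤ ≤_) (trans eq (ring 2 (λ a s → :- (a :* a :* (s :* s)) := :- (a :* s :* (a :* s))) refl a (+ s))) (0≤i*i y)))
          where
          a≢0 : a ≢ 0ℤ
          a≢0 = QuarticEquation.a≢0 a 2≤a
          s≢0 : + s ≢ 0ℤ
          s≢0 eq = S²≢0 (cong (λ i → i * i * (i * i)) eq)

        signs : x ≡ a * a ⊎ x ≡ - (a * a) → z ≡ S ⊎ z ≡ - S → Coefficients x y z
        signs (inj₁ x≡) (inj₁ z≡) = nontrivial 1ℤ (inj₁ refl) (trans x≡ (sym (ℤ.*-identityˡ (a * a)))) (trans z≡ (sym (ℤ.*-identityˡ S)))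
          (y-root (trans y²≡xz (cong₂ _*_ x≡ z≡)))
        signs (inj₂ x≡) (inj₂ z≡) = nontrivial -1ℤ (inj₂ refl) (trans x≡ (sym (ℤ.-1*i≡-i (a * a)))) (trans z≡ (sym (ℤ.-1*i≡-i S)))
          (y-root (trans y²≡xz (trans (cong₂ _*_ x≡ z≡) (ring 2 (λ x z → :- x :* :- z := x :* z) refl (a * a) S))))
        signs (inj₁ x≡) (inj₂ z≡) = ⊥-elim (opposite (trans y²≡xz (trans (cong₂ _*_ x≡ z≡) (ring 2 (λ x z → x :* :- z := :- (x :* z)) refl (a * a) S))))
        signs (inj₂ x≡) (inj₁ z≡) = ⊥-elim (opposite (trans y²≡xz (trans (cong₂ _*_ x≡ z≡) (ring 2 (λ x z → :- x :* z := :- (x :* z)) refl (a * a) S))))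

-- The list of generators

^4≡ : ∀ i → i ^ 4 ≡ i * i * (i * i)
^4≡ = ring 1 (λ i → i :* (i :* (i :* (i :* :1))) := i :* i :* (i :* i)) refl

^2≡ : ∀ i → i ^ 2 ≡ i * i
^2≡ = ring 1 (λ i → i :* (i :* :1) := i :* i) refl

-- Both conditions are quadratic in the coefficients of α, α², α³, so a common change of sign
-- preserves them.
equivalent-conditions : ∀ m γ x y z → x * x - m * (z * z) ≡ 1ℤ → y * y - x * z ≡ 0ℤ → Equivalent γ (ϑ x y z) →
  c1 γ * c1 γ - m * (c3 γ * c3 γ) ≡ 1ℤ × c2 γ * c2 γ - c1 γ * c3 γ ≡ 0ℤ
equivalent-conditions _ ⟨ _ , x , y , z ⟩ _ _ _ N Q (inj₁ (refl , refl , refl)) = N , Q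
equivalent-conditions m ⟨ _ , _ , _ , _ ⟩ x y z N Q (inj₂ (refl , refl , refl)) =
    trans (ring 3 (λ m x z → :- x :* :- x :- m :* (:- z :* :- z) := x :* x :- m :* (z :* z)) refl m x z) N
  , trans (ring 3 (λ x y z → :- y :* :- y :- :- x :* :- z := y :* y :- x :* z) refl x y z) Q

theorem3 : (s t : ℕ) → NonZero s → NonZero t → (ε : ℤ) → (ε ≡ 1ℤ ⊎ ε ≡ -1ℤ) →
    (m : ℤ) → (+ s) ^ 4 * m ≡ ((+ s) ^ 4 * + t + ε) ^ 4 - 1ℤ →
    SquareFree m → 1ℤ < m → (m % + 4 ≡ 2 ⊎ m % + 4 ≡ 3) →
    (γ : ZK) →
    (GeneratesPowerIntegralBasis m γ
    ⇔ (Equivalent γ (ϑ 1ℤ (+ 0) (+ 0))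
    ⊎ Equivalent γ (ϑ (((+ s) ^ 4 * + t + ε) ^ 2) (((+ s) ^ 4 * + t + ε) * + s) ((+ s) ^ 2))
    ⊎ Equivalent γ (ϑ (((+ s) ^ 4 * + t + ε) ^ 2) (- (((+ s) ^ 4 * + t + ε) * + s)) ((+ s) ^ 2))))
theorem3 s t s≢0 t≢0 ε ε±1 m s⁴m _ 1<m m%4 γ = main ((+ s) ^ 4 * + t + ε) refl s⁴m
  where
  2≤m : 0ℤ ≤ m - + 2
  2≤m = ℤ.i≤j⇒0≤j-i (ℤ.i<j⇒suc[i]≤j 1<m)

  main : ∀ a → (+ s) ^ 4 * + t + ε ≡ a → (+ s) ^ 4 * m ≡ a ^ 4 - 1ℤ →
    GeneratesPowerIntegralBasis m γ
    ⇔ (Equivalent γ (ϑ 1ℤ (+ 0) (+ 0))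
    ⊎ Equivalent γ (ϑ (a ^ 2) (a * + s) ((+ s) ^ 2))
    ⊎ Equivalent γ (ϑ (a ^ 2) (- (a * + s)) ((+ s) ^ 2)))
  main a a≡ s⁴m = mk⇔ (λ basis → forward (generator⇒ m γ 2≤m basis)) backward
    where
    S = + s * + s

    S²m : S * S * m ≡ disc a
    S²m = trans (cong (_* m) (sym (^4≡ (+ s)))) (trans s⁴m (cong (_- 1ℤ) (^4≡ a)))

    open Parameters s t {{s≢0}} {{t≢0}} ε ε±1 m a
      (trans (sym a≡) (cong (λ i → i * + t + ε) (^4≡ (+ s)))) 2≤m S²m

    Target = Equivalent γ (ϑ 1ℤ (+ 0) (+ 0))
      ⊎ Equivalent γ (ϑ (a ^ 2) (a * + s) ((+ s) ^ 2))
      ⊎ Equivalent γ (ϑ (a ^ 2) (- (a * + s)) ((+ s) ^ 2))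

    classify : Coefficients (c1 γ) (c2 γ) (c3 γ) → Target
    classify (trivial x²≡1 y≡0 z≡0) = go (unit-signs (c1 γ) (c1 γ) x²≡1)
      where
      go : c1 γ ≡ 1ℤ ⊎ c1 γ ≡ -1ℤ → Target
      go (inj₁ x≡) = inj₁ (inj₁ (x≡ , y≡0 , z≡0))
      go (inj₂ x≡) = inj₁ (inj₂ (x≡ , y≡0 , z≡0))
    classify (nontrivial _ (inj₁ refl) x≡ z≡ y≡) = go y≡
      where
      x≡′ : c1 γ ≡ a ^ 2
      x≡′ = trans x≡ (trans (ℤ.*-identityˡ (a * a)) (sym (^2≡ a)))
      z≡′ : c3 γ ≡ (+ s) ^ 2
      z≡′ = trans z≡ (trans (ℤ.*-identityˡ S) (sym (^2≡ (+ s))))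
      go : c2 γ ≡ a * + s ⊎ c2 γ ≡ - (a * + s) → Target
      go (inj₁ y≡) = inj₂ (inj₁ (inj₁ (x≡′ , y≡ , z≡′)))
      go (inj₂ y≡) = inj₂ (inj₂ (inj₁ (x≡′ , y≡ , z≡′)))
    classify (nontrivial _ (inj₂ refl) x≡ z≡ y≡) = go y≡
      where
      x≡′ : c1 γ ≡ - (a ^ 2)
      x≡′ = trans x≡ (trans (ℤ.-1*i≡-i (a * a)) (cong -_ (sym (^2≡ a))))
      z≡′ : c3 γ ≡ - ((+ s) ^ 2)
      z≡′ = trans z≡ (trans (ℤ.-1*i≡-i S) (cong -_ (sym (^2≡ (+ s)))))
      -- Negating γ to match x = a² and z = s² also negates y, so the two signs of y change places.
      go : c2 γ ≡ a * + s ⊎ c2 γ ≡ - (a * + s) → Target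
      go (inj₁ y≡) = inj₂ (inj₂ (inj₂ (x≡′ , trans y≡ (sym (ℤ.neg-involutive (a * + s))) , z≡′)))
      go (inj₂ y≡) = inj₂ (inj₁ (inj₂ (x≡′ , y≡ , z≡′)))

    forward : (c1 γ * c1 γ - m * (c3 γ * c3 γ) ≡ 1ℤ ⊎ c1 γ * c1 γ - m * (c3 γ * c3 γ) ≡ -1ℤ) × c2 γ * c2 γ - c1 γ * c3 γ ≡ 0ℤ → Target
    forward (inj₁ N , Q) = classify (coefficients (c1 γ) (c2 γ) (c3 γ) N Q)
    forward (inj₂ N , _) = ⊥-elim (impossible (m≡3[4] m%4))
      where
      impossible : (∃ λ q → m ≡ + 3 + + 4 * q) → ⊥
      impossible (q , m≡) = no-norm-minus-one q (c1 γ) (c3 γ) (trans (cong (λ i → c1 γ * c1 γ - i * (c3 γ * c3 γ)) (sym m≡)) N)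

    norm≡1 : a ^ 2 * a ^ 2 - m * ((+ s) ^ 2 * (+ s) ^ 2) ≡ 1ℤ
    norm≡1 = trans (cong₂ (λ A B → A * A - m * (B * B)) (^2≡ a) (^2≡ (+ s)))
      (modulo -1ℤ (ring 3 (λ a S m → a :* a :* (a :* a) :- m :* (S :* S) := :1 :+ con -1ℤ :* (S :* S :* m :- (a :* a :* (a :* a) :- :1))) refl a S m) S²m)

    product≡ : ∀ y → y * y ≡ a * + s * (a * + s) → y * y - a ^ 2 * (+ s) ^ 2 ≡ 0ℤ
    product≡ y y² = trans (cong₂ (λ u v → u - v) y² (cong₂ _*_ (^2≡ a) (^2≡ (+ s))))
      (ring 2 (λ a s → a :* s :* (a :* s) :- a :* a :* (s :* s) := :0) refl a (+ s))

    generates : c1 γ * c1 γ - m * (c3 γ * c3 γ) ≡ 1ℤ × c2 γ * c2 γ - c1 γ * c3 γ ≡ 0ℤ → GeneratesPowerIntegralBasis m γ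
    generates (N , Q) = ⇒generator m γ N Q

    backward : Target → GeneratesPowerIntegralBasis m γ
    backward (inj₁ e) = generates (equivalent-conditions m γ 1ℤ 0ℤ 0ℤ (ring 1 (λ m → :1 :* :1 :- m :* (:0 :* :0) := :1) refl m) refl e)
    backward (inj₂ (inj₁ e)) = generates (equivalent-conditions m γ (a ^ 2) (a * + s) ((+ s) ^ 2) norm≡1 (product≡ (a * + s) refl) e)
    backward (inj₂ (inj₂ e)) = generates (equivalent-conditions m γ (a ^ 2) (- (a * + s)) ((+ s) ^ 2) norm≡1
      (product≡ (- (a * + s)) (ring 1 (λ i → :- i :* :- i := i :* i) refl (a * + s))) e)
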